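{- Let $\Sigma$ be a self-converse oriented graph on $n$ vertices with walk-matrix $W(\Sigma)$. Suppose that the Smith normal form of $W(\Sigma)$ is $$\mathrm{diag}(\underbrace{1,1,\ldots,1}_{\lceil n/2\rceil},\underbrace{2,2,\ldots,2,2d}_{\lfloor n/2\rfloor}),$$ i.e. the first $\lceil n/2\rceil$ diagonal entries equal $1$, the next $\lfloor n/2\rfloor-1$ entries equal $2$, and the last entry equals $2d$, where $d$ is any odd integer (not necessarily square-free). Then $\Sigma$ is determined by its generalized skew spectrum (DGSS).
   Context: An oriented graph $\Sigma$ on vertex set $\{v_1,\dots,v_n\}$ is a simple graph in which every edge has been given a direction. Its skew adjacency matrix $S=S(\Sigma)=(S_{ij})$ is the $n\times n$ matrix with $S_{ij}=1$ if $(v_i,v_j)$ is a (directed) edge, $S_{ij}=-1$ if $(v_j,v_i)$ is an edge, and $S_{ij}=0$ otherwise; thus $S^{\mathrm T}=-S$. The walk-matrix of $\Sigma$ is $W(\Sigma)=[e,Se,S^2e,\ldots,S^{n-1}e]$, where $e$ is the all-ones vector. The converse $\Sigma^{\mathrm T}$ is obtained by reversing every edge; $\Sigma$ is self-converse if it is isomorphic to $\Sigma^{\mathrm T}$, equivalently if there is a permutation matrix $P$ with $P^{\mathrm T}SP=S^{\mathrm T}=-S$. $\Sigma$ is determined by its generalized skew spectrum (DGSS) if every oriented graph $\Delta$ with $\mathrm{Spec}(S(\Sigma))=\mathrm{Spec}(S(\Delta))$ and $\mathrm{Spec}(J-S(\Sigma))=\mathrm{Spec}(J-S(\Delta))$ (where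 $J$ is the all-ones matrix) is isomorphic to $\Sigma$. The Smith normal form of a nonsingular integer matrix $M$ is the unique diagonal matrix $\mathrm{diag}(d_1,\ldots,d_n)$ with positive integers $d_i\mid d_{i+1}$ such that $M=U_1\,\mathrm{diag}(d_1,\dots,d_n)\,U_2$ for some integer matrices $U_1,U_2$ of determinant $\pm1$. -}

module Defs where

open import Level using (Level; 0ℓ; _⊔_) renaming (suc to lsuc)
open import Algebra.Bundles using (CommutativeRing; Semiring)
open import Algebra.Apartness.Bundles using (HeytingField; HeytingCommutativeRing)
import Algebra.Definitions.RawSemiring as RawSemiringDefinitions
open import Data.Bool.Base using (if_then_else_)
open import Data.Fin.Base using (Fin; zero; suc; toℕ; punchIn)
import Data.Fin.Properties as Fin
open import Data.Integer.Base using (ℤ; +_; -[1+_]; 0ℤ; 1ℤ; -1ℤ)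
import Data.Integer.Base as ℤ
open import Data.Integer.Divisibility using (_∣_)
import Data.Integer.Properties as ℤ
open import Data.List.Base using (List; length; map; foldr)
import Data.List.Relation.Binary.Permutation.Setoid as Permutation
open import Data.Nat.Base using (ℕ; zero; suc; ⌈_/2⌉)
import Data.Nat.Properties as ℕ
open import Data.Product.Base using (∃; ∃₂; _×_)
open import Data.Sum.Base using (_⊎_)
open import Data.Vec.Functional using (Vector)
open import Function.Base using (flip)
open import Function.Bundles using (_↔_; _⇔_; Inverse)
open import Relation.Binary.Core using (Rel)
open import Relation.Binary.Definitions using (Asymmetric; Decidable)
open import Relation.Binary.PropositionalEquality using (_≡_)
open import Relation.Nullary.Decidable.Core using (does)
open import Relation.Nullary.Negation.Core using (¬_)

private
  variable
    c ℓ₁ ℓ₂ : Level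
    m n : ℕ

Matrix : Set c → ℕ → Set c
Matrix A n = Fin n → Fin n → A

module MatrixOps (R : CommutativeRing c ℓ₁) where
  open CommutativeRing R hiding (zero)
  open RawSemiringDefinitions (Semiring.rawSemiring semiring) public using (sum; _^_)

  diag : Vector Carrier n → Matrix Carrier n
  diag d i j = if does (i Fin.≟ j) then d i else 0#

  𝟙 : Matrix Carrier n
  𝟙 = diag (λ _ → 1#)

  infixl 7 _⊗_
  _⊗_ : Matrix Carrier n → Matrix Carrier n → Matrix Carrier n
  (A ⊗ B) i k = sum (λ j → A i j * B j k)

  infixr 7 _⊗ᵥ_
  _⊗ᵥ_ : Matrix Carrier n → Vector Carrier n → Vector Carrier n
  (A ⊗ᵥ v) i = sum (λ j → A i j * v j)

  power : Matrix Carrier n → ℕ → Matrix Carrier n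
  power A zero    = 𝟙
  power A (suc k) = A ⊗ power A k

  -- Laplace expansion along the first row.
  det : Matrix Carrier n → Carrier
  det {zero}  A = 1#
  det {suc n} A =
    sum (λ j → (- 1#) ^ toℕ j * (A zero j * det (λ i k → A (suc i) (punchIn j k))))

module ℤᴹ = MatrixOps ℤ.+-*-commutativeRing

-- Asymmetry excludes both loops and pairs of opposite arcs.
record OrientedGraph (n : ℕ) : Set₁ where
  field
    _⟶_  : Rel (Fin n) 0ℓ
    _⟶?_ : Decidable _⟶_
    asym : Asymmetric _⟶_

converse : OrientedGraph n → OrientedGraph n
converse Γ = record { _⟶_ = flip _⟶_ ; _⟶?_ = flip _⟶?_ ; asym = flip asym }
  where open OrientedGraph Γ

_≅_ : OrientedGraph m → OrientedGraph n → Set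
_≅_ {m} {n} Γ Δ =
  ∃ λ (f : Fin m ↔ Fin n) →
    ∀ i j → (i Γ.⟶ j) ⇔ (Inverse.to f i Δ.⟶ Inverse.to f j)
  where
  module Γ = OrientedGraph Γ
  module Δ = OrientedGraph Δ

SelfConverse : OrientedGraph n → Set
SelfConverse Γ = Γ ≅ converse Γ

skewAdjacency : OrientedGraph n → Matrix ℤ n
skewAdjacency Γ i j =
  if does (i ⟶? j) then 1ℤ else if does (j ⟶? i) then -1ℤ else 0ℤ
  where open OrientedGraph Γ

J-_ : Matrix ℤ n → Matrix ℤ n
(J- A) i j = 1ℤ ℤ.- A i j

walkMatrix : OrientedGraph n → Matrix ℤ n
walkMatrix Γ i k = (ℤᴹ.power (skewAdjacency Γ) (toℕ k) ℤᴹ.⊗ᵥ (λ _ → 1ℤ)) i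

Unimodular : Matrix ℤ n → Set
Unimodular U = ℤᴹ.det U ≡ 1ℤ ⊎ ℤᴹ.det U ≡ -1ℤ

record IsSmithNormalForm (M : Matrix ℤ n) (d : Vector ℤ n) : Set where
  field
    positive      : ∀ i → 0ℤ ℤ.< d i
    divides       : ∀ i j → toℕ j ≡ suc (toℕ i) → d i ∣ d j
    U₁ U₂         : Matrix ℤ n
    unimodular₁   : Unimodular U₁
    unimodular₂   : Unimodular U₂
    factorization : ∀ i j → M i j ≡ ((U₁ ℤᴹ.⊗ ℤᴹ.diag d) ℤᴹ.⊗ U₂) i j

Odd : ℤ → Set
Odd d = ¬ (+ 2 ∣ d)

-- (1, …, 1, 2, …, 2, 2d) with ⌈n/2⌉ ones.  For n ≤ 1 the second block is empty
-- and d does not occur.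
ones-twos-2d : ∀ n → ℤ → Vector ℤ n
ones-twos-2d n d i =
  if does (toℕ i ℕ.<? ⌈ n /2⌉) then 1ℤ
  else if does (suc (toℕ i) ℕ.≟ n) then + 2 ℤ.* d
  else + 2

-- Algebraically closed fields of characteristic zero; these stand in for ℂ as
-- the field in which eigenvalues are taken.
record AlgClosedField₀ c ℓ₁ ℓ₂ : Set (lsuc (c ⊔ ℓ₁ ⊔ ℓ₂)) where
  field
    heytingField : HeytingField c ℓ₁ ℓ₂

  commutativeRing : CommutativeRing c ℓ₁
  commutativeRing =
    HeytingCommutativeRing.commutativeRing (HeytingField.heytingCommutativeRing heytingField)

  open CommutativeRing commutativeRing public hiding (zero)
  open RawSemiringDefinitions (Semiring.rawSemiring semiring) public using (sum; _^_) renaming (_×_ to _·_)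

  field
    characteristicZero : ∀ k → k · 1# ≈ 0# → k ≡ 0
    -- Every monic polynomial of degree k + 1 has a root.
    algebraicallyClosed : ∀ k (a : Vector Carrier (suc k)) →
      ∃ λ x → x ^ suc k + sum (λ i → a i * x ^ toℕ i) ≈ 0#

  fromℤ : ℤ → Carrier
  fromℤ (+ k)    = k · 1#
  fromℤ -[1+ k ] = - (suc k · 1#)

module Spectrum (K : AlgClosedField₀ c ℓ₁ ℓ₂) where
  open AlgClosedField₀ K
  open MatrixOps commutativeRing using (𝟙; det)
  open Permutation setoid using (_↭_)

  charPoly : Matrix ℤ n → Carrier → Carrier
  charPoly A x = det (λ i j → x * 𝟙 i j - fromℤ (A i j))

  -- λs lists the eigenvalues with algebraic multiplicity: det (xI − A) = ∏ (x − λᵢ).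
  -- As K is infinite, this identity of polynomial functions is one of polynomials.
  IsSpectrum : Matrix ℤ n → List Carrier → Set (c ⊔ ℓ₁)
  IsSpectrum {n} A λs =
    length λs ≡ n × (∀ x → charPoly A x ≈ foldr _*_ 1# (map (λ μ → x - μ) λs))

  -- Equality of spectra as multisets; the two matrices may differ in size.
  Cospectral : Matrix ℤ m → Matrix ℤ n → Set (c ⊔ ℓ₁)
  Cospectral A B =
    ∃₂ λ λs μs → IsSpectrum A λs × IsSpectrum B μs × λs ↭ μs

  DGSS : OrientedGraph n → Set (lsuc 0ℓ ⊔ c ⊔ ℓ₁)
  DGSS Γ =
    ∀ {m} (Δ : OrientedGraph m) →
    Cospectral (skewAdjacency Γ) (skewAdjacency Δ) →
    Cospectral (J- skewAdjacency Γ) (J- skewAdjacency Δ) →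
    Δ ≅ Γ

{-# OPTIONS --safe #-}

-- Write S, T for the skew adjacency matrices of Γ, Δ, and W = A D B for the Smith
-- form of the walk matrix of Γ.  Evaluating the characteristic polynomials at 1/t and
-- working modulo powers of t shows that 1ᵀSᵏ1 = 1ᵀTᵏ1 for all k.  Hence the walk
-- matrices have the same Gram matrix, and Q = W(Δ) W⁻¹ is a rational orthogonal
-- matrix with Q S = T Q and Q 1 = 1; if Q is integral it is a permutation matrix.
-- Since D divides 2d, the matrix Θ = 2d Q is integral, and one has to show that d and
-- then 2 divide it.
--
-- For d: let v be the last row of A⁻¹.  Modulo a prime p ∣ d it spans the left kernel
-- of W.  The involution reversing Γ acts on v by the sign (−1)ⁿ⁻¹ and forces S v ≡ 0.
-- If p ∣ ⟨v, v⟩, then v is in the column space, v ≡ g(S) 1 where x g(x) is the minimal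
-- polynomial of 1, of degree n − 1 and of definite parity; so the involution would act
-- by (−1)ⁿ.  Hence ⟨v, v⟩ is prime to d.  A row θ of Θ is ≡ ξ v modulo d and has norm
-- (2d)², and completing the square gives d ∣ ξ.
--
-- For 2: a row u of 2Q is orthogonal mod 2 to the column space of W, hence up to a
-- factor is mod 2 a combination Σ xᵢ Sⁱ⁺ᵋ 1, i < ⌊n/2⌋, where ε = n mod 2.  As
-- ⟨u, S²ᵏu⟩ ≡ 0 mod 4, the cross terms cancel and Σ xᵢ 1ᵀS²⁽ⁱ⁺ᵋ⁾⁺²ᵏ1 ≡ 0 mod 4 for
-- all k, and the shape of D then makes every xᵢ even.
module Submission where

open import Defs
open import Algebra.Apartness.Bundles using (HeytingField)
open import Algebra.Bundles using (CommutativeRing)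
import Algebra.Properties.CommutativeMonoid.Sum as CommutativeMonoidSum
import Algebra.Properties.Ring as RingProperties
import Algebra.Properties.Semiring.Mult as SemiringMult
import Algebra.Properties.Semiring.Sum as SemiringSum
open import Data.Bool.Base using (Bool; true; false; if_then_else_)
open import Data.Fin.Base using (Fin; zero; suc; toℕ; fromℕ; fromℕ<; inject₁; punchIn; punchOut; splitAt; _↑ˡ_; _↑ʳ_)
open import Data.Fin.Induction using (>-weakInduction)
import Data.Fin.Properties as Fin
open import Data.Integer.Base using (ℤ; +_; -[1+_]; 0ℤ; 1ℤ; -1ℤ; _⊖_; ≢-nonZero)
import Data.Integer.Base as ℤ
open import Data.Integer.Divisibility.Signed
import Data.Integer.Properties as ℤ
open import Data.Integer.Tactic.RingSolver using (solve-∀)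
open import Data.List.Base using ([]; _∷_; map; foldr)
import Data.List.Relation.Binary.Permutation.Setoid.Properties as PermutationProperties
open import Data.List.Relation.Unary.All using (_∷_)
open import Data.Nat.Base as ℕ using (ℕ; zero; suc; z≤n; s≤s; ⌈_/2⌉)
open import Data.Nat.Coprimality using (Coprime; coprime-/gcd; coprime-divisor)
import Data.Nat.DivMod as ℕ
import Data.Nat.Divisibility as ℕ
open import Data.Nat.GCD using (gcd; gcd[m,n]∣m; gcd[m,n]∣n; gcd[m,n]≢0)
open import Data.Nat.Induction using (<-rec)
open import Data.Nat.ListAction using (product)
open import Data.Nat.Primality using (Prime; euclidsLemma; prime⇒nonTrivial; prime[2]; irreducible[2])
open import Data.Nat.Primality.Factorisation using (factorise)
import Data.Nat.Properties as ℕ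
import Data.Nat.Tactic.RingSolver as ℕSolver
open import Data.Product.Base using (∃; _×_; _,_; proj₁; proj₂)
open import Data.Sum.Base as Sum using (_⊎_; inj₁; inj₂)
open import Data.Vec.Functional using (Vector) renaming (_∷_ to _∷ᵥ_)
open import Function.Base using (_∘_)
open import Function.Bundles using (_↔_; Inverse; mk↔ₛ′; mk⇔)
open import Function.Construct.Identity using (↔-id)
open import Function.Construct.Symmetry using (↔-sym)
open import Level using (0ℓ; _⊔_)
open import Relation.Binary.Bundles using (Setoid)
open import Relation.Binary.Core using (REL)
open import Relation.Binary.Definitions using (tri<; tri≈; tri>)
open import Relation.Binary.PropositionalEquality as ≡ using (_≡_; _≢_; cong)
import Relation.Binary.Reasoning.Setoid as SetoidReasoning
open import Relation.Nullary.Decidable using (Dec; does; yes; no; ¬?; dec-true; dec-false; does-⇔; decidable-stable)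
open import Relation.Nullary.Negation using (contradiction; ¬_)
open ℤᴹ using (det; 𝟙)

-- A spectrum is a list in the field K, whereas all later arguments concern integers. The bridge is
-- det (I - tA) for integers t ≠ 0, which is an integer and equals tⁿ times the characteristic
-- polynomial at 1/t. Power series in t become congruences modulo powers of t, and an integer
-- divisible by every t > 0 is zero.
--
-- The two divisibilities differ in kind. Only the last invariant factor contains d, so modulo d the
-- matrix Θ has rank at most one and a single scalar per row decides. The obstacle is a prime common
-- to d and ⟨v, v⟩. The parity imposed by the reversal excludes each such prime, after which d is
-- removed in one step, repeated prime factors included. Modulo 2 the left kernel has dimension
-- ⌊n/2⌋, so there are many scalars per row, and the norms with respect to all even powers of S are
-- used together. Since d is odd, each entry of the second block of D is 2 times an odd number.
--
-- Dimension counts appear as m homogeneous equations in m + 1 unknowns, over ℤ or modulo 2.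

private
  variable
    m n : ℕ
    p : ℤ

-- Congruence of det, congruence modulo an integer and compatibility with ring
-- homomorphisms are all instances of this.
record RingRelation {c₁ ℓ₁ c₂ ℓ₂ ℓ} (R₁ : CommutativeRing c₁ ℓ₁) (R₂ : CommutativeRing c₂ ℓ₂)
  (_~_ : REL (CommutativeRing.Carrier R₁) (CommutativeRing.Carrier R₂) ℓ) : Set (c₁ ⊔ c₂ ⊔ ℓ) where
  private
    module R₁ = CommutativeRing R₁
    module R₂ = CommutativeRing R₂
    module M₁ = MatrixOps R₁
    module M₂ = MatrixOps R₂

  field
    ~-0   : R₁.0# ~ R₂.0#
    ~-1   : R₁.1# ~ R₂.1#
    ~-+   : ∀ {x y u v} → x ~ u → y ~ v → (x R₁.+ y) ~ (u R₂.+ v)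
    ~-*   : ∀ {x y u v} → x ~ u → y ~ v → (x R₁.* y) ~ (u R₂.* v)
    ~-neg : ∀ {x u} → x ~ u → (R₁.- x) ~ (R₂.- u)

  sum-~ : {f : Vector R₁.Carrier n} {g : Vector R₂.Carrier n} → (∀ i → f i ~ g i) → M₁.sum f ~ M₂.sum g
  sum-~ {n = zero}  f~g = ~-0
  sum-~ {n = suc n} f~g = ~-+ (f~g zero) (sum-~ (f~g ∘ suc))

  ^-~ : ∀ {x u} → x ~ u → ∀ k → (x M₁.^ k) ~ (u M₂.^ k)
  ^-~ x~u zero    = ~-1
  ^-~ x~u (suc k) = ~-* x~u (^-~ x~u k)

  det-~ : {A : Matrix R₁.Carrier n} {B : Matrix R₂.Carrier n} → (∀ i j → A i j ~ B i j) → M₁.det A ~ M₂.det B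
  det-~ {n = zero}  A~B = ~-1
  det-~ {n = suc n} A~B = sum-~ λ j → ~-* (^-~ (~-neg ~-1) (toℕ j))
    (~-* (A~B zero j) (det-~ (λ i k → A~B (suc i) (punchIn j k))))

-- From the field of eigenvalues to ℤ

module OverField {c ℓ₁ ℓ₂} (K : AlgClosedField₀ c ℓ₁ ℓ₂) where
  open AlgClosedField₀ K
  open Spectrum K
  open MatrixOps commutativeRing using () renaming (det to detᴷ; 𝟙 to 𝟙ᴷ)
  open RingProperties (CommutativeRing.ring commutativeRing)
    using (-0#≈0#; -‿distribˡ-*; -‿distribʳ-*; -‿involutive; -‿+-comm; x+x≈x⇒x≈0)
  open SemiringMult semiring using (×-homo-+)
  open SemiringSum semiring using (*-distribˡ-sum)
  open SetoidReasoning setoid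

  fromℤ-⊖ : ∀ k l → fromℤ (k ⊖ l) ≈ k · 1# - l · 1#
  fromℤ-⊖ zero    zero    = sym (-‿inverseʳ 0#)
  fromℤ-⊖ zero    (suc l) = sym (+-identityˡ _)
  fromℤ-⊖ (suc k) zero    = sym (trans (+-congˡ -0#≈0#) (+-identityʳ _))
  fromℤ-⊖ (suc k) (suc l) = begin
    fromℤ (suc k ⊖ suc l)                         ≡⟨ cong fromℤ (ℤ.[1+m]⊖[1+n]≡m⊖n k l) ⟩
    fromℤ (k ⊖ l)                                 ≈⟨ fromℤ-⊖ k l ⟩
    k · 1# - l · 1#                               ≈⟨ +-congˡ (+-identityˡ _) ⟨
    k · 1# + (0# - l · 1#)                        ≈⟨ +-congˡ (+-congʳ (-‿inverseʳ 1#)) ⟨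
    k · 1# + ((1# - 1#) - l · 1#)                 ≈⟨ +-congˡ (+-assoc 1# (- 1#) (- (l · 1#))) ⟩
    k · 1# + (1# + (- 1# - l · 1#))               ≈⟨ +-assoc (k · 1#) 1# (- 1# - l · 1#) ⟨
    (k · 1# + 1#) + (- 1# - l · 1#)               ≈⟨ +-cong (+-comm (k · 1#) 1#) (-‿+-comm 1# (l · 1#)) ⟩
    suc k · 1# - suc l · 1#                       ∎

  fromℤ-+ : ∀ i j → fromℤ (i ℤ.+ j) ≈ fromℤ i + fromℤ j
  fromℤ-+ (+ k)    (+ l)    = ×-homo-+ 1# k l
  fromℤ-+ (+ k)    -[1+ l ] = fromℤ-⊖ k (suc l)
  fromℤ-+ -[1+ k ] (+ l)    = trans (fromℤ-⊖ l (suc k)) (+-comm _ _)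
  fromℤ-+ -[1+ k ] -[1+ l ] = begin
    - (suc (suc (k ℕ.+ l)) · 1#)         ≡⟨ cong (λ q → - (suc q · 1#)) (ℕ.+-suc k l) ⟨
    - ((suc k ℕ.+ suc l) · 1#)           ≈⟨ -‿cong (×-homo-+ 1# (suc k) (suc l)) ⟩
    - (suc k · 1# + suc l · 1#)          ≈⟨ -‿+-comm (suc k · 1#) (suc l · 1#) ⟨
    - (suc k · 1#) + - (suc l · 1#)      ∎

  fromℤ-neg : ∀ i → fromℤ (ℤ.- i) ≈ - fromℤ i
  fromℤ-neg (+ zero)  = sym -0#≈0#
  fromℤ-neg (+ suc k) = refl
  fromℤ-neg -[1+ k ]  = sym (-‿involutive _)

  fromℤ-*ℕ : ∀ i l → fromℤ (i ℤ.* + l) ≈ fromℤ i * l · 1#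
  fromℤ-*ℕ i zero = trans (reflexive (cong fromℤ (ℤ.*-zeroʳ i))) (sym (zeroʳ (fromℤ i)))
  fromℤ-*ℕ i (suc l) = begin
    fromℤ (i ℤ.* + suc l)                  ≡⟨ cong fromℤ (ℤ.*-suc i (+ l)) ⟩
    fromℤ (i ℤ.+ i ℤ.* + l)                ≈⟨ fromℤ-+ i (i ℤ.* + l) ⟩
    fromℤ i + fromℤ (i ℤ.* + l)            ≈⟨ +-cong (sym (*-identityʳ (fromℤ i))) (fromℤ-*ℕ i l) ⟩
    fromℤ i * 1# + fromℤ i * l · 1#        ≈⟨ distribˡ (fromℤ i) 1# (l · 1#) ⟨
    fromℤ i * suc l · 1#                   ∎

  fromℤ-* : ∀ i j → fromℤ (i ℤ.* j) ≈ fromℤ i * fromℤ j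
  fromℤ-* i (+ l)    = fromℤ-*ℕ i l
  fromℤ-* i -[1+ l ] = begin
    fromℤ (i ℤ.* -[1+ l ])           ≡⟨ cong fromℤ (ℤ.neg-distribʳ-* i (+ suc l)) ⟨
    fromℤ (ℤ.- (i ℤ.* + suc l))      ≈⟨ fromℤ-neg (i ℤ.* + suc l) ⟩
    - fromℤ (i ℤ.* + suc l)          ≈⟨ -‿cong (fromℤ-*ℕ i (suc l)) ⟩
    - (fromℤ i * suc l · 1#)         ≈⟨ -‿distribʳ-* (fromℤ i) (suc l · 1#) ⟩
    fromℤ i * - (suc l · 1#)         ∎

  fromℤ-≈0 : ∀ i → fromℤ i ≈ 0# → i ≡ 0ℤ
  fromℤ-≈0 (+ k)    eq = cong +_ (characteristicZero k eq)
  fromℤ-≈0 -[1+ k ] eq with () ← characteristicZero (suc k)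
    (trans (sym (-‿involutive _)) (trans (-‿cong eq) -0#≈0#))

  fromℤ-injective : ∀ i j → fromℤ i ≈ fromℤ j → i ≡ j
  fromℤ-injective i j eq = ℤ.i-j≡0⇒i≡j i j (fromℤ-≈0 (i ℤ.- j) (begin
    fromℤ (i ℤ.- j)             ≈⟨ fromℤ-+ i (ℤ.- j) ⟩
    fromℤ i + fromℤ (ℤ.- j)     ≈⟨ +-cong eq (fromℤ-neg j) ⟩
    fromℤ j - fromℤ j           ≈⟨ -‿inverseʳ (fromℤ j) ⟩
    0#                          ∎))

  fromℤ-det : (A : Matrix ℤ n) → fromℤ (det A) ≈ detᴷ (λ i j → fromℤ (A i j))
  fromℤ-det A = RingRelation.det-~ {R₁ = ℤ.+-*-commutativeRing} {R₂ = commutativeRing} {_~_ = λ i x → fromℤ i ≈ x}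
    (record
      { ~-0   = refl
      ; ~-1   = +-identityʳ 1#
      ; ~-+   = λ {x} {y} p q → trans (fromℤ-+ x y) (+-cong p q)
      ; ~-*   = λ {x} {y} p q → trans (fromℤ-* x y) (*-cong p q)
      ; ~-neg = λ {x} p → trans (fromℤ-neg x) (-‿cong p) })
    {A = A} (λ i j → refl)

  ≈-relation : RingRelation commutativeRing commutativeRing _≈_
  ≈-relation = record { ~-0 = refl ; ~-1 = refl ; ~-+ = +-cong ; ~-* = *-cong ; ~-neg = -‿cong }

  open RingRelation ≈-relation using (sum-~) renaming (det-~ to detᴷ-cong)

  det-scale : (τ : Carrier) (M : Matrix Carrier n) → detᴷ (λ i j → τ * M i j) ≈ τ ^ n * detᴷ M
  det-scale {zero}  τ M = sym (*-identityˡ 1#)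
  det-scale {suc n} τ M = begin
    sum (λ j → sg j * ((τ * M zero j) * detᴷ (λ i k → τ * M (suc i) (punchIn j k))))
      ≈⟨ sum-~ (λ j → trans (*-congˡ (*-congˡ (det-scale τ (λ i k → M (suc i) (punchIn j k)))))
                        (regroup (sg j) τ (M zero j) (τ ^ n) (detᴷ (λ i k → M (suc i) (punchIn j k))))) ⟩
    sum (λ j → τ ^ suc n * (sg j * (M zero j * detᴷ (λ i k → M (suc i) (punchIn j k)))))
      ≈⟨ *-distribˡ-sum (τ ^ suc n) (λ j → sg j * (M zero j * detᴷ (λ i k → M (suc i) (punchIn j k)))) ⟨
    τ ^ suc n * detᴷ M ∎
    where
    sg : Fin (suc n) → Carrier
    sg j = (- 1#) ^ toℕ j
    regroup : ∀ s τ e τ′ d → s * ((τ * e) * (τ′ * d)) ≈ (τ * τ′) * (s * (e * d))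
    regroup s τ e τ′ d = begin
      s * ((τ * e) * (τ′ * d))    ≈⟨ *-congˡ (interchange τ e τ′ d) ⟩
      s * ((τ * τ′) * (e * d))    ≈⟨ *-assoc s (τ * τ′) (e * d) ⟨
      (s * (τ * τ′)) * (e * d)    ≈⟨ *-congʳ (*-comm s (τ * τ′)) ⟩
      ((τ * τ′) * s) * (e * d)    ≈⟨ *-assoc (τ * τ′) s (e * d) ⟩
      (τ * τ′) * (s * (e * d))    ∎
      where
      interchange : ∀ a b c d → (a * b) * (c * d) ≈ (a * c) * (b * d)
      interchange a b c d = begin
        (a * b) * (c * d)    ≈⟨ *-assoc a b (c * d) ⟩
        a * (b * (c * d))    ≈⟨ *-congˡ (*-assoc b c d) ⟨
        a * ((b * c) * d)    ≈⟨ *-congˡ (*-congʳ (*-comm b c)) ⟩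
        a * ((c * b) * d)    ≈⟨ *-congˡ (*-assoc c b d) ⟩
        a * (c * (b * d))    ≈⟨ *-assoc a c (b * d) ⟨
        (a * c) * (b * d)    ∎

  -- Pulling t out of every row turns I - tA into s I - A, where s plays the part of 1/t.
  det-reversed : ∀ t s → fromℤ t * s ≈ 1# → (A : Matrix ℤ n) →
    fromℤ (det (λ i j → 𝟙 i j ℤ.- t ℤ.* A i j)) ≈ fromℤ t ^ n * charPoly A s
  det-reversed {n} t s ts≈1 A = begin
    fromℤ (det (λ i j → 𝟙 i j ℤ.- t ℤ.* A i j))                ≈⟨ fromℤ-det (λ i j → 𝟙 i j ℤ.- t ℤ.* A i j) ⟩
    detᴷ (λ i j → fromℤ (𝟙 i j ℤ.- t ℤ.* A i j))               ≈⟨ detᴷ-cong entry ⟩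
    detᴷ (λ i j → fromℤ t * (s * 𝟙ᴷ i j - fromℤ (A i j)))      ≈⟨ det-scale (fromℤ t) (λ i j → s * 𝟙ᴷ i j - fromℤ (A i j)) ⟩
    fromℤ t ^ n * charPoly A s                                 ∎
    where
    τ = fromℤ t
    indicator : ∀ i j → fromℤ (𝟙 i j) ≈ 𝟙ᴷ i j
    indicator i j with does (i Fin.≟ j)
    ... | true  = +-identityʳ 1#
    ... | false = refl
    entry : ∀ i j → fromℤ (𝟙 i j ℤ.- t ℤ.* A i j) ≈ τ * (s * 𝟙ᴷ i j - fromℤ (A i j))
    entry i j = begin
      fromℤ (𝟙 i j ℤ.- t ℤ.* A i j)                    ≈⟨ fromℤ-+ (𝟙 i j) (ℤ.- (t ℤ.* A i j)) ⟩
      fromℤ (𝟙 i j) + fromℤ (ℤ.- (t ℤ.* A i j))        ≈⟨ +-cong (indicator i j)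
                                                            (trans (fromℤ-neg (t ℤ.* A i j)) (-‿cong (fromℤ-* t (A i j)))) ⟩
      𝟙ᴷ i j - τ * fromℤ (A i j)                       ≈⟨ +-cong (sym (trans (*-congʳ ts≈1) (*-identityˡ (𝟙ᴷ i j))))
                                                            (-‿distribʳ-* τ (fromℤ (A i j))) ⟩
      (τ * s) * 𝟙ᴷ i j + τ * - fromℤ (A i j)           ≈⟨ +-congʳ (*-assoc τ s (𝟙ᴷ i j)) ⟩
      τ * (s * 𝟙ᴷ i j) + τ * - fromℤ (A i j)           ≈⟨ distribˡ τ (s * 𝟙ᴷ i j) (- fromℤ (A i j)) ⟨
      τ * (s * 𝟙ᴷ i j - fromℤ (A i j))                 ∎

  cospectral-size : {A : Matrix ℤ m} {B : Matrix ℤ n} → Cospectral A B → m ≡ n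
  cospectral-size (λs , μs , (∣λs∣≡m , _) , (∣μs∣≡n , _) , λs↭μs) =
    ≡.trans (≡.sym ∣λs∣≡m) (≡.trans (PermutationProperties.xs↭ys⇒|xs|≡|ys| setoid λs↭μs) ∣μs∣≡n)

  cospectral-charPoly : {A : Matrix ℤ m} {B : Matrix ℤ n} → Cospectral A B → ∀ x → charPoly A x ≈ charPoly B x
  cospectral-charPoly {A = A} {B} (λs , μs , (_ , A≈) , (_ , B≈) , λs↭μs) x = begin
    charPoly A x                                   ≈⟨ A≈ x ⟩
    foldr _*_ 1# (map (λ μ → x - μ) λs)            ≈⟨ PermutationProperties.foldr-commMonoid setoid *-isCommutativeMonoid
                                                        (PermutationProperties.map⁺ setoid setoid (λ eq → +-congˡ (-‿cong eq)) λs↭μs) ⟩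
    foldr _*_ 1# (map (λ μ → x - μ) μs)            ≈⟨ B≈ x ⟨
    charPoly B x                                   ∎

  -- Integers are invertible in K only up to double negation, which is enough
  -- because equality of integers is decidable.
  cospectral-det : {A B : Matrix ℤ n} → Cospectral A B → ∀ t → t ≢ 0ℤ →
    det (λ i j → 𝟙 i j ℤ.- t ℤ.* A i j) ≡ det (λ i j → 𝟙 i j ℤ.- t ℤ.* B i j)
  cospectral-det {n} {A} {B} cospectral t t≢0 = decidable-stable (_ ℤ.≟ _) λ dets≢ →
    t≢0 (fromℤ-≈0 t (proj₁ (tight (fromℤ t) 0#) λ t#0 → dets≢ (invertible-case (#⇒invertible t#0))))
    where
    open HeytingField heytingField using (tight; #⇒invertible)
    invertible-case : (∃ λ s → (s * (fromℤ t - 0#) ≈ 1#) × ((fromℤ t - 0#) * s ≈ 1#)) →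
      det (λ i j → 𝟙 i j ℤ.- t ℤ.* A i j) ≡ det (λ i j → 𝟙 i j ℤ.- t ℤ.* B i j)
    invertible-case (s , _ , ts≈1) = fromℤ-injective _ _ (begin
      fromℤ (det (λ i j → 𝟙 i j ℤ.- t ℤ.* A i j))   ≈⟨ det-reversed t s ts≈1′ A ⟩
      fromℤ t ^ n * charPoly A s                    ≈⟨ *-congˡ (cospectral-charPoly {A = A} {B} cospectral s) ⟩
      fromℤ t ^ n * charPoly B s                    ≈⟨ det-reversed t s ts≈1′ B ⟨
      fromℤ (det (λ i j → 𝟙 i j ℤ.- t ℤ.* B i j))   ∎)
      where
      ts≈1′ : fromℤ t * s ≈ 1#
      ts≈1′ = trans (*-congʳ (sym (trans (+-congˡ -0#≈0#) (+-identityʳ (fromℤ t))))) ts≈1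

open import Data.Integer.Base using (_+_; _*_; -_; _-_)
open ≡ using (refl; sym; trans; cong₂; subst; subst₂; _≗_; module ≡-Reasoning)
open CommutativeRing ℤ.+-*-commutativeRing using (semiring; +-commutativeMonoid)
open SemiringSum semiring using (*-distribˡ-sum)
open CommutativeMonoidSum +-commutativeMonoid using (∑-distrib-+; ∑-comm; sum-permute; sum-init-last)
open ℤᴹ using (sum; diag; _⊗_; _⊗ᵥ_; power; _^_)

-- Vectors and bilinear pairing

sum-cong : {f g : Vector ℤ n} → (∀ i → f i ≡ g i) → sum f ≡ sum g
sum-cong {zero}  f≗g = refl
sum-cong {suc n} f≗g = cong₂ _+_ (f≗g zero) (sum-cong (f≗g ∘ suc))

sum-+ : (f g : Vector ℤ n) → sum (λ i → f i + g i) ≡ sum f + sum g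
sum-+ = ∑-distrib-+

sum-* : (c : ℤ) (f : Vector ℤ n) → sum (λ i → c * f i) ≡ c * sum f
sum-* c f = sym (*-distribˡ-sum c f)

sum-zero : {f : Vector ℤ n} → (∀ i → f i ≡ 0ℤ) → sum f ≡ 0ℤ
sum-zero {zero}  f≗0 = refl
sum-zero {suc n} f≗0 = cong₂ _+_ (f≗0 zero) (sum-zero (f≗0 ∘ suc))

sum-single : (j : Fin n) (f : Vector ℤ n) → (∀ i → i ≢ j → f i ≡ 0ℤ) → sum f ≡ f j
sum-single zero f f≗0 =
  trans (cong (_+_ (f zero)) (sum-zero (λ i → f≗0 (suc i) (λ ())))) (ℤ.+-identityʳ _)
sum-single (suc j) f f≗0 =
  trans (cong (_+ sum (f ∘ suc)) (f≗0 zero (λ ())))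
    (trans (ℤ.+-identityˡ _)
      (sum-single j (f ∘ suc) (λ i i≢j → f≗0 (suc i) (i≢j ∘ Fin.suc-injective))))

⟪_,_⟫ : Vector ℤ n → Vector ℤ n → ℤ
⟪ x , y ⟫ = sum (λ i → x i * y i)

_ᵀ : Matrix ℤ n → Matrix ℤ n
(A ᵀ) i j = A j i

⟪⟫-congʳ : (x : Vector ℤ n) {y y′ : Vector ℤ n} → y ≗ y′ → ⟪ x , y ⟫ ≡ ⟪ x , y′ ⟫
⟪⟫-congʳ x y≗y′ = sum-cong (λ i → cong (_*_ (x i)) (y≗y′ i))

⟪⟫-congˡ : (y : Vector ℤ n) {x x′ : Vector ℤ n} → x ≗ x′ → ⟪ x , y ⟫ ≡ ⟪ x′ , y ⟫
⟪⟫-congˡ y x≗x′ = sum-cong (λ i → cong (_* y i) (x≗x′ i))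

⟪⟫-comm : (x y : Vector ℤ n) → ⟪ x , y ⟫ ≡ ⟪ y , x ⟫
⟪⟫-comm x y = sum-cong (λ i → ℤ.*-comm (x i) (y i))

⟪⟫-+ʳ : (x y z : Vector ℤ n) → ⟪ x , (λ i → y i + z i) ⟫ ≡ ⟪ x , y ⟫ + ⟪ x , z ⟫
⟪⟫-+ʳ x y z = trans (sum-cong (λ i → ℤ.*-distribˡ-+ (x i) (y i) (z i)))
  (sum-+ (λ i → x i * y i) (λ i → x i * z i))

⟪⟫-*ʳ : (c : ℤ) (x y : Vector ℤ n) → ⟪ x , (λ i → c * y i) ⟫ ≡ c * ⟪ x , y ⟫
⟪⟫-*ʳ c x y = trans (sum-cong (λ i → swap (x i) c (y i))) (sum-* c (λ i → x i * y i))
  where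
  swap : ∀ a b c → a * (b * c) ≡ b * (a * c)
  swap = solve-∀

⟪⟫-linʳ : (a b : ℤ) (x y z : Vector ℤ n) →
  ⟪ x , (λ i → a * y i + b * z i) ⟫ ≡ a * ⟪ x , y ⟫ + b * ⟪ x , z ⟫
⟪⟫-linʳ a b x y z = trans (⟪⟫-+ʳ x (λ i → a * y i) (λ i → b * z i))
  (cong₂ _+_ (⟪⟫-*ʳ a x y) (⟪⟫-*ʳ b x z))

⟪⟫-linˡ : (a b : ℤ) (x y z : Vector ℤ n) →
  ⟪ (λ i → a * y i + b * z i) , x ⟫ ≡ a * ⟪ y , x ⟫ + b * ⟪ z , x ⟫
⟪⟫-linˡ a b x y z = trans (⟪⟫-comm _ x) (trans (⟪⟫-linʳ a b x y z)
  (cong₂ (λ s t → a * s + b * t) (⟪⟫-comm x y) (⟪⟫-comm x z)))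

⟪⟫-*ˡ : (c : ℤ) (x y : Vector ℤ n) → ⟪ (λ i → c * x i) , y ⟫ ≡ c * ⟪ x , y ⟫
⟪⟫-*ˡ c x y = trans (⟪⟫-comm _ y) (trans (⟪⟫-*ʳ c y x) (cong (c *_) (⟪⟫-comm y x)))

comb : Vector ℤ m → (Fin m → Vector ℤ n) → Vector ℤ n
comb c b i = sum (λ k → c k * b k i)

⟪⟫-comb : (x : Vector ℤ n) (c : Vector ℤ m) (b : Fin m → Vector ℤ n) →
  ⟪ x , comb c b ⟫ ≡ sum (λ k → c k * ⟪ x , b k ⟫)
⟪⟫-comb x c b = begin
  sum (λ i → x i * sum (λ k → c k * b k i))     ≡⟨ sum-cong (λ i → sym (sum-* (x i) (λ k → c k * b k i))) ⟩
  sum (λ i → sum (λ k → x i * (c k * b k i)))   ≡⟨ ∑-comm (λ i k → x i * (c k * b k i)) ⟩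
  sum (λ k → sum (λ i → x i * (c k * b k i)))   ≡⟨ sum-cong (λ k → ⟪⟫-*ʳ (c k) x (b k)) ⟩
  sum (λ k → c k * ⟪ x , b k ⟫)                 ∎
  where open ≡-Reasoning

⊗ᵥ-comb : (A : Matrix ℤ n) (x : Vector ℤ n) → A ⊗ᵥ x ≗ comb x (A ᵀ)
⊗ᵥ-comb A x i = sum-cong (λ j → ℤ.*-comm (A i j) (x j))

⟪⟫-adjoint : (A : Matrix ℤ n) (x y : Vector ℤ n) → ⟪ x , A ⊗ᵥ y ⟫ ≡ ⟪ A ᵀ ⊗ᵥ x , y ⟫
⟪⟫-adjoint A x y = begin
  ⟪ x , A ⊗ᵥ y ⟫                   ≡⟨ ⟪⟫-congʳ x (⊗ᵥ-comb A y) ⟩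
  ⟪ x , comb y (A ᵀ) ⟫             ≡⟨ ⟪⟫-comb x y (A ᵀ) ⟩
  ⟪ y , (λ k → ⟪ x , (A ᵀ) k ⟫) ⟫  ≡⟨ ⟪⟫-comm y _ ⟩
  ⟪ (λ k → ⟪ x , (A ᵀ) k ⟫) , y ⟫  ≡⟨ ⟪⟫-congˡ y (λ k → ⟪⟫-comm x ((A ᵀ) k)) ⟩
  ⟪ A ᵀ ⊗ᵥ x , y ⟫                 ∎
  where open ≡-Reasoning

⊗ᵥ-cong : (A : Matrix ℤ n) {x y : Vector ℤ n} → x ≗ y → A ⊗ᵥ x ≗ A ⊗ᵥ y
⊗ᵥ-cong A x≗y i = ⟪⟫-congʳ (A i) x≗y

⊗-⊗ᵥ : (A B : Matrix ℤ n) (x : Vector ℤ n) → (A ⊗ B) ⊗ᵥ x ≗ A ⊗ᵥ (B ⊗ᵥ x)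
⊗-⊗ᵥ A B x i = begin
  ⟪ (A ⊗ B) i , x ⟫        ≡⟨ ⟪⟫-congˡ x (λ k → ⟪⟫-comm (A i) ((B ᵀ) k)) ⟩
  ⟪ B ᵀ ⊗ᵥ A i , x ⟫       ≡⟨ ⟪⟫-adjoint B (A i) x ⟨
  ⟪ A i , B ⊗ᵥ x ⟫         ∎
  where open ≡-Reasoning

diag-⊗ᵥ : (d x : Vector ℤ n) → diag d ⊗ᵥ x ≗ (λ i → d i * x i)
diag-⊗ᵥ d x i = trans
  (sum-single i (λ j → diag d i j * x j) (λ j j≢i → cong (λ b → (if b then d i else 0ℤ) * x j) (dec-false (i Fin.≟ j) (j≢i ∘ sym))))
  (cong (λ b → (if b then d i else 0ℤ) * x i) (dec-true (i Fin.≟ i) refl))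

𝟙-⊗ᵥ : (x : Vector ℤ n) → 𝟙 ⊗ᵥ x ≗ x
𝟙-⊗ᵥ x i = trans (diag-⊗ᵥ (λ _ → 1ℤ) x i) (ℤ.*-identityˡ (x i))

𝟙-diag : (i : Fin n) → 𝟙 i i ≡ 1ℤ
𝟙-diag i = cong (λ b → if b then 1ℤ else 0ℤ) (dec-true (i Fin.≟ i) refl)

𝟙-off : {i j : Fin n} → i ≢ j → 𝟙 i j ≡ 0ℤ
𝟙-off {i = i} {j} i≢j = cong (λ b → if b then 1ℤ else 0ℤ) (dec-false (i Fin.≟ j) i≢j)

⟪⟫-permute : (x y : Vector ℤ n) (π : Fin n ↔ Fin n) →
  ⟪ x , y ⟫ ≡ ⟪ x ∘ Inverse.to π , y ∘ Inverse.to π ⟫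
⟪⟫-permute x y π = sum-permute (λ i → x i * y i) π

-- Determinants

det-cong : {A B : Matrix ℤ n} → (∀ i j → A i j ≡ B i j) → det A ≡ det B
det-cong = RingRelation.det-~ {R₁ = ℤ.+-*-commutativeRing} {R₂ = ℤ.+-*-commutativeRing} {_~_ = _≡_} (record
  { ~-0 = refl ; ~-1 = refl ; ~-+ = cong₂ _+_ ; ~-* = cong₂ _*_ ; ~-neg = cong (λ x → - x) })

minor : Fin (suc n) → Matrix ℤ (suc n) → Matrix ℤ n
minor j A i k = A (suc i) (punchIn j k)

-- Entrywise hypotheses pass to minors. Deleting a column l ≠ j moves the special column to
-- `punchOut l≢j`; for l = j the minors agree and the top entry splits.
det-linear : (j : Fin n) (a : ℤ) {A B C : Matrix ℤ n} →
  (∀ r → A r j ≡ B r j + a * C r j) →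
  (∀ r k → k ≢ j → A r k ≡ B r k) → (∀ r k → k ≢ j → C r k ≡ B r k) →
  det A ≡ det B + a * det C
det-linear {suc n} j a {A} {B} {C} A≡B+aC A≡B C≡B = begin
  sum (λ l → term A l)                            ≡⟨ sum-cong term-linear ⟩
  sum (λ l → term B l + a * term C l)             ≡⟨ sum-+ (term B) (λ l → a * term C l) ⟩
  sum (term B) + sum (λ l → a * term C l)         ≡⟨ cong (_+_ (sum (term B))) (sum-* a (term C)) ⟩
  sum (term B) + a * sum (term C)                 ∎
  where
  open ≡-Reasoning
  term : Matrix ℤ (suc n) → Fin (suc n) → ℤ
  term M l = (- 1ℤ) ^ toℕ l * (M zero l * det (minor l M))
  entry-linear : ∀ s a b c m → s * ((b + a * c) * m) ≡ s * (b * m) + a * (s * (c * m))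
  entry-linear = solve-∀
  minor-linear : ∀ s a e m m′ → s * (e * (m + a * m′)) ≡ s * (e * m) + a * (s * (e * m′))
  minor-linear = solve-∀
  term-linear : ∀ l → term A l ≡ term B l + a * term C l
  term-linear l with l Fin.≟ j
  ... | yes refl = begin
    sg * (A zero l * det (minor l A))
      ≡⟨ cong₂ (λ e d → sg * (e * d)) (A≡B+aC zero)
           (det-cong (λ r k → A≡B (suc r) (punchIn l k) (Fin.punchInᵢ≢i l k))) ⟩
    sg * ((B zero l + a * C zero l) * det (minor l B))
      ≡⟨ entry-linear sg a (B zero l) (C zero l) (det (minor l B)) ⟩
    term B l + a * (sg * (C zero l * det (minor l B)))
      ≡⟨ cong (λ d → term B l + a * (sg * (C zero l * d)))
           (det-cong (λ r k → sym (C≡B (suc r) (punchIn l k) (Fin.punchInᵢ≢i l k)))) ⟩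
    term B l + a * term C l ∎
    where sg = (- 1ℤ) ^ toℕ l
  ... | no l≢j = begin
    sg * (A zero l * det (minor l A))
      ≡⟨ cong₂ (λ e d → sg * (e * d)) (A≡B zero l l≢j) minors ⟩
    sg * (B zero l * (det (minor l B) + a * det (minor l C)))
      ≡⟨ minor-linear sg a (B zero l) (det (minor l B)) (det (minor l C)) ⟩
    term B l + a * (sg * (B zero l * det (minor l C)))
      ≡⟨ cong (λ e → term B l + a * (sg * (e * det (minor l C)))) (sym (C≡B zero l l≢j)) ⟩
    term B l + a * term C l ∎
    where
    sg = (- 1ℤ) ^ toℕ l
    j′ = punchOut l≢j
    off : ∀ k → k ≢ j′ → punchIn l k ≢ j
    off k k≢j′ eq = k≢j′ (Fin.punchIn-injective l k j′ (trans eq (sym (Fin.punchIn-punchOut l≢j))))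
    minors : det (minor l A) ≡ det (minor l B) + a * det (minor l C)
    minors = det-linear j′ a
      (λ r → subst (λ q → A (suc r) q ≡ B (suc r) q + a * C (suc r) q)
               (sym (Fin.punchIn-punchOut l≢j)) (A≡B+aC (suc r)))
      (λ r k k≢j′ → A≡B (suc r) (punchIn l k) (off k k≢j′))
      (λ r k k≢j′ → C≡B (suc r) (punchIn l k) (off k k≢j′))

adjSwap : Fin n → Fin (suc n) → Fin (suc n)
adjSwap zero    zero          = suc zero
adjSwap zero    (suc zero)    = zero
adjSwap zero    (suc (suc i)) = suc (suc i)
adjSwap (suc j) zero          = zero
adjSwap (suc j) (suc i)       = suc (adjSwap j i)

-- The two ways in which exchanging neighbouring columns acts on the term l of the Laplace
-- expansion. Either l is one of the two, and the term becomes that of its partner with the opposite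
-- sign, or l stays, and the exchange descends to two neighbouring columns of the minor.
data SwapView (j : Fin (suc n)) (l : Fin (suc (suc n))) : Set where
  moved : (- 1ℤ) ^ toℕ l ≡ - ((- 1ℤ) ^ toℕ (adjSwap j l)) →
          (∀ k → adjSwap j (punchIn l k) ≡ punchIn (adjSwap j l) k) → SwapView j l
  fixed : (j′ : Fin n) → adjSwap j l ≡ l →
          (∀ k → adjSwap j (punchIn l k) ≡ punchIn l (adjSwap j′ k)) → SwapView j l

swapView : (j : Fin (suc n)) (l : Fin (suc (suc n))) → SwapView j l
swapView zero zero = moved refl λ { zero → refl ; (suc k) → refl }
swapView zero (suc zero) = moved refl λ { zero → refl ; (suc k) → refl }
swapView {suc n} zero (suc (suc l)) =
  fixed zero refl λ { zero → refl ; (suc zero) → refl ; (suc (suc k)) → refl }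
swapView (suc j) zero = fixed j refl (λ k → refl)
swapView {suc n} (suc j) (suc l) with swapView j l
... | moved sg eq = moved (trans (cong (_*_ (- 1ℤ)) sg) (neg-out ((- 1ℤ) ^ toℕ (adjSwap j l))))
                      λ { zero → refl ; (suc k) → cong suc (eq k) }
  where
  neg-out : ∀ x → (- 1ℤ) * (- x) ≡ - ((- 1ℤ) * x)
  neg-out = solve-∀
... | fixed j′ fx eq = fixed (suc j′) (cong suc fx) λ { zero → refl ; (suc k) → cong suc (eq k) }

sum-adjSwap : (j : Fin n) (f : Vector ℤ (suc n)) → sum (f ∘ adjSwap j) ≡ sum f
sum-adjSwap zero f = exchange (f (suc zero)) (f zero) (sum (λ i → f (suc (suc i))))
  where
  exchange : ∀ x y z → x + (y + z) ≡ y + (x + z)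
  exchange = solve-∀
sum-adjSwap (suc j) f = cong (_+_ (f zero)) (sum-adjSwap j (f ∘ suc))

det-adjSwap : (j : Fin n) (A : Matrix ℤ (suc n)) → det (λ r c → A r (adjSwap j c)) ≡ - det A
det-adjSwap {suc n} j A = begin
  sum (λ l → (- 1ℤ) ^ toℕ l * (A zero (adjSwap j l) * det (minor l A′)))  ≡⟨ sum-cong swapped ⟩
  sum (λ l → - 1ℤ * term (adjSwap j l))                                   ≡⟨ sum-adjSwap j (λ l → - 1ℤ * term l) ⟩
  sum (λ l → - 1ℤ * term l)                                               ≡⟨ sum-* (- 1ℤ) term ⟩
  - 1ℤ * det A                                                            ≡⟨ ℤ.-1*i≡-i (det A) ⟩
  - det A                                                                 ∎
  where
  open ≡-Reasoning
  A′ : Matrix ℤ (suc (suc n))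
  A′ r c = A r (adjSwap j c)
  term : Fin (suc (suc n)) → ℤ
  term l = (- 1ℤ) ^ toℕ l * (A zero l * det (minor l A))
  neg-sign : ∀ s e d → (- s) * (e * d) ≡ - 1ℤ * (s * (e * d))
  neg-sign = solve-∀
  neg-minor : ∀ s e d → s * (e * (- d)) ≡ - 1ℤ * (s * (e * d))
  neg-minor = solve-∀
  swapped : ∀ l → (- 1ℤ) ^ toℕ l * (A zero (adjSwap j l) * det (minor l A′)) ≡ - 1ℤ * term (adjSwap j l)
  swapped l with swapView j l
  ... | moved sg eq = trans
    (cong₂ (λ s d → s * (A zero (adjSwap j l) * d)) sg (det-cong (λ r k → cong (A (suc r)) (eq k))))
    (neg-sign ((- 1ℤ) ^ toℕ (adjSwap j l)) (A zero (adjSwap j l)) (det (minor (adjSwap j l) A)))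
  ... | fixed j′ fx eq rewrite fx = trans
    (cong (λ d → (- 1ℤ) ^ toℕ l * (A zero l * d))
      (trans (det-cong (λ r k → cong (A (suc r)) (eq k))) (det-adjSwap j′ (minor l A))))
    (neg-minor ((- 1ℤ) ^ toℕ l) (A zero l) (det (minor l A)))

adjSwap-inject₁ : (j : Fin n) → adjSwap j (inject₁ j) ≡ suc j
adjSwap-inject₁ zero    = refl
adjSwap-inject₁ (suc j) = cong suc (adjSwap-inject₁ j)

adjSwap-< : (j : Fin n) (i : Fin (suc n)) → toℕ i ℕ.< toℕ j → adjSwap j i ≡ i
adjSwap-< (suc j) zero    i<j       = refl
adjSwap-< (suc j) (suc i) (s≤s i<j) = cong suc (adjSwap-< j i i<j)

adjSwap-invariant : (j : Fin n) (f : Fin (suc n) → ℤ) → f (inject₁ j) ≡ f (suc j) → ∀ c → f (adjSwap j c) ≡ f c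
adjSwap-invariant zero    f eq zero          = sym eq
adjSwap-invariant zero    f eq (suc zero)    = eq
adjSwap-invariant zero    f eq (suc (suc c)) = refl
adjSwap-invariant (suc j) f eq zero          = refl
adjSwap-invariant (suc j) f eq (suc c)       = adjSwap-invariant j (f ∘ suc) eq c

i≡-i⇒i≡0 : ∀ {i} → i ≡ - i → i ≡ 0ℤ
i≡-i⇒i≡0 {i} eq with i | eq
... | + zero  | _ = refl
... | + suc _ | ()
... | -[1+ _ ] | ()

-- Induction on the gap d. Exchanging two equal neighbours changes nothing, so det = - det.
-- Otherwise column `suc j` is exchanged with its left neighbour, which shortens the gap by one.
det-alternating-< : ∀ d (i : Fin (suc n)) (j : Fin n) → toℕ j ≡ toℕ i ℕ.+ d → (A : Matrix ℤ (suc n)) →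
  (∀ r → A r i ≡ A r (suc j)) → det A ≡ 0ℤ
det-alternating-< zero i j j≡i A eq = i≡-i⇒i≡0 (trans (sym (det-cong invariant)) (det-adjSwap j A))
  where
  i≡j : i ≡ inject₁ j
  i≡j = Fin.toℕ-injective (trans (sym (trans j≡i (ℕ.+-identityʳ _))) (sym (Fin.toℕ-inject₁ j)))
  invariant : ∀ r c → A r (adjSwap j c) ≡ A r c
  invariant r = adjSwap-invariant j (A r) (trans (cong (A r) (sym i≡j)) (eq r))
det-alternating-< (suc d) i zero j≡i A eq = contradiction (trans j≡i (ℕ.+-suc (toℕ i) d)) (λ ())
det-alternating-< {suc (suc n)} (suc d) i j@(suc j′) j≡i A eq =
  ℤ.neg-injective (trans (sym (det-adjSwap j A)) smaller)
  where
  j′≡ : toℕ (inject₁ j′) ≡ toℕ i ℕ.+ d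
  j′≡ = trans (Fin.toℕ-inject₁ j′) (ℕ.suc-injective (trans j≡i (ℕ.+-suc (toℕ i) d)))
  i<j : toℕ i ℕ.< toℕ j
  i<j = subst (toℕ i ℕ.<_) (sym j≡i) (ℕ.m<m+n (toℕ i) (s≤s z≤n))
  smaller : det (λ r c → A r (adjSwap j c)) ≡ 0ℤ
  smaller = det-alternating-< d i (inject₁ j′) j′≡ (λ r c → A r (adjSwap j c))
    (λ r → trans (cong (A r) (adjSwap-< j i i<j))
             (trans (eq r) (cong (A r) (sym (adjSwap-inject₁ j)))))

det-alternating : (A : Matrix ℤ n) {i k : Fin n} → i ≢ k → (∀ r → A r i ≡ A r k) → det A ≡ 0ℤ
det-alternating A {i} {k} i≢k eq with Fin.<-cmp i k
... | tri≈ _ i≡k _ = contradiction i≡k i≢k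
det-alternating A {i} {suc k} _ eq | tri< (s≤s i≤k) _ _ =
  det-alternating-< (toℕ k ℕ.∸ toℕ i) i k (sym (ℕ.m+[n∸m]≡n i≤k)) A eq
det-alternating A {suc i} {k} _ eq | tri> _ _ (s≤s k≤i) =
  det-alternating-< (toℕ i ℕ.∸ toℕ k) k i (sym (ℕ.m+[n∸m]≡n k≤i)) A (sym ∘ eq)

setCol : Matrix ℤ n → Fin n → Vector ℤ n → Matrix ℤ n
setCol A j u r k = if does (k Fin.≟ j) then u r else A r k

setCol-≡ : (A : Matrix ℤ n) (j : Fin n) (u : Vector ℤ n) → ∀ r → setCol A j u r j ≡ u r
setCol-≡ A j u r = cong (λ b → if b then u r else A r j) (dec-true (j Fin.≟ j) refl)

setCol-≢ : (A : Matrix ℤ n) (j : Fin n) (u : Vector ℤ n) → ∀ r k → k ≢ j → setCol A j u r k ≡ A r k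
setCol-≢ A j u r k k≢j = cong (λ b → if b then u r else A r k) (dec-false (k Fin.≟ j) k≢j)

det-setCol-cong : (A : Matrix ℤ n) (j : Fin n) {u v : Vector ℤ n} → u ≗ v → det (setCol A j u) ≡ det (setCol A j v)
det-setCol-cong A j u≗v = det-cong λ r k → cong (λ x → if does (k Fin.≟ j) then x else A r k) (u≗v r)

det-setCol-+* : (A : Matrix ℤ n) (j : Fin n) (u : Vector ℤ n) (a : ℤ) (v : Vector ℤ n) →
  det (setCol A j (λ r → u r + a * v r)) ≡ det (setCol A j u) + a * det (setCol A j v)
det-setCol-+* A j u a v = det-linear j a
  (λ r → trans (setCol-≡ A j (λ r → u r + a * v r) r) (sym (cong₂ (λ x y → x + a * y) (setCol-≡ A j u r) (setCol-≡ A j v r))))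
  (λ r k k≢j → trans (setCol-≢ A j (λ r → u r + a * v r) r k k≢j) (sym (setCol-≢ A j u r k k≢j)))
  (λ r k k≢j → trans (setCol-≢ A j v r k k≢j) (sym (setCol-≢ A j u r k k≢j)))

det-setCol-0 : (A : Matrix ℤ n) (j : Fin n) → det (setCol A j (λ _ → 0ℤ)) ≡ 0ℤ
det-setCol-0 A j = cancel (det-setCol-+* A j (λ _ → 0ℤ) 1ℤ (λ _ → 0ℤ))
  where
  cancel : ∀ {x} → x ≡ x + 1ℤ * x → x ≡ 0ℤ
  cancel {x} eq = trans (regroup x) (trans (cong (_- x) (sym eq)) (ℤ.+-inverseʳ x))
    where
    regroup : ∀ x → x ≡ x + 1ℤ * x - x
    regroup = solve-∀

det-setCol-comb : (A : Matrix ℤ n) (j : Fin n) (c : Vector ℤ m) (b : Fin m → Vector ℤ n) →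
  det (setCol A j (comb c b)) ≡ sum (λ k → c k * det (setCol A j (b k)))
det-setCol-comb {m = zero}  A j c b = det-setCol-0 A j
det-setCol-comb {m = suc m} A j c b = begin
  det (setCol A j (comb c b))
    ≡⟨ det-setCol-cong A j (λ r → ℤ.+-comm (c zero * b zero r) (comb (c ∘ suc) (b ∘ suc) r)) ⟩
  det (setCol A j (λ r → comb (c ∘ suc) (b ∘ suc) r + c zero * b zero r))
    ≡⟨ det-setCol-+* A j (comb (c ∘ suc) (b ∘ suc)) (c zero) (b zero) ⟩
  det (setCol A j (comb (c ∘ suc) (b ∘ suc))) + c zero * det (setCol A j (b zero))
    ≡⟨ cong (_+ c zero * det (setCol A j (b zero))) (det-setCol-comb A j (c ∘ suc) (b ∘ suc)) ⟩
  sum (λ k → c (suc k) * det (setCol A j (b (suc k)))) + c zero * det (setCol A j (b zero))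
    ≡⟨ ℤ.+-comm _ (c zero * det (setCol A j (b zero))) ⟩
  sum (λ k → c k * det (setCol A j (b k))) ∎
  where open ≡-Reasoning

det-setCol-self : (A : Matrix ℤ n) (j : Fin n) → det (setCol A j ((A ᵀ) j)) ≡ det A
det-setCol-self A j = det-cong same
  where
  same : ∀ r k → setCol A j ((A ᵀ) j) r k ≡ A r k
  same r k with k Fin.≟ j
  ... | yes refl = refl
  ... | no  _    = refl

det-setCol-other : (A : Matrix ℤ n) {j k : Fin n} → k ≢ j → det (setCol A j ((A ᵀ) k)) ≡ 0ℤ
det-setCol-other A {j} {k} k≢j = det-alternating (setCol A j ((A ᵀ) k)) {j} {k} (k≢j ∘ sym)
  (λ r → trans (setCol-≡ A j ((A ᵀ) k) r) (sym (setCol-≢ A j ((A ᵀ) k) r k k≢j)))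

cramer : (A : Matrix ℤ n) (x : Vector ℤ n) (j : Fin n) → det (setCol A j (A ⊗ᵥ x)) ≡ x j * det A
cramer A x j = begin
  det (setCol A j (A ⊗ᵥ x))                       ≡⟨ det-setCol-cong A j (⊗ᵥ-comb A x) ⟩
  det (setCol A j (comb x (A ᵀ)))                 ≡⟨ det-setCol-comb A j x (A ᵀ) ⟩
  sum (λ k → x k * det (setCol A j ((A ᵀ) k)))    ≡⟨ sum-single j _ vanish ⟩
  x j * det (setCol A j ((A ᵀ) j))                ≡⟨ cong (_*_ (x j)) (det-setCol-self A j) ⟩
  x j * det A                                     ∎
  where
  open ≡-Reasoning
  vanish : ∀ k → k ≢ j → x k * det (setCol A j ((A ᵀ) k)) ≡ 0ℤ
  vanish k k≢j = trans (cong (_*_ (x k)) (det-setCol-other A k≢j)) (ℤ.*-zeroʳ (x k))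

adjugate : Matrix ℤ n → Matrix ℤ n
adjugate A i j = det (setCol A i (𝟙 j))

adjugate-⊗ᵥ : (A : Matrix ℤ n) (x : Vector ℤ n) → adjugate A ⊗ᵥ (A ⊗ᵥ x) ≗ (λ i → det A * x i)
adjugate-⊗ᵥ A x i = begin
  ⟪ adjugate A i , A ⊗ᵥ x ⟫                  ≡⟨ ⟪⟫-comm (adjugate A i) (A ⊗ᵥ x) ⟩
  ⟪ A ⊗ᵥ x , adjugate A i ⟫                  ≡⟨ det-setCol-comb A i (A ⊗ᵥ x) 𝟙 ⟨
  det (setCol A i (comb (A ⊗ᵥ x) 𝟙))         ≡⟨ det-setCol-cong A i basis ⟩
  det (setCol A i (A ⊗ᵥ x))                  ≡⟨ cramer A x i ⟩
  x i * det A                                ≡⟨ ℤ.*-comm (x i) (det A) ⟩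
  det A * x i                                ∎
  where
  open ≡-Reasoning
  basis : comb (A ⊗ᵥ x) 𝟙 ≗ A ⊗ᵥ x
  basis r = trans (sum-single r _ λ k k≢r → trans (cong (_*_ ((A ⊗ᵥ x) k)) (𝟙-off k≢r)) (ℤ.*-zeroʳ ((A ⊗ᵥ x) k)))
    (trans (cong (_*_ ((A ⊗ᵥ x) r)) (𝟙-diag r)) (ℤ.*-identityʳ _))

det-𝟙 : ∀ n → det (𝟙 {n}) ≡ 1ℤ
det-𝟙 zero    = refl
det-𝟙 (suc n) = begin
  sum term                          ≡⟨ sum-single zero term vanish ⟩
  1ℤ * (1ℤ * det (𝟙 {n}))           ≡⟨ trans (ℤ.*-identityˡ (1ℤ * det (𝟙 {n}))) (ℤ.*-identityˡ (det (𝟙 {n}))) ⟩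
  det (𝟙 {n})                       ≡⟨ det-𝟙 n ⟩
  1ℤ                                ∎
  where
  open ≡-Reasoning
  term : Vector ℤ (suc n)
  term j = (- 1ℤ) ^ toℕ j * (𝟙 zero j * det (minor j 𝟙))
  vanish : ∀ j → j ≢ zero → term j ≡ 0ℤ
  vanish j j≢0 = trans (cong (λ e → (- 1ℤ) ^ toℕ j * (e * det (minor j 𝟙))) (𝟙-off (j≢0 ∘ sym)))
    (trans (cong (_*_ ((- 1ℤ) ^ toℕ j)) (ℤ.*-zeroˡ (det (minor j 𝟙)))) (ℤ.*-zeroʳ ((- 1ℤ) ^ toℕ j)))

-- Congruences

infix 4 _≋_mod_

-- A record and not an abbreviation, so that both sides and the modulus can be recovered by
-- unification.
record _≋_mod_ (a b m : ℤ) : Set where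
  constructor mod
  field difference : m ∣ a - b

open _≋_mod_ public

≡⇒≋ : ∀ {a b p} → a ≡ b → a ≋ b mod p
≡⇒≋ {a = a} {p = p} refl = mod (divides 0ℤ (ℤ.+-inverseʳ a))

≋-refl : ∀ {a p} → a ≋ a mod p
≋-refl = ≡⇒≋ refl

≋-sym : ∀ {a b p} → a ≋ b mod p → b ≋ a mod p
≋-sym {a} {b} {p} (mod h) = mod (subst (p ∣_) (swap a b) (∣m⇒∣-m h))
  where
  swap : ∀ a b → - (a - b) ≡ b - a
  swap = solve-∀

≋-trans : ∀ {a b p c} → a ≋ b mod p → b ≋ c mod p → a ≋ c mod p
≋-trans {a} {b} {p} {c} (mod h) (mod h′) = mod (subst (p ∣_) (telescope a b c) (∣m∣n⇒∣m+n h h′))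
  where
  telescope : ∀ a b c → (a - b) + (b - c) ≡ a - c
  telescope = solve-∀

≋-+ : ∀ {a b p c d} → a ≋ b mod p → c ≋ d mod p → a + c ≋ b + d mod p
≋-+ {a} {b} {p} {c} {d} (mod h) (mod h′) = mod (subst (p ∣_) (regroup a b c d) (∣m∣n⇒∣m+n h h′))
  where
  regroup : ∀ a b c d → (a - b) + (c - d) ≡ (a + c) - (b + d)
  regroup = solve-∀

≋-* : ∀ {a b p c d} → a ≋ b mod p → c ≋ d mod p → a * c ≋ b * d mod p
≋-* {a} {b} {p} {c} {d} (mod h) (mod h′) =
  mod (subst (p ∣_) (regroup a b c d) (∣m∣n⇒∣m+n (∣m⇒∣m*n c h) (∣n⇒∣m*n b h′)))
  where
  regroup : ∀ a b c d → (a - b) * c + b * (c - d) ≡ a * c - b * d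
  regroup = solve-∀

≋-*ˡ : ∀ {a b p} c → a ≋ b mod p → c * a ≋ c * b mod p
≋-*ˡ c = ≋-* (≋-refl {c})

≋-neg : ∀ {a b p} → a ≋ b mod p → - a ≋ - b mod p
≋-neg {a} {b} {p} (mod h) = mod (subst (p ∣_) (ℤ.neg-distrib-+ a (- b)) (∣m⇒∣-m h))

≋-sum : {f g : Vector ℤ n} → (∀ i → f i ≋ g i mod p) → sum f ≋ sum g mod p
≋-sum {zero}  f≋g = ≋-refl
≋-sum {suc n} f≋g = ≋-+ (f≋g zero) (≋-sum (f≋g ∘ suc))

≋-⟪⟫ : (x : Vector ℤ n) {y z : Vector ℤ n} → (∀ i → y i ≋ z i mod p) → ⟪ x , y ⟫ ≋ ⟪ x , z ⟫ mod p
≋-⟪⟫ x y≋z = ≋-sum (λ i → ≋-*ˡ (x i) (y≋z i))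

≋0⇒∣ : ∀ {a p} → a ≋ 0ℤ mod p → p ∣ a
≋0⇒∣ {a} {p} (mod h) = subst (p ∣_) (ℤ.+-identityʳ a) h

∣⇒≋0 : ∀ {p a} → p ∣ a → a ≋ 0ℤ mod p
∣⇒≋0 {p} {a} h = mod (subst (p ∣_) (sym (ℤ.+-identityʳ a)) h)

≋-∣ : ∀ {a b p} → a ≋ b mod p → p ∣ b → p ∣ a
≋-∣ a≋b p∣b = ≋0⇒∣ (≋-trans a≋b (∣⇒≋0 p∣b))

∣-sum : {f : Vector ℤ n} → (∀ i → p ∣ f i) → p ∣ sum f
∣-sum {zero} {p} h = divides 0ℤ refl
∣-sum {suc n}    h = ∣m∣n⇒∣m+n (h zero) (∣-sum (h ∘ suc))

∣-⟪⟫ : (x : Vector ℤ n) {y : Vector ℤ n} → (∀ i → p ∣ y i) → p ∣ ⟪ x , y ⟫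
∣-⟪⟫ x h = ∣-sum (λ i → ∣n⇒∣m*n (x i) (h i))

modSetoid : ℤ → Setoid 0ℓ 0ℓ
modSetoid p = record
  { Carrier = ℤ ; _≈_ = λ a b → a ≋ b mod p
  ; isEquivalence = record { refl = ≋-refl ; sym = ≋-sym ; trans = ≋-trans } }

module ≋-Reasoning (p : ℤ) = SetoidReasoning (modSetoid p)

-- For p = 0, congruence is equality.
record PrimeIdeal (p : ℤ) : Set where
  field
    proper : ¬ p ∣ 1ℤ
    split  : ∀ a b → p ∣ a * b → p ∣ a ⊎ p ∣ b

  *-∤ : ∀ {a b} → ¬ p ∣ a → ¬ p ∣ b → ¬ p ∣ a * b
  *-∤ {a} {b} p∤a p∤b h with split a b h
  ... | inj₁ p∣a = p∤a p∣a
  ... | inj₂ p∣b = p∤b p∣b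

  cancel : ∀ {b} a → ¬ p ∣ a → p ∣ a * b → p ∣ b
  cancel a p∤a h with split a _ h
  ... | inj₁ p∣a = contradiction p∣a p∤a
  ... | inj₂ p∣b = p∣b

zeroIdeal : PrimeIdeal 0ℤ
zeroIdeal = record
  { proper = λ h → contradiction (0∣⇒≡0 h) (λ ())
  ; split  = λ a b h → Sum.map ≡0⇒0∣ ≡0⇒0∣ (ℤ.i*j≡0⇒i≡0∨j≡0 a (0∣⇒≡0 h)) }
  where
  ≡0⇒0∣ : ∀ {a} → a ≡ 0ℤ → 0ℤ ∣ a
  ≡0⇒0∣ refl = ∣-refl

primeIdeal : ∀ {p} → Prime p → PrimeIdeal (+ p)
primeIdeal {p} isPrime = record
  { proper = λ h → ℕ.nonTrivial⇒≢1 {{prime⇒nonTrivial isPrime}} (ℕ.∣1⇒≡1 (∣⇒∣ᵤ h))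
  ; split  = λ a b h → Sum.map ∣ᵤ⇒∣ ∣ᵤ⇒∣
      (euclidsLemma ℤ.∣ a ∣ ℤ.∣ b ∣ isPrime (subst (p ℕ.∣_) (ℤ.abs-* a b) (∣⇒∣ᵤ h))) }

-- Fraction-free elimination.
nontrivialSolution : PrimeIdeal p → (M : Fin m → Vector ℤ (suc m)) →
  ∃ λ (x : Vector ℤ (suc m)) → (∃ λ i → ¬ p ∣ x i) × (∀ r → p ∣ ⟪ M r , x ⟫)
nontrivialSolution {p} {zero} P M = (λ _ → 1ℤ) , (zero , PrimeIdeal.proper P) , λ ()
nontrivialSolution {p} {suc m} P M with Fin.any? (λ r → ¬? (p ∣? M r zero))
... | no none = 𝟙 zero , (zero , PrimeIdeal.proper P) , λ r →
    subst (p ∣_) (sym (trans (⟪⟫-comm (M r) (𝟙 zero)) (𝟙-⊗ᵥ (M r) zero)))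
      (decidable-stable (p ∣? M r zero) (λ ∤ → none (r , ∤)))
... | yes (r₀ , p∤a) = x , (suc (proj₁ nz) , PrimeIdeal.*-∤ P p∤a (proj₂ nz)) , solves
  where
  open ≡-Reasoning
  π = M r₀ zero
  reduced : Fin m → Vector ℤ (suc m)
  reduced r j = π * M (punchIn r₀ r) (suc j) + (- M (punchIn r₀ r) zero) * M r₀ (suc j)
  ih = nontrivialSolution P reduced
  x′ = proj₁ ih
  nz = proj₁ (proj₂ ih)
  s = ⟪ M r₀ ∘ suc , x′ ⟫
  x : Vector ℤ (suc (suc m))
  x = (- s) ∷ᵥ (λ j → π * x′ j)
  row : ∀ r → ⟪ M r , x ⟫ ≡ π * ⟪ M r ∘ suc , x′ ⟫ + (- M r zero) * s
  row r = trans (cong (_+_ (M r zero * - s)) (⟪⟫-*ʳ π (M r ∘ suc) x′))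
    (regroup (M r zero) s (π * ⟪ M r ∘ suc , x′ ⟫))
    where
    regroup : ∀ m s t → m * - s + t ≡ t + (- m) * s
    regroup = solve-∀
  pivot-row : ∀ a s → a * s + (- a) * s ≡ 0ℤ
  pivot-row = solve-∀
  solves : ∀ r → p ∣ ⟪ M r , x ⟫
  solves r with r₀ Fin.≟ r
  ... | yes refl = subst (p ∣_) (sym (trans (row r) (pivot-row π s))) (divides 0ℤ refl)
  ... | no r₀≢r = subst (p ∣_) (trans (⟪⟫-linˡ π (- M (punchIn r₀ r′) zero) x′ (M (punchIn r₀ r′) ∘ suc) (M r₀ ∘ suc))
      (trans (cong (λ q → π * ⟪ M q ∘ suc , x′ ⟫ + (- M q zero) * s) (Fin.punchIn-punchOut r₀≢r)) (sym (row r))))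
      (proj₂ (proj₂ ih) r′)
    where r′ = punchOut r₀≢r

-- Inverses of square matrices

*-cancel-≢0 : ∀ {a b c} → c ≢ 0ℤ → c * a ≡ c * b → a ≡ b
*-cancel-≢0 {a} {b} {c} c≢0 = ℤ.*-cancelˡ-≡ c a b {{≢-nonZero c≢0}}

-- There is a nontrivial relation t y + B x = 0, being n equations in n + 1 unknowns. Applying A
-- gives c x = - t A y. Hence t = 0 would force x = 0, and for t ≠ 0 substituting back gives B A y =
-- c y.
flip-inverse : {c : ℤ} → c ≢ 0ℤ → (A B : Matrix ℤ n) →
  (∀ x → A ⊗ᵥ (B ⊗ᵥ x) ≗ (λ i → c * x i)) → ∀ y → B ⊗ᵥ (A ⊗ᵥ y) ≗ (λ i → c * y i)
flip-inverse {n} {c} c≢0 A B AB y i = *-cancel-≢0 t≢0 (begin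
  t * (B ⊗ᵥ (A ⊗ᵥ y)) i               ≡⟨ ⟪⟫-*ʳ t (B i) (A ⊗ᵥ y) ⟨
  ⟪ B i , (λ k → t * (A ⊗ᵥ y) k) ⟫    ≡⟨ ⟪⟫-congʳ (B i) tAy ⟩
  ⟪ B i , (λ k → (- c) * x k) ⟫       ≡⟨ ⟪⟫-*ʳ (- c) (B i) x ⟩
  (- c) * (B ⊗ᵥ x) i                  ≡⟨ move c t (y i) ((B ⊗ᵥ x) i) (relation i) ⟩
  t * (c * y i)                       ∎)
  where
  open ≡-Reasoning
  sol = nontrivialSolution zeroIdeal (λ r → y r ∷ᵥ B r)
  t = proj₁ sol zero
  x = proj₁ sol ∘ suc
  relation : ∀ r → y r * t + (B ⊗ᵥ x) r ≡ 0ℤ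
  relation r = 0∣⇒≡0 (proj₂ (proj₂ sol) r)
  isolate : ∀ u v → v ≡ (u + v) - u
  isolate = solve-∀
  Bx : B ⊗ᵥ x ≗ (λ r → (- t) * y r)
  Bx r = trans (isolate (y r * t) ((B ⊗ᵥ x) r)) (trans (cong (_- y r * t) (relation r)) (neg (y r) t))
    where
    neg : ∀ y t → 0ℤ - y * t ≡ (- t) * y
    neg = solve-∀
  cx : ∀ k → c * x k ≡ (- t) * (A ⊗ᵥ y) k
  cx k = trans (sym (AB x k)) (trans (⊗ᵥ-cong A Bx k) (⟪⟫-*ʳ (- t) (A k) y))
  tAy : ∀ k → t * (A ⊗ᵥ y) k ≡ (- c) * x k
  tAy k = trans (neg-neg t ((A ⊗ᵥ y) k)) (trans (cong (λ z → - z) (sym (cx k))) (ℤ.neg-distribˡ-* c (x k)))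
    where
    neg-neg : ∀ t z → t * z ≡ - ((- t) * z)
    neg-neg = solve-∀
  t≢0 : t ≢ 0ℤ
  t≢0 t≡0 = proj₂ (proj₁ (proj₂ sol)) (vanish (proj₁ (proj₁ (proj₂ sol))))
    where
    vanish : ∀ j → 0ℤ ∣ proj₁ sol j
    vanish zero    = subst (0ℤ ∣_) (sym t≡0) ∣-refl
    vanish (suc k) = subst (0ℤ ∣_) (sym (*-cancel-≢0 c≢0
      (trans (cx k) (trans (cong (λ z → (- z) * (A ⊗ᵥ y) k) t≡0) (sym (ℤ.*-zeroʳ c)))))) ∣-refl
  move : ∀ c t y b → y * t + b ≡ 0ℤ → (- c) * b ≡ t * (c * y)
  move c t y b eq = trans (expand c t y b) (trans (cong (λ z → t * (c * y) - c * z) eq) (finish c t y))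
    where
    expand : ∀ c t y b → (- c) * b ≡ t * (c * y) - c * (y * t + b)
    expand = solve-∀
    finish : ∀ c t y → t * (c * y) - c * 0ℤ ≡ t * (c * y)
    finish = solve-∀

record Invertible (A : Matrix ℤ n) : Set where
  field
    inv  : Matrix ℤ n
    invˡ : ∀ x → inv ⊗ᵥ (A ⊗ᵥ x) ≗ x
    invʳ : ∀ x → A ⊗ᵥ (inv ⊗ᵥ x) ≗ x

unimodular⇒invertible : {U : Matrix ℤ n} → Unimodular U → Invertible U
unimodular⇒invertible {n} {U} uni = record { inv = U′ ; invˡ = left ; invʳ = right }
  where
  square : det U * det U ≡ 1ℤ
  square = Sum.[ (λ eq → cong₂ _*_ eq eq) , (λ eq → cong₂ _*_ eq eq) ] uni
  U′ : Matrix ℤ n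
  U′ i j = det U * adjugate U i j
  left : ∀ x → U′ ⊗ᵥ (U ⊗ᵥ x) ≗ x
  left x i = begin
    ⟪ U′ i , U ⊗ᵥ x ⟫                    ≡⟨ ⟪⟫-*ˡ (det U) (adjugate U i) (U ⊗ᵥ x) ⟩
    det U * ⟪ adjugate U i , U ⊗ᵥ x ⟫    ≡⟨ cong (_*_ (det U)) (adjugate-⊗ᵥ U x i) ⟩
    det U * (det U * x i)                ≡⟨ ℤ.*-assoc (det U) (det U) (x i) ⟨
    det U * det U * x i                  ≡⟨ cong (_* x i) square ⟩
    1ℤ * x i                             ≡⟨ ℤ.*-identityˡ (x i) ⟩
    x i                                  ∎
    where open ≡-Reasoning
  right : ∀ x → U ⊗ᵥ (U′ ⊗ᵥ x) ≗ x
  right x i = trans (flip-inverse {c = 1ℤ} (λ ()) U′ U (λ y j → trans (left y j) (sym (ℤ.*-identityˡ (y j)))) x i)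
    (ℤ.*-identityˡ (x i))

⊗ᵥ-basis : (A : Matrix ℤ n) (j : Fin n) → A ⊗ᵥ 𝟙 j ≗ (A ᵀ) j
⊗ᵥ-basis A j i = trans (⟪⟫-comm (A i) (𝟙 j)) (𝟙-⊗ᵥ (A i) j)

transpose-inverse : {c : ℤ} (A B : Matrix ℤ n) → (∀ x → A ⊗ᵥ (B ⊗ᵥ x) ≗ (λ i → c * x i)) →
  ∀ x → B ᵀ ⊗ᵥ (A ᵀ ⊗ᵥ x) ≗ (λ i → c * x i)
transpose-inverse {c = c} A B AB x i = begin
  ⟪ (B ᵀ) i , A ᵀ ⊗ᵥ x ⟫         ≡⟨ ⟪⟫-adjoint (A ᵀ) ((B ᵀ) i) x ⟩
  ⟪ A ⊗ᵥ (B ᵀ) i , x ⟫           ≡⟨ ⟪⟫-congˡ x (⊗ᵥ-cong A (λ k → sym (⊗ᵥ-basis B i k))) ⟩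
  ⟪ A ⊗ᵥ (B ⊗ᵥ 𝟙 i) , x ⟫        ≡⟨ ⟪⟫-congˡ x (AB (𝟙 i)) ⟩
  ⟪ (λ k → c * 𝟙 i k) , x ⟫      ≡⟨ ⟪⟫-*ˡ c (𝟙 i) x ⟩
  c * ⟪ 𝟙 i , x ⟫                ≡⟨ cong (_*_ c) (𝟙-⊗ᵥ x i) ⟩
  c * x i                        ∎
  where open ≡-Reasoning

transpose-invertible : {A : Matrix ℤ n} → Invertible A → Invertible (A ᵀ)
transpose-invertible {A = A} I = record
  { inv  = inv ᵀ
  ; invˡ = unscale A inv invʳ
  ; invʳ = unscale inv A invˡ }
  where
  open Invertible I
  unscale : ∀ A B → (∀ x → A ⊗ᵥ (B ⊗ᵥ x) ≗ x) → ∀ x → B ᵀ ⊗ᵥ (A ᵀ ⊗ᵥ x) ≗ x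
  unscale A B AB x i = trans
    (transpose-inverse {c = 1ℤ} A B (λ y j → trans (AB y j) (sym (ℤ.*-identityˡ (y j)))) x i)
    (ℤ.*-identityˡ (x i))

-- Walks and their moments

sgn : ℕ → ℤ
sgn zero    = 1ℤ
sgn (suc k) = - sgn k

sgn-+ : ∀ i j → sgn (i ℕ.+ j) ≡ sgn i * sgn j
sgn-+ zero    j = sym (ℤ.*-identityˡ (sgn j))
sgn-+ (suc i) j = trans (cong (λ z → - z) (sgn-+ i j)) (ℤ.neg-distribˡ-* (sgn i) (sgn j))

sgn-sq : ∀ i → sgn i * sgn i ≡ 1ℤ
sgn-sq zero    = refl
sgn-sq (suc i) = trans (neg-sq (sgn i)) (sgn-sq i)
  where
  neg-sq : ∀ x → (- x) * (- x) ≡ x * x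
  neg-sq = solve-∀

sgn-double : ∀ i → sgn (i ℕ.+ i) ≡ 1ℤ
sgn-double i = trans (sgn-+ i i) (sgn-sq i)

parity : ∀ k → ∃ λ j → k ≡ j ℕ.+ j ⊎ k ≡ suc (j ℕ.+ j)
parity zero = zero , inj₁ refl
parity (suc k) with parity k
... | j , inj₁ refl = j , inj₂ refl
... | j , inj₂ refl = suc j , inj₁ (cong suc (sym (ℕ.+-suc j j)))

𝟏 : Vector ℤ n
𝟏 _ = 1ℤ

iter : Matrix ℤ n → ℕ → Vector ℤ n → Vector ℤ n
iter S zero    x = x
iter S (suc k) x = S ⊗ᵥ iter S k x

walk : Matrix ℤ n → ℕ → Vector ℤ n
walk S k = iter S k 𝟏

krylov : Matrix ℤ n → Matrix ℤ n
krylov S i k = walk S (toℕ k) i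

moment : Matrix ℤ n → ℕ → ℤ
moment S k = ⟪ 𝟏 , walk S k ⟫

power-iter : (S : Matrix ℤ n) (k : ℕ) (x : Vector ℤ n) → power S k ⊗ᵥ x ≗ iter S k x
power-iter S zero    x i = 𝟙-⊗ᵥ x i
power-iter S (suc k) x i = trans (⊗-⊗ᵥ S (power S k) x i) (⊗ᵥ-cong S (power-iter S k x) i)

iter-+ : (S : Matrix ℤ n) (k l : ℕ) (x : Vector ℤ n) → iter S (k ℕ.+ l) x ≗ iter S k (iter S l x)
iter-+ S zero    l x i = refl
iter-+ S (suc k) l x i = ⊗ᵥ-cong S (iter-+ S k l x) i

iter-cong : (S : Matrix ℤ n) (k : ℕ) {x y : Vector ℤ n} → x ≗ y → iter S k x ≗ iter S k y
iter-cong S zero    x≗y = x≗y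
iter-cong S (suc k) x≗y = ⊗ᵥ-cong S (iter-cong S k x≗y)

Skew : Matrix ℤ n → Set
Skew S = ∀ i j → S i j ≡ - S j i

⟪⟫-skew : {S : Matrix ℤ n} → Skew S → (x y : Vector ℤ n) → ⟪ S ⊗ᵥ x , y ⟫ ≡ - ⟪ x , S ⊗ᵥ y ⟫
⟪⟫-skew {S = S} skew x y = begin
  ⟪ S ⊗ᵥ x , y ⟫                        ≡⟨ ⟪⟫-adjoint (S ᵀ) x y ⟨
  ⟪ x , S ᵀ ⊗ᵥ y ⟫                      ≡⟨ ⟪⟫-congʳ x (λ i → ⟪⟫-congˡ y (λ j → trans (skew j i) (sym (ℤ.-1*i≡-i (S i j))))) ⟩
  ⟪ x , (λ i → ⟪ (λ j → - 1ℤ * S i j) , y ⟫) ⟫  ≡⟨ ⟪⟫-congʳ x (λ i → ⟪⟫-*ˡ (- 1ℤ) (S i) y) ⟩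
  ⟪ x , (λ i → - 1ℤ * (S ⊗ᵥ y) i) ⟫     ≡⟨ ⟪⟫-*ʳ (- 1ℤ) x (S ⊗ᵥ y) ⟩
  - 1ℤ * ⟪ x , S ⊗ᵥ y ⟫                 ≡⟨ ℤ.-1*i≡-i ⟪ x , S ⊗ᵥ y ⟫ ⟩
  - ⟪ x , S ⊗ᵥ y ⟫                      ∎
  where open ≡-Reasoning

⟪⟫-iter : {S : Matrix ℤ n} → Skew S → ∀ k (x y : Vector ℤ n) → ⟪ iter S k x , y ⟫ ≡ sgn k * ⟪ x , iter S k y ⟫
⟪⟫-iter skew zero x y = sym (ℤ.*-identityˡ ⟪ x , y ⟫)
⟪⟫-iter {S = S} skew (suc k) x y = begin
  ⟪ S ⊗ᵥ iter S k x , y ⟫              ≡⟨ ⟪⟫-skew skew (iter S k x) y ⟩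
  - ⟪ iter S k x , S ⊗ᵥ y ⟫            ≡⟨ cong (λ z → - z) (⟪⟫-iter skew k x (S ⊗ᵥ y)) ⟩
  - (sgn k * ⟪ x , iter S k (S ⊗ᵥ y) ⟫) ≡⟨ ℤ.neg-distribˡ-* (sgn k) ⟪ x , iter S k (S ⊗ᵥ y) ⟫ ⟩
  (- sgn k) * ⟪ x , iter S k (S ⊗ᵥ y) ⟫ ≡⟨ cong (_*_ (- sgn k)) (⟪⟫-congʳ x commute) ⟩
  (- sgn k) * ⟪ x , S ⊗ᵥ iter S k y ⟫   ∎
  where
  open ≡-Reasoning
  commute : iter S k (S ⊗ᵥ y) ≗ S ⊗ᵥ iter S k y
  commute i = trans (sym (iter-+ S k 1 y i)) (cong (λ q → iter S q y i) (ℕ.+-comm k 1))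

-- Skewness moves powers of S across the pairing at the cost of a sign, so all inner products of
-- walks are functions of the moments.
walk-gram : {S : Matrix ℤ n} → Skew S → ∀ i j → ⟪ walk S i , walk S j ⟫ ≡ sgn i * moment S (i ℕ.+ j)
walk-gram {S = S} skew i j = trans (⟪⟫-iter skew i 𝟏 (walk S j))
  (cong (_*_ (sgn i)) (⟪⟫-congʳ 𝟏 (λ k → sym (iter-+ S i j 𝟏 k))))

moment-odd : {S : Matrix ℤ n} → Skew S → ∀ j → moment S (suc (j ℕ.+ j)) ≡ 0ℤ
moment-odd {S = S} skew j = i≡-i⇒i≡0 (begin
  moment S k                    ≡⟨ ⟪⟫-comm 𝟏 (walk S k) ⟩
  ⟪ walk S k , 𝟏 ⟫              ≡⟨ ⟪⟫-iter skew k 𝟏 𝟏 ⟩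
  sgn k * moment S k            ≡⟨ cong (λ s → - s * moment S k) (sgn-double j) ⟩
  - 1ℤ * moment S k             ≡⟨ ℤ.-1*i≡-i (moment S k) ⟩
  - moment S k                  ∎)
  where
  open ≡-Reasoning
  k = suc (j ℕ.+ j)

2∣i*i-i : ∀ i → + 2 ∣ i * i - i
2∣i*i-i (+ n) = nonnegative n
  where
  step : ∀ x → (x * x - x) + x * + 2 ≡ (1ℤ + x) * (1ℤ + x) - (1ℤ + x)
  step = solve-∀
  nonnegative : ∀ n → + 2 ∣ + n * + n - + n
  nonnegative zero    = divides 0ℤ refl
  nonnegative (suc n) = subst (+ 2 ∣_) (step (+ n)) (∣m∣n⇒∣m+n (nonnegative n) (divides (+ n) refl))
2∣i*i-i i@(-[1+ n ]) = subst (+ 2 ∣_) (flip-sign i) (∣m∣n⇒∣m+n (2∣i*i-i (- i)) (divides (- i) refl))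
  where
  flip-sign : ∀ x → ((- x) * (- x) - (- x)) + (- x) * + 2 ≡ x * x - x
  flip-sign = solve-∀

square≋self : ∀ i → i * i ≋ i mod + 2
square≋self i = mod (2∣i*i-i i)

neg≋self : ∀ i → - i ≋ i mod + 2
neg≋self i = mod (divides (- i) (double i))
  where
  double : ∀ i → - i - i ≡ (- i) * + 2
  double = solve-∀

sgn≋1 : ∀ k → sgn k ≋ 1ℤ mod + 2
sgn≋1 zero    = ≋-refl
sgn≋1 (suc k) = ≋-trans (neg≋self (sgn k)) (sgn≋1 k)

-- ⟨1, S²ʲ1⟩ = ± |Sʲ1|² has the parity of ⟨1, Sʲ1⟩.
moment-even : {S : Matrix ℤ n} → Skew S → ∀ k → + 2 ∣ moment S (suc k)
moment-even {n} {S} skew = <-rec (λ k → + 2 ∣ moment S (suc k)) step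
  where
  step : ∀ k → (∀ {j} → j ℕ.< k → + 2 ∣ moment S (suc j)) → + 2 ∣ moment S (suc k)
  step k ih with parity k
  ... | j , inj₁ refl = subst (+ 2 ∣_) (sym (moment-odd skew j)) (divides 0ℤ refl)
  ... | j , inj₂ refl = ≋0⇒∣ (begin
    moment S (suc (suc (j ℕ.+ j)))            ≡⟨ cong (moment S) (cong suc (sym (ℕ.+-suc j j))) ⟩
    moment S (q ℕ.+ q)                        ≡⟨ ℤ.*-identityˡ (moment S (q ℕ.+ q)) ⟨
    1ℤ * moment S (q ℕ.+ q)                   ≈⟨ ≋-* (≋-sym (sgn≋1 q)) ≋-refl ⟩
    sgn q * moment S (q ℕ.+ q)                ≡⟨ walk-gram skew q q ⟨
    ⟪ walk S q , walk S q ⟫                   ≈⟨ ≋-sum (λ i → ≋-trans (square≋self (walk S q i))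
                                                  (≡⇒≋ (sym (ℤ.*-identityˡ (walk S q i))))) ⟩
    moment S q                                ≈⟨ ∣⇒≋0 (ih (s≤s (ℕ.m≤m+n j j))) ⟩
    0ℤ                                        ∎)
    where
    open ≋-Reasoning (+ 2)
    q = suc j

-- The generalized spectrum determines the moments

addFirst : Vector ℤ n → (Fin n → Vector ℤ (suc n)) → Vector ℤ (suc n) → Matrix ℤ (suc n)
addFirst a C u r zero    = u r
addFirst a C u r (suc j) = C j r + a j * u r

-- The stages of a column operation carried out one column at a time: the first k multiples have
-- already been cleared.
zeroBelow : ℕ → Vector ℤ n → Vector ℤ n
zeroBelow k a j = if does (toℕ j ℕ.<? k) then 0ℤ else a j

zeroBelow-< : ∀ {k} {a : Vector ℤ n} {j} → toℕ j ℕ.< k → zeroBelow k a j ≡ 0ℤ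
zeroBelow-< {k = k} {a} {j} j<k = cong (if_then 0ℤ else a j) (dec-true (toℕ j ℕ.<? k) j<k)

zeroBelow-≮ : ∀ {k} {a : Vector ℤ n} {j} → ¬ toℕ j ℕ.< k → zeroBelow k a j ≡ a j
zeroBelow-≮ {k = k} {a} {j} j≮k = cong (if_then 0ℤ else a j) (dec-false (toℕ j ℕ.<? k) j≮k)

det-addFirst : (a : Vector ℤ n) (C : Fin n → Vector ℤ (suc n)) (u : Vector ℤ (suc n)) →
  det (addFirst a C u) ≡ det (addFirst (λ _ → 0ℤ) C u)
det-addFirst {n} a C u = trans (sym (steps n ℕ.≤-refl)) (det-cong all-zero)
  where
  addFirst-cong : ∀ {a b r c} → (∀ j → c ≡ suc j → a j ≡ b j) → addFirst a C u r c ≡ addFirst b C u r c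
  addFirst-cong {c = zero}  _   = refl
  addFirst-cong {r = r} {c = suc j} eq = cong (λ z → C j r + z * u r) (eq j refl)
  all-zero : ∀ r c → addFirst (zeroBelow n a) C u r c ≡ addFirst (λ _ → 0ℤ) C u r c
  all-zero r c = addFirst-cong {r = r} {c = c} λ j _ → zeroBelow-< {a = a} (Fin.toℕ<n j)
  steps : ∀ k → k ℕ.≤ n → det (addFirst (zeroBelow k a) C u) ≡ det (addFirst a C u)
  steps zero    _   = refl
  steps (suc k) k<n = trans (sym step) (steps k (ℕ.<⇒≤ k<n))
    where
    j = fromℕ< k<n
    j≡k : toℕ j ≡ k
    j≡k = Fin.toℕ-fromℕ< k<n
    here : zeroBelow k a j ≡ a j
    here = zeroBelow-≮ {a = a} (ℕ.<-irrefl j≡k)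
    gone : zeroBelow (suc k) a j ≡ 0ℤ
    gone = zeroBelow-< {a = a} (ℕ.≤-reflexive (cong suc j≡k))
    elsewhere : ∀ i → i ≢ j → zeroBelow k a i ≡ zeroBelow (suc k) a i
    elsewhere i i≢j = by-cases (toℕ i ℕ.<? k)
      where
      by-cases : Dec (toℕ i ℕ.< k) → zeroBelow k a i ≡ zeroBelow (suc k) a i
      by-cases (yes i<k) = trans (zeroBelow-< {a = a} i<k) (sym (zeroBelow-< {a = a} (ℕ.m<n⇒m<1+n i<k)))
      by-cases (no  i≮k) = trans (zeroBelow-≮ {a = a} i≮k) (sym (zeroBelow-≮ {k = suc k} {a = a}
        (λ { (s≤s i≤k) → i≮k (ℕ.≤∧≢⇒< i≤k (λ eq → i≢j (Fin.toℕ-injective (trans eq (sym j≡k))))) })))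
    step : det (addFirst (zeroBelow k a) C u) ≡ det (addFirst (zeroBelow (suc k) a) C u)
    step = begin
      det (addFirst (zeroBelow k a) C u)
        ≡⟨ det-linear (suc j) (a j)
             {addFirst (zeroBelow k a) C u} {addFirst (zeroBelow (suc k) a) C u} {E}
             (λ r → trans (cong (λ z → C j r + z * u r) here)
               (trans (regroup (C j r) (a j) (u r))
                 (sym (cong₂ (λ z e → C j r + z * u r + a j * e) gone (setCol-≡ (addFirst (zeroBelow (suc k) a) C u) (suc j) u r)))))
             (λ r c c≢j → addFirst-cong {r = r} {c = c} (λ i c≡i → elsewhere i (λ i≡j → c≢j (trans c≡i (cong suc i≡j)))))
             (λ r c c≢j → setCol-≢ (addFirst (zeroBelow (suc k) a) C u) (suc j) u r c c≢j) ⟩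
      det (addFirst (zeroBelow (suc k) a) C u) + a j * det E
        ≡⟨ cong (λ z → det (addFirst (zeroBelow (suc k) a) C u) + a j * z) E-zero ⟩
      det (addFirst (zeroBelow (suc k) a) C u) + a j * 0ℤ
        ≡⟨ finish (det (addFirst (zeroBelow (suc k) a) C u)) (a j) ⟩
      det (addFirst (zeroBelow (suc k) a) C u) ∎
      where
      open ≡-Reasoning
      E = setCol (addFirst (zeroBelow (suc k) a) C u) (suc j) u
      E-zero : det E ≡ 0ℤ
      E-zero = det-alternating E {zero} {suc j} (λ ())
        (λ r → sym (setCol-≡ (addFirst (zeroBelow (suc k) a) C u) (suc j) u r))
      regroup : ∀ c a u → c + a * u ≡ c + 0ℤ * u + a * u
      regroup = solve-∀
      finish : ∀ x y → x + y * 0ℤ ≡ x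
      finish = solve-∀

-- I + tS is I - (-t)S, and `shifted` is I + tS - tJ = I - t(J - S). Their determinants are the
-- reversed characteristic polynomials of S at -t and of J - S at t.
resolvent : ℤ → Matrix ℤ n → Matrix ℤ n
resolvent t S i j = 𝟙 i j + t * S i j

shifted : ℤ → Matrix ℤ n → Matrix ℤ n
shifted t S i j = resolvent t S i j - t

module Resolvent (t : ℤ) (S : Matrix ℤ (suc n)) where

  -- The Neumann series of (I + tS)⁻¹ 𝟏, cut off after M terms; `series` is its pairing with 𝟏.
  partial : ℕ → Vector ℤ (suc n)
  partial zero    i = 0ℤ
  partial (suc M) i = partial M i + (- t) ^ M * walk S M i

  series : ℕ → ℤ
  series zero    = 0ℤ
  series (suc M) = series M + (- t) ^ M * moment S M

  ⟨𝟏,partial⟩ : ∀ M → ⟪ 𝟏 , partial M ⟫ ≡ series M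
  ⟨𝟏,partial⟩ zero    = sum-zero {n = suc n} {f = λ i → 1ℤ * 0ℤ} (λ i → refl)
  ⟨𝟏,partial⟩ (suc M) = trans (⟪⟫-+ʳ 𝟏 (partial M) (λ i → (- t) ^ M * walk S M i))
    (cong₂ _+_ (⟨𝟏,partial⟩ M) (⟪⟫-*ʳ ((- t) ^ M) 𝟏 (walk S M)))

  resolvent-⊗ᵥ : ∀ x i → (resolvent t S ⊗ᵥ x) i ≡ x i + t * (S ⊗ᵥ x) i
  resolvent-⊗ᵥ x i = begin
    ⟪ (λ j → 𝟙 i j + t * S i j) , x ⟫   ≡⟨ ⟪⟫-congˡ x (λ j → cong (_+ t * S i j) (sym (ℤ.*-identityˡ (𝟙 i j)))) ⟩
    ⟪ (λ j → 1ℤ * 𝟙 i j + t * S i j) , x ⟫ ≡⟨ ⟪⟫-linˡ 1ℤ t x (𝟙 i) (S i) ⟩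
    1ℤ * ⟪ 𝟙 i , x ⟫ + t * (S ⊗ᵥ x) i   ≡⟨ cong (_+ t * (S ⊗ᵥ x) i) (trans (ℤ.*-identityˡ ⟪ 𝟙 i , x ⟫) (𝟙-⊗ᵥ x i)) ⟩
    x i + t * (S ⊗ᵥ x) i                ∎
    where open ≡-Reasoning

  resolvent-partial : ∀ M i → (resolvent t S ⊗ᵥ partial M) i ≡ 1ℤ + (- ((- t) ^ M)) * walk S M i
  resolvent-partial zero i = sum-zero {f = λ j → resolvent t S i j * 0ℤ} (λ j → ℤ.*-zeroʳ (resolvent t S i j))
  resolvent-partial (suc M) i = begin
    ⟪ A i , (λ j → partial M j + τ * walk S M j) ⟫           ≡⟨ ⟪⟫-+ʳ (A i) (partial M) (λ j → τ * walk S M j) ⟩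
    (A ⊗ᵥ partial M) i + ⟪ A i , (λ j → τ * walk S M j) ⟫    ≡⟨ cong₂ _+_ (resolvent-partial M i)
                                                                 (trans (⟪⟫-*ʳ τ (A i) (walk S M)) (cong (_*_ τ) (resolvent-⊗ᵥ (walk S M) i))) ⟩
    1ℤ + (- τ) * walk S M i + τ * (walk S M i + t * walk S (suc M) i)  ≡⟨ collect t τ (walk S M i) (walk S (suc M) i) ⟩
    1ℤ + (- ((- t) * τ)) * walk S (suc M) i                  ∎
    where
    open ≡-Reasoning
    A = resolvent t S
    τ = (- t) ^ M
    collect : ∀ t τ w w′ → 1ℤ + (- τ) * w + τ * (w + t * w′) ≡ 1ℤ + (- ((- t) * τ)) * w′
    collect = solve-∀

  shifted-partial : ∀ M i → (shifted t S ⊗ᵥ partial M) i ≡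
    (1ℤ + (- (t * series M)) * 1ℤ) + (- ((- t) ^ M)) * walk S M i
  shifted-partial M i = begin
    ⟪ (λ j → resolvent t S i j - t) , x ⟫
      ≡⟨ ⟪⟫-congˡ x (λ j → scale (resolvent t S i j) t) ⟩
    ⟪ (λ j → 1ℤ * resolvent t S i j + (- t) * 𝟏 j) , x ⟫
      ≡⟨ ⟪⟫-linˡ 1ℤ (- t) x (resolvent t S i) 𝟏 ⟩
    1ℤ * (resolvent t S ⊗ᵥ x) i + (- t) * ⟪ 𝟏 , x ⟫
      ≡⟨ cong₂ (λ y z → 1ℤ * y + (- t) * z) (resolvent-partial M i) (⟨𝟏,partial⟩ M) ⟩
    1ℤ * (1ℤ + (- τ) * walk S M i) + (- t) * series M
      ≡⟨ collect t τ (series M) (walk S M i) ⟩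
    (1ℤ + (- (t * series M)) * 1ℤ) + (- τ) * walk S M i ∎
    where
    open ≡-Reasoning
    x = partial M
    τ = (- t) ^ M
    scale : ∀ r t → r - t ≡ 1ℤ * r + (- t) * 1ℤ
    scale = solve-∀
    collect : ∀ t τ s w → 1ℤ * (1ℤ + (- τ) * w) + (- t) * s ≡ (1ℤ + (- (t * s)) * 1ℤ) + (- τ) * w
    collect = solve-∀

  partial≋1 : ∀ M i → partial (suc M) i ≋ 1ℤ mod t
  partial≋1 zero    i = ≡⇒≋ refl
  partial≋1 (suc M) i = ≋-trans (≋-+ (partial≋1 M i) (∣⇒≋0 (∣m⇒∣m*n (walk S (suc M) i)
    (∣m⇒∣m*n ((- t) ^ M) (∣m⇒∣-m (∣-refl {t})))))) (≡⇒≋ refl)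

  det-resolvent≋1 : det (resolvent t S) ≋ 1ℤ mod t
  det-resolvent≋1 = ≋-trans
    (RingRelation.det-~ {R₁ = ℤ.+-*-commutativeRing} {R₂ = ℤ.+-*-commutativeRing} {_~_ = λ a b → a ≋ b mod t}
      (record { ~-0 = ≋-refl ; ~-1 = ≋-refl ; ~-+ = ≋-+ ; ~-* = ≋-* ; ~-neg = ≋-neg })
      {A = resolvent t S} {B = 𝟙}
      (λ i j → ≋-trans (≋-+ (≋-refl {𝟙 i j}) (∣⇒≋0 (∣m⇒∣m*n (S i j) (∣-refl {t})))) (≡⇒≋ (ℤ.+-identityʳ (𝟙 i j)))))
    (≡⇒≋ (det-𝟙 (suc n)))

  -- A truncated matrix determinant lemma, det (I + tS - tJ) = det (I + tS) (1 - t 𝟏ᵀ(I + tS)⁻¹𝟏).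
  -- Cramer's rule for the first column, applied to both matrices and the truncated series, avoids
  -- the inverse; its price is the factor `partial M zero` on both sides.
  det-shifted : ∀ M → det (shifted t S) * partial M zero ≋
    (1ℤ + (- (t * series M))) * (det (resolvent t S) * partial M zero) mod ((- t) ^ M)
  det-shifted M = begin
    det B * x zero                                 ≡⟨ ℤ.*-comm (det B) (x zero) ⟩
    x zero * det B                                 ≡⟨ cramer B x zero ⟨
    det (setCol B zero (B ⊗ᵥ x))                   ≡⟨ det-setCol-cong B zero (shifted-partial M) ⟩
    det (setCol B zero (λ i → (1ℤ + (- (t * series M)) * 1ℤ) + (- τ) * walk S M i))
      ≡⟨ det-setCol-+* B zero (λ i → 1ℤ + (- (t * series M)) * 1ℤ) (- τ) (walk S M) ⟩
    det (setCol B zero (λ i → 1ℤ + (- (t * series M)) * 1ℤ)) + (- τ) * det (setCol B zero (walk S M))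
      ≈⟨ drop (det (setCol B zero (λ i → 1ℤ + (- (t * series M)) * 1ℤ))) (det (setCol B zero (walk S M))) ⟩
    det (setCol B zero (λ i → 1ℤ + (- (t * series M)) * 1ℤ))
      ≡⟨ det-setCol-+* B zero 𝟏 (- (t * series M)) 𝟏 ⟩
    det (setCol B zero 𝟏) + (- (t * series M)) * det (setCol B zero 𝟏)
      ≡⟨ factor (det (setCol B zero 𝟏)) (- (t * series M)) ⟩
    (1ℤ + (- (t * series M))) * det (setCol B zero 𝟏)
      ≡⟨ cong (_*_ (1ℤ + (- (t * series M)))) border ⟩
    (1ℤ + (- (t * series M))) * det (setCol A zero 𝟏)
      ≈⟨ ≋-*ˡ (1ℤ + (- (t * series M))) solve-A ⟩
    (1ℤ + (- (t * series M))) * (det A * x zero) ∎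
    where
    open ≋-Reasoning ((- t) ^ M)
    A = resolvent t S
    B = shifted t S
    x = partial M
    τ = (- t) ^ M
    factor : ∀ e s → e + s * e ≡ (1ℤ + s) * e
    factor = solve-∀
    drop : ∀ y z → y + (- τ) * z ≋ y mod τ
    drop y z = ≋-trans (≋-+ (≋-refl {y}) (∣⇒≋0 (∣m⇒∣m*n z (∣m⇒∣-m (∣-refl {τ}))))) (≡⇒≋ (ℤ.+-identityʳ y))
    solve-A : det (setCol A zero 𝟏) ≋ det A * x zero mod τ
    solve-A = ≋-sym (≋-trans (≡⇒≋ (trans (ℤ.*-comm (det A) (x zero)) (trans (sym (cramer A x zero))
      (trans (det-setCol-cong A zero (resolvent-partial M)) (det-setCol-+* A zero 𝟏 (- τ) (walk S M))))))
      (drop (det (setCol A zero 𝟏)) (det (setCol A zero (walk S M)))))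
    -- Subtracting tJ adds -t times 𝟏 to each column, and once the first column is 𝟏 itself, this is
    -- a column operation.
    border : det (setCol B zero 𝟏) ≡ det (setCol A zero 𝟏)
    border = trans (det-cong {A = setCol B zero 𝟏} {B = addFirst (λ _ → - t) (λ j r → A r (suc j)) 𝟏} λ { r zero → refl ; r (suc j) → scale (A r (suc j)) t })
      (trans (det-addFirst (λ _ → - t) (λ j r → A r (suc j)) 𝟏)
        (det-cong {A = addFirst (λ _ → 0ℤ) (λ j r → A r (suc j)) 𝟏} {B = setCol A zero 𝟏} λ { r zero → refl ; r (suc j) → ℤ.+-identityʳ (A r (suc j)) }))
      where
      scale : ∀ r t → r - t ≡ r + (- t) * 1ℤ
      scale = solve-∀

^-≢0 : ∀ {a} M → a ≢ 0ℤ → a ^ M ≢ 0ℤ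
^-≢0 zero    a≢0 ()
^-≢0 {a} (suc M) a≢0 eq with ℤ.i*j≡0⇒i≡0∨j≡0 a eq
... | inj₁ a≡0 = a≢0 a≡0
... | inj₂ aᴹ≡0 = ^-≢0 M a≢0 aᴹ≡0

≡0-if-all-divide : ∀ {a} → (∀ k → + suc k ∣ a) → a ≡ 0ℤ
≡0-if-all-divide {a} h with ℤ.∣ a ∣ in eq
... | zero  = ℤ.∣i∣≡0⇒i≡0 eq
... | suc k = contradiction (subst (suc (suc k) ℕ.∣_) eq (∣⇒∣ᵤ (h (suc k)))) (ℕ.>⇒∤ ℕ.≤-refl)

-- Strong induction on N. In the two instances of `det-shifted` the moments below N cancel, which
-- leaves t ∣ δ for the difference δ of the N-th moments. As t is an arbitrary positive integer, δ =
-- 0.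
moments-determined : (S T : Matrix ℤ (suc n)) →
  (∀ t → t ≢ 0ℤ → det (resolvent t S) ≡ det (resolvent t T)) →
  (∀ t → t ≢ 0ℤ → det (shifted t S) ≡ det (shifted t T)) →
  ∀ N → moment S N ≡ moment T N
moments-determined {n} S T resolvents shifteds = <-rec (λ N → moment S N ≡ moment T N) step
  where
  step : ∀ N → (∀ {j} → j ℕ.< N → moment S j ≡ moment T j) → moment S N ≡ moment T N
  step N ih = trans (split-off (moment S N) (moment T N))
      (trans (cong (_+ moment T N) (≡0-if-all-divide t∣δ)) (ℤ.+-identityˡ (moment T N)))
    where
    split-off : ∀ x y → x ≡ (x - y) + y
    split-off = solve-∀
    t∣δ : ∀ k → + suc k ∣ moment S N - moment T N
    t∣δ k = ≋0⇒∣ (begin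
      δ                              ≡⟨ ℤ.*-identityʳ δ ⟨
      δ * 1ℤ                         ≈⟨ ≋-*ˡ δ (≋-sym u≋1) ⟩
      δ * u                          ≡⟨ split t δ δ′ u ⟩
      (δ - t * δ′) * u + t * (δ′ * u) ≈⟨ ≋-+ (∣⇒≋0 t∣) (∣⇒≋0 (∣m⇒∣m*n (δ′ * u) (∣-refl {t}))) ⟩
      0ℤ                             ∎)
      where
      open ≋-Reasoning (+ suc k)
      t = + suc k
      t≢0 : t ≢ 0ℤ
      t≢0 ()
      module S = Resolvent t S
      module T = Resolvent t T
      -- One power of t beyond N is spent on the factor t in front of the series; the second is the
      -- one that divides δ. It brings in the next moments, whose difference δ′ carries a factor t.
      M = suc (suc N)
      δ = moment S N - moment T N
      δ′ = moment S (suc N) - moment T (suc N)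
      dA = det (resolvent t S)
      dB = det (shifted t S)
      x = S.partial M zero
      y = T.partial M zero
      u = dA * (x * y)
      τ = (- t) ^ N
      split : ∀ t δ δ′ u → δ * u ≡ (δ - t * δ′) * u + t * (δ′ * u)
      split = solve-∀
      u≋1 : u ≋ 1ℤ mod t
      u≋1 = ≋-* S.det-resolvent≋1 (≋-* (S.partial≋1 (suc N) zero) (T.partial≋1 (suc N) zero))
      series≡ : ∀ K → K ℕ.≤ N → S.series K ≡ T.series K
      series≡ zero    _   = refl
      series≡ (suc K) K<N = cong₂ (λ s μ → s + (- t) ^ K * μ) (series≡ K (ℕ.<⇒≤ K<N)) (ih K<N)
      -- The Cramer factors x and y of S and T differ, so the two congruences are cross-multiplied.
      -- Both factors are 1 modulo t.
      both : (1ℤ + (- (t * S.series M))) * (dA * x) * y ≋ (1ℤ + (- (t * T.series M))) * (dA * y) * x mod ((- t) ^ M)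
      both = ≋-trans (≋-* (≋-sym (S.det-shifted M)) ≋-refl) (≋-trans (≡⇒≋ (regroup dB x y))
        (≋-* (subst₂ (λ p q → q * y ≋ (1ℤ + (- (t * T.series M))) * (p * y) mod ((- t) ^ M))
               (sym (resolvents t t≢0)) (sym (shifteds t t≢0)) (T.det-shifted M)) ≋-refl))
        where
        regroup : ∀ b x y → b * x * y ≡ b * y * x
        regroup = solve-∀
      difference≡ : (1ℤ + (- (t * S.series M))) * (dA * x) * y - (1ℤ + (- (t * T.series M))) * (dA * y) * x
        ≡ (t * τ) * (- ((δ - t * δ′) * u))
      difference≡ = trans
        (cong (λ s → (1ℤ + (- (t * (s + τ * moment S N + (- t) * τ * moment S (suc N))))) * (dA * x) * y
            - (1ℤ + (- (t * T.series M))) * (dA * y) * x) (series≡ N ℕ.≤-refl))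
        (expand t τ (T.series N) (moment S N) (moment T N) (moment S (suc N)) (moment T (suc N)) dA x y)
        where
        expand : ∀ t τ s a b a′ b′ d x y →
          (1ℤ + (- (t * (s + τ * a + (- t) * τ * a′)))) * (d * x) * y
            - (1ℤ + (- (t * (s + τ * b + (- t) * τ * b′)))) * (d * y) * x
          ≡ (t * τ) * (- ((a - b - t * (a′ - b′)) * (d * (x * y))))
        expand = solve-∀
      t∣ : t ∣ (δ - t * δ′) * u
      t∣ = subst (t ∣_) (ℤ.neg-involutive ((δ - t * δ′) * u)) (∣m⇒∣-m
        (*-cancelˡ-∣ (t * τ) {{≢-nonZero tτ≢0}}
          (subst₂ _∣_ (modulus t τ) difference≡ (difference both))))
        where
        modulus : ∀ t τ → (- t) * ((- t) * τ) ≡ (t * τ) * t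
        modulus = solve-∀
        tτ≢0 : t * τ ≢ 0ℤ
        tτ≢0 eq with ℤ.i*j≡0⇒i≡0∨j≡0 t eq
        ... | inj₁ t≡0 = t≢0 t≡0
        ... | inj₂ τ≡0 = ^-≢0 N (λ ()) τ≡0

cospectral-moments : ∀ {c ℓ₁ ℓ₂} (K : AlgClosedField₀ c ℓ₁ ℓ₂) (let open Spectrum K) (S T : Matrix ℤ (suc n)) →
  Cospectral S T → Cospectral (J- S) (J- T) → ∀ k → moment S k ≡ moment T k
cospectral-moments K S T S~T J-S~J-T = moments-determined S T
  (λ t t≢0 → trans (det-cong (λ i j → negated t (𝟙 i j) (S i j)))
    (trans (cospectral-det {A = S} {T} S~T (- t) (t≢0 ∘ ℤ.neg-injective))
      (det-cong (λ i j → sym (negated t (𝟙 i j) (T i j))))))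
  (λ t t≢0 → trans (det-cong (λ i j → complement t (𝟙 i j) (S i j)))
    (trans (cospectral-det {A = J- S} {J- T} J-S~J-T t t≢0)
      (det-cong (λ i j → sym (complement t (𝟙 i j) (T i j))))))
  where
  open OverField K using (cospectral-det)
  negated : ∀ t e a → e + t * a ≡ e - (- t) * a
  negated = solve-∀
  complement : ∀ t e a → e + t * a - t ≡ e - t * (1ℤ - a)
  complement = solve-∀

-- Diagonal factorisations W = A D B

record Factorisation (W : Matrix ℤ n) (D : Vector ℤ n) : Set where
  field
    A B    : Matrix ℤ n
    A-inv  : Invertible A
    B-inv  : Invertible B
    factor : ∀ x → W ⊗ᵥ x ≗ A ⊗ᵥ (λ i → D i * (B ⊗ᵥ x) i)

  open Invertible A-inv public using () renaming (inv to A⁻¹; invˡ to A⁻¹A; invʳ to AA⁻¹)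
  open Invertible B-inv public using () renaming (inv to B⁻¹; invˡ to B⁻¹B; invʳ to BB⁻¹)

  A⁻¹W : ∀ x → A⁻¹ ⊗ᵥ (W ⊗ᵥ x) ≗ (λ i → D i * (B ⊗ᵥ x) i)
  A⁻¹W x i = trans (⊗ᵥ-cong A⁻¹ (factor x) i) (A⁻¹A (λ i → D i * (B ⊗ᵥ x) i) i)

  WB⁻¹ : ∀ y → W ⊗ᵥ (B⁻¹ ⊗ᵥ y) ≗ A ⊗ᵥ (λ i → D i * y i)
  WB⁻¹ y i = trans (factor (B⁻¹ ⊗ᵥ y) i) (⊗ᵥ-cong A (λ j → cong (_*_ (D j)) (BB⁻¹ y j)) i)

⟪⟫-nondegenerate : {x y : Vector ℤ n} → (∀ z → ⟪ x , z ⟫ ≡ ⟪ y , z ⟫) → x ≗ y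
⟪⟫-nondegenerate {x = x} {y} eq i = trans (sym (at x)) (trans (eq (𝟙 i)) (at y))
  where
  at : ∀ x → ⟪ x , 𝟙 i ⟫ ≡ x i
  at x = trans (⟪⟫-comm x (𝟙 i)) (𝟙-⊗ᵥ x i)

transposeFactorisation : {W : Matrix ℤ n} {D : Vector ℤ n} → Factorisation W D → Factorisation (W ᵀ) D
transposeFactorisation {W = W} {D} F = record
  { A = B ᵀ ; B = A ᵀ
  ; A-inv = transpose-invertible B-inv ; B-inv = transpose-invertible A-inv
  ; factor = λ x → ⟪⟫-nondegenerate (λ z → begin
      ⟪ W ᵀ ⊗ᵥ x , z ⟫                                   ≡⟨ ⟪⟫-adjoint W x z ⟨
      ⟪ x , W ⊗ᵥ z ⟫                                     ≡⟨ ⟪⟫-congʳ x (factor z) ⟩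
      ⟪ x , A ⊗ᵥ (λ i → D i * (B ⊗ᵥ z) i) ⟫              ≡⟨ ⟪⟫-adjoint A x (λ i → D i * (B ⊗ᵥ z) i) ⟩
      ⟪ A ᵀ ⊗ᵥ x , (λ i → D i * (B ⊗ᵥ z) i) ⟫            ≡⟨ sum-cong (λ i → swap ((A ᵀ ⊗ᵥ x) i) (D i) ((B ⊗ᵥ z) i)) ⟩
      ⟪ (λ i → D i * (A ᵀ ⊗ᵥ x) i) , B ⊗ᵥ z ⟫            ≡⟨ ⟪⟫-adjoint B (λ i → D i * (A ᵀ ⊗ᵥ x) i) z ⟩
      ⟪ B ᵀ ⊗ᵥ (λ i → D i * (A ᵀ ⊗ᵥ x) i) , z ⟫          ∎) }
  where
  open Factorisation F
  open ≡-Reasoning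
  swap : ∀ x y z → x * (y * z) ≡ (y * x) * z
  swap = solve-∀

≋-sum-single : (j : Fin n) (f : Vector ℤ n) → (∀ i → i ≢ j → p ∣ f i) → sum f ≋ f j mod p
≋-sum-single zero f h = ≋-trans (≋-+ (≋-refl {f zero}) (∣⇒≋0 (∣-sum (λ i → h (suc i) (λ ()))))) (≡⇒≋ (ℤ.+-identityʳ (f zero)))
≋-sum-single (suc j) f h = ≋-trans
  (≋-+ (∣⇒≋0 (h zero (λ ()))) (≋-sum-single j (f ∘ suc) (λ i i≢j → h (suc i) (i≢j ∘ Fin.suc-injective))))
  (≡⇒≋ (ℤ.+-identityˡ (f (suc j))))

-- All D k with k ≠ j are invertible modulo p, so D B x ≡ 0 leaves only coordinate j of B x free,
-- and the kernel is spanned by column j of B⁻¹.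
kernel : {W : Matrix ℤ n} {D : Vector ℤ n} (F : Factorisation W D) (let open Factorisation F) →
  PrimeIdeal p → (j : Fin n) → (∀ i → i ≢ j → ¬ p ∣ D i) →
  ∀ x → (∀ i → p ∣ (W ⊗ᵥ x) i) → ∀ i → x i ≋ (B ⊗ᵥ x) j * B⁻¹ i j mod p
kernel {p = p} {D = D} F P j p∤D x p∣Wx i = ≋-trans (≡⇒≋ (sym (B⁻¹B x i)))
  (≋-trans (≋-sum-single j (λ k → B⁻¹ i k * (B ⊗ᵥ x) k)
      (λ k k≢j → ∣n⇒∣m*n (B⁻¹ i k) (PrimeIdeal.cancel P (D k) (p∤D k k≢j) (p∣DBx k))))
    (≡⇒≋ (ℤ.*-comm (B⁻¹ i j) ((B ⊗ᵥ x) j))))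
  where
  open Factorisation F
  p∣DBx : ∀ k → p ∣ D k * (B ⊗ᵥ x) k
  p∣DBx k = subst (p ∣_) (A⁻¹W x k) (∣-⟪⟫ (A⁻¹ k) p∣Wx)

-- Krylov matrices

-- A coefficient vector x stands for a polynomial g of degree at most n, with `krylov S ⊗ᵥ x` equal
-- to g(S) 𝟏. This is multiplication by the variable with the top coefficient dropped;
-- `krylov-shift` restores the lost term.
shift : Vector ℤ (suc n) → Vector ℤ (suc n)
shift x zero    = 0ℤ
shift x (suc i) = x (inject₁ i)

krylov-column : (S : Matrix ℤ n) (k : Fin n) → krylov S ⊗ᵥ 𝟙 k ≗ walk S (toℕ k)
krylov-column S k = ⊗ᵥ-basis (krylov S) k

krylov-shift : (S : Matrix ℤ (suc n)) (x : Vector ℤ (suc n)) → ∀ i →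
  (S ⊗ᵥ (krylov S ⊗ᵥ x)) i ≡ (krylov S ⊗ᵥ shift x) i + x (fromℕ n) * walk S (suc n) i
krylov-shift {n} S x i = begin
  ⟪ S i , krylov S ⊗ᵥ x ⟫                            ≡⟨ ⟪⟫-congʳ (S i) (⊗ᵥ-comb (krylov S) x) ⟩
  ⟪ S i , comb x (krylov S ᵀ) ⟫                      ≡⟨ ⟪⟫-comb (S i) x (krylov S ᵀ) ⟩
  sum t                                              ≡⟨ sum-init-last t ⟩
  sum (t ∘ inject₁) + t (fromℕ n)                    ≡⟨ cong₂ _+_ (sum-cong inner) outer ⟩
  rest + x (fromℕ n) * walk S (suc n) i              ≡⟨ cong (_+ x (fromℕ n) * walk S (suc n) i)
                                                          (sym (trans (cong (_+ rest) (ℤ.*-zeroʳ (walk S 0 i))) (ℤ.+-identityˡ rest))) ⟩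
  (krylov S ⊗ᵥ shift x) i + x (fromℕ n) * walk S (suc n) i ∎
  where
  open ≡-Reasoning
  t : Vector ℤ (suc n)
  t k = x k * walk S (suc (toℕ k)) i
  rest : ℤ
  rest = sum (λ k → walk S (suc (toℕ k)) i * x (inject₁ k))
  inner : ∀ k → t (inject₁ k) ≡ walk S (suc (toℕ k)) i * x (inject₁ k)
  inner k = trans (ℤ.*-comm (x (inject₁ k)) _) (cong (λ q → walk S (suc q) i * x (inject₁ k)) (Fin.toℕ-inject₁ k))
  outer : t (fromℕ n) ≡ x (fromℕ n) * walk S (suc n) i
  outer = cong (λ q → x (fromℕ n) * walk S (suc q) i) (Fin.toℕ-fromℕ n)

Reverses : Matrix ℤ n → Fin n ↔ Fin n → Set
Reverses S π = ∀ i j → S (Inverse.to π i) (Inverse.to π j) ≡ - S i j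

reverses-sym : {S : Matrix ℤ n} {π : Fin n ↔ Fin n} → Reverses S π → Reverses S (↔-sym π)
reverses-sym {S = S} {π} rev i j = sym (begin
  - S i j                              ≡⟨ cong₂ (λ k l → - S k l) (sym (to∘from i)) (sym (to∘from j)) ⟩
  - S (to (from i)) (to (from j))      ≡⟨ cong (λ z → - z) (rev (from i) (from j)) ⟩
  - - S (from i) (from j)              ≡⟨ ℤ.neg-involutive (S (from i) (from j)) ⟩
  S (from i) (from j)                  ∎)
  where
  open ≡-Reasoning
  open Inverse π using (to; from)
  to∘from : ∀ i → to (from i) ≡ i
  to∘from = Inverse.strictlyInverseˡ π

module _ {S : Matrix ℤ n} (π : Fin n ↔ Fin n) (rev : Reverses S π) where
  open Inverse π using (to)

  reverse-⊗ᵥ : ∀ x i → (S ⊗ᵥ x) (to i) ≡ - (S ⊗ᵥ (x ∘ to)) i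
  reverse-⊗ᵥ x i = begin
    ⟪ S (to i) , x ⟫                         ≡⟨ ⟪⟫-permute (S (to i)) x π ⟩
    ⟪ S (to i) ∘ to , x ∘ to ⟫               ≡⟨ ⟪⟫-congˡ (x ∘ to) (λ j → trans (rev i j) (sym (ℤ.-1*i≡-i (S i j)))) ⟩
    ⟪ (λ j → - 1ℤ * S i j) , x ∘ to ⟫        ≡⟨ ⟪⟫-*ˡ (- 1ℤ) (S i) (x ∘ to) ⟩
    - 1ℤ * ⟪ S i , x ∘ to ⟫                  ≡⟨ ℤ.-1*i≡-i ⟪ S i , x ∘ to ⟫ ⟩
    - ⟪ S i , x ∘ to ⟫                       ∎
    where open ≡-Reasoning

  reverse-walk : ∀ k i → walk S k (to i) ≡ sgn k * walk S k i
  reverse-walk zero    i = refl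
  reverse-walk (suc k) i = begin
    (S ⊗ᵥ walk S k) (to i)                   ≡⟨ reverse-⊗ᵥ (walk S k) i ⟩
    - (S ⊗ᵥ (walk S k ∘ to)) i               ≡⟨ cong (λ z → - z) (⊗ᵥ-cong S (reverse-walk k) i) ⟩
    - (S ⊗ᵥ (λ j → sgn k * walk S k j)) i    ≡⟨ cong (λ z → - z) (⟪⟫-*ʳ (sgn k) (S i) (walk S k)) ⟩
    - (sgn k * walk S (suc k) i)             ≡⟨ ℤ.neg-distribˡ-* (sgn k) (walk S (suc k) i) ⟩
    (- sgn k) * walk S (suc k) i             ∎
    where open ≡-Reasoning

-- The coefficients of g(-X). A reversal fixes 𝟏 and conjugates S to -S, so it carries g(S) 𝟏 to
-- g(-S) 𝟏.
signed : Vector ℤ n → Vector ℤ n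
signed x k = sgn (toℕ k) * x k

krylov-signed : {S : Matrix ℤ n} (π : Fin n ↔ Fin n) → Reverses S π → ∀ x i →
  (krylov S ⊗ᵥ x) (Inverse.to π i) ≡ (krylov S ⊗ᵥ signed x) i
krylov-signed {S = S} π rev x i = sum-cong (λ k → trans (cong (_* x k) (reverse-walk π rev (toℕ k) i))
  (regroup (sgn (toℕ k)) (walk S (toℕ k) i) (x k)))
  where
  regroup : ∀ s w x → s * w * x ≡ w * (s * x)
  regroup = solve-∀

⟪⟫-move : (π : Fin n ↔ Fin n) (x y : Vector ℤ n) → ⟪ x ∘ Inverse.to π , y ⟫ ≡ ⟪ x , y ∘ Inverse.from π ⟫
⟪⟫-move π x y = trans (⟪⟫-permute (x ∘ to) y (↔-sym π))
  (⟪⟫-congˡ (y ∘ from) (λ i → cong x (Inverse.strictlyInverseˡ π i)))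
  where open Inverse π using (to; from)

-- The odd part of the last invariant factor

module OddPrime
  {S : Matrix ℤ (suc n)} (skew : Skew S) (π : Fin (suc n) ↔ Fin (suc n)) (rev : Reverses S π)
  {D : Vector ℤ (suc n)} (F : Factorisation (krylov S) D) {d : ℤ} (d≢0 : d ≢ 0ℤ)
  (D-last : D (fromℕ n) ≡ + 2 * d) (D-other : ∀ i → i ≢ fromℕ n → ∃ λ e → e * D i ≡ + 2)
  {p : ℤ} (P : PrimeIdeal p) (p∤2 : ¬ p ∣ + 2) (p∣d : p ∣ d)
  where

  open Factorisation F
  open PrimeIdeal P
  private
    W = krylov S
    L = fromℕ n
    to = Inverse.to π
    from = Inverse.from π

  -- Modulo p, v spans the left kernel of W and r the right kernel; u and ρ are dual to them and
  -- read off multipliers. As a polynomial, r annihilates 𝟏 modulo p.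
  v u ρ r : Vector ℤ (suc n)
  v = A⁻¹ L
  u = (A ᵀ) L
  ρ = B L
  r = (B⁻¹ ᵀ) L

  p∤D : ∀ i → i ≢ L → ¬ p ∣ D i
  p∤D i i≢L p∣Di = p∤2 (subst (p ∣_) (proj₂ (D-other i i≢L)) (∣n⇒∣m*n (proj₁ (D-other i i≢L)) p∣Di))

  ⟪v,W⟫ : ∀ x → ⟪ v , W ⊗ᵥ x ⟫ ≡ + 2 * d * ⟪ ρ , x ⟫
  ⟪v,W⟫ x = trans (A⁻¹W x L) (cong (_* ⟪ ρ , x ⟫) D-last)

  p∣⟪v,W⟫ : ∀ x → p ∣ ⟪ v , W ⊗ᵥ x ⟫
  p∣⟪v,W⟫ x = subst (p ∣_) (sym (⟪v,W⟫ x)) (∣m⇒∣m*n ⟪ ρ , x ⟫ (∣n⇒∣m*n (+ 2) p∣d))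

  Wr : ∀ i → (W ⊗ᵥ r) i ≡ + 2 * d * u i
  Wr i = begin
    (W ⊗ᵥ r) i                             ≡⟨ ⊗ᵥ-cong W (λ k → sym (⊗ᵥ-basis B⁻¹ L k)) i ⟩
    (W ⊗ᵥ (B⁻¹ ⊗ᵥ 𝟙 L)) i                  ≡⟨ WB⁻¹ (𝟙 L) i ⟩
    (A ⊗ᵥ (λ k → D k * 𝟙 L k)) i           ≡⟨ ⊗ᵥ-cong A D𝟙 i ⟩
    (A ⊗ᵥ (λ k → + 2 * d * 𝟙 L k)) i       ≡⟨ ⟪⟫-*ʳ (+ 2 * d) (A i) (𝟙 L) ⟩
    + 2 * d * (A ⊗ᵥ 𝟙 L) i                 ≡⟨ cong (_*_ (+ 2 * d)) (⊗ᵥ-basis A L i) ⟩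
    + 2 * d * u i                          ∎
    where
    open ≡-Reasoning
    D𝟙 : ∀ k → D k * 𝟙 L k ≡ + 2 * d * 𝟙 L k
    D𝟙 k with L Fin.≟ k
    ... | yes refl = cong (_* 1ℤ) D-last
    ... | no  _    = trans (ℤ.*-zeroʳ (D k)) (sym (ℤ.*-zeroʳ (+ 2 * d)))

  p∣Wr : ∀ i → p ∣ (W ⊗ᵥ r) i
  p∣Wr i = subst (p ∣_) (sym (Wr i)) (∣m⇒∣m*n (u i) (∣n⇒∣m*n (+ 2) p∣d))

  ⟪ρ,r⟫ : ⟪ ρ , r ⟫ ≡ 1ℤ
  ⟪ρ,r⟫ = trans (⟪⟫-congʳ ρ (λ k → sym (⊗ᵥ-basis B⁻¹ L k))) (trans (BB⁻¹ (𝟙 L) L) (𝟙-diag L))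

  ⟪v,u⟫ : ⟪ v , u ⟫ ≡ 1ℤ
  ⟪v,u⟫ = trans (⟪⟫-congʳ v (λ k → sym (⊗ᵥ-basis A L k))) (trans (A⁻¹A (𝟙 L) L) (𝟙-diag L))

  v-primitive : ∀ c → (∀ i → p ∣ c * v i) → p ∣ c
  v-primitive c h = subst (p ∣_) (trans (⟪⟫-*ʳ c u v) (trans (cong (_*_ c) (trans (⟪⟫-comm u v) ⟪v,u⟫)) (ℤ.*-identityʳ c)))
    (∣-⟪⟫ u h)

  kernelW : ∀ x → (∀ i → p ∣ (W ⊗ᵥ x) i) → ∀ i → x i ≋ ⟪ ρ , x ⟫ * r i mod p
  kernelW = kernel F P L p∤D

  kernelWᵀ : ∀ x → (∀ y → p ∣ ⟪ x , W ⊗ᵥ y ⟫) → ∀ i → x i ≋ ⟪ u , x ⟫ * v i mod p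
  kernelWᵀ x h = kernel (transposeFactorisation F) P L p∤D x
    (λ k → subst (p ∣_) (trans (⟪⟫-congʳ x (krylov-column S k)) (⟪⟫-comm x (walk S (toℕ k)))) (h (𝟙 k)))

  -- The parity of r, which has degree n modulo p when there are n + 1 vertices.
  σ : ℤ
  σ = sgn (toℕ L)

  p∤σ : ¬ p ∣ σ
  p∤σ p∣σ = proper (subst (p ∣_) (sgn-sq (toℕ L)) (∣m⇒∣m*n σ p∣σ))

  W-shift : ∀ x i → p ∣ (S ⊗ᵥ (W ⊗ᵥ x)) i → p ∣ x L → p ∣ (W ⊗ᵥ shift x) i
  W-shift x i h xL = ∣m+n∣n⇒∣m (subst (p ∣_) (krylov-shift S x i) h) (∣m⇒∣m*n (walk S (suc n) i) xL)

  -- If the top coefficient vanished modulo p, X r would lie in the kernel and be a multiple of r.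
  -- Comparing coefficients from the top downwards would then give r ≡ 0, against ⟨ρ, r⟩ = 1.
  p∤r-last : ¬ p ∣ r L
  p∤r-last p∣rL = proper (subst (p ∣_) ⟪ρ,r⟫ (∣-⟪⟫ ρ p∣r))
    where
    shifted≋ : ∀ i → shift r i ≋ ⟪ ρ , shift r ⟫ * r i mod p
    shifted≋ = kernelW (shift r) (λ i → W-shift r i (∣-⟪⟫ (S i) p∣Wr) p∣rL)
    p∣r : ∀ i → p ∣ r i
    p∣r = >-weakInduction (λ i → p ∣ r i) p∣rL
      (λ i p∣ri → ≋-∣ (shifted≋ (suc i)) (∣n⇒∣m*n ⟪ ρ , shift r ⟫ p∣ri))

  ≋-from-multiple : ∀ {a b c} → ¬ p ∣ c → a * c ≋ b * c mod p → a ≋ b mod p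
  ≋-from-multiple {a} {b} {c} p∤c (mod h) = mod (cancel c p∤c (subst (p ∣_) (regroup a b c) h))
    where
    regroup : ∀ a b c → a * c - b * c ≡ c * (a - b)
    regroup = solve-∀

  signed-r′ : ∀ k → signed r k ≋ ⟪ ρ , signed r ⟫ * r k mod p
  signed-r′ = kernelW (signed r) (λ i → subst (p ∣_) (krylov-signed π rev r i) (p∣Wr (to i)))

  -- r(-X) lies in the same one-dimensional kernel as r, and the top coefficients give the ratio.
  ⟪ρ,signed-r⟫≋σ : ⟪ ρ , signed r ⟫ ≋ σ mod p
  ⟪ρ,signed-r⟫≋σ = ≋-from-multiple p∤r-last (≋-sym (signed-r′ L))

  signed-r : ∀ k → signed r k ≋ σ * r k mod p
  signed-r k = ≋-trans (signed-r′ k) (≋-* ⟪ρ,signed-r⟫≋σ ≋-refl)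

  -- The reversal preserves the left kernel, so v ∘ π is a multiple of v. Its multiplier is found
  -- from that of r in the right kernel.
  v∘π : ∀ i → v (to i) ≋ σ * v i mod p
  v∘π i = ≋-trans (kernelWᵀ (v ∘ to) orthogonal i) (≋-* (≋-trans (≡⇒≋ multiplier) ⟪ρ,signed-r⟫≋σ) ≋-refl)
    where
    orthogonal : ∀ y → p ∣ ⟪ v ∘ to , W ⊗ᵥ y ⟫
    orthogonal y = subst (p ∣_)
      (sym (trans (⟪⟫-move π v (W ⊗ᵥ y)) (⟪⟫-congʳ v (krylov-signed (↔-sym π) (reverses-sym {π = π} rev) y))))
      (p∣⟪v,W⟫ (signed y))
    -- W r = 2d u holds exactly and not only modulo p, so 2d may be cancelled although p divides it.
    multiplier : ⟪ u , v ∘ to ⟫ ≡ ⟪ ρ , signed r ⟫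
    multiplier = *-cancel-≢0 2d≢0 (begin
      + 2 * d * ⟪ u , v ∘ to ⟫                    ≡⟨ cong (_*_ (+ 2 * d)) (trans (⟪⟫-comm u (v ∘ to)) (⟪⟫-move π v u)) ⟩
      + 2 * d * ⟪ v , u ∘ from ⟫                  ≡⟨ ⟪⟫-*ʳ (+ 2 * d) v (u ∘ from) ⟨
      ⟪ v , (λ i → + 2 * d * u (from i)) ⟫        ≡⟨ ⟪⟫-congʳ v (λ i → sym (Wr (from i))) ⟩
      ⟪ v , (W ⊗ᵥ r) ∘ from ⟫                     ≡⟨ ⟪⟫-congʳ v (krylov-signed (↔-sym π) (reverses-sym {π = π} rev) r) ⟩
      ⟪ v , W ⊗ᵥ signed r ⟫                       ≡⟨ ⟪v,W⟫ (signed r) ⟩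
      + 2 * d * ⟪ ρ , signed r ⟫                  ∎)
      where
      open ≡-Reasoning
      2d≢0 : + 2 * d ≢ 0ℤ
      2d≢0 eq with ℤ.i*j≡0⇒i≡0∨j≡0 (+ 2) eq
      ... | inj₂ d≡0 = d≢0 d≡0

  -- The left kernel is stable under S, hence S v ≡ μ v. The reversal preserves the line of v but
  -- anticommutes with S, so 2σμ ≡ 0.
  p∣Sv : ∀ i → p ∣ (S ⊗ᵥ v) i
  p∣Sv i = ≋-∣ (Sv≋ i) (∣m⇒∣m*n (v i) p∣μ)
    where
    open ≋-Reasoning p
    w = walk S (suc n)
    -- Pairing v with S W r = W (X r) + r_L w, where r_L is invertible modulo p, shows that v also
    -- annihilates the first walk w beyond the columns of W.
    p∣⟪v,w⟫ : p ∣ ⟪ v , w ⟫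
    p∣⟪v,w⟫ = cancel (r L) p∤r-last (∣m+n∣m⇒∣n
      (subst (p ∣_) (trans (⟪⟫-congʳ v (krylov-shift S r))
        (trans (⟪⟫-+ʳ v (W ⊗ᵥ shift r) (λ i → r L * w i)) (cong (_+_ ⟪ v , W ⊗ᵥ shift r ⟫) (⟪⟫-*ʳ (r L) v w))))
        (∣-⟪⟫ v (λ i → ∣-⟪⟫ (S i) p∣Wr)))
      (p∣⟪v,W⟫ (shift r)))
    p∣⟪v,SW⟫ : ∀ y → p ∣ ⟪ v , S ⊗ᵥ (W ⊗ᵥ y) ⟫
    p∣⟪v,SW⟫ y = subst (p ∣_)
      (sym (trans (⟪⟫-congʳ v (krylov-shift S y))
        (trans (⟪⟫-+ʳ v (W ⊗ᵥ shift y) (λ i → y L * w i)) (cong (_+_ ⟪ v , W ⊗ᵥ shift y ⟫) (⟪⟫-*ʳ (y L) v w)))))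
      (∣m∣n⇒∣m+n (p∣⟪v,W⟫ (shift y)) (∣n⇒∣m*n (y L) p∣⟪v,w⟫))
    μ = ⟪ u , S ⊗ᵥ v ⟫
    Sv≋ : ∀ i → (S ⊗ᵥ v) i ≋ μ * v i mod p
    Sv≋ = kernelWᵀ (S ⊗ᵥ v) (λ y → subst (p ∣_) (sym (⟪⟫-skew skew v (W ⊗ᵥ y))) (∣m⇒∣-m (p∣⟪v,SW⟫ y)))
    two-ways : ∀ i → μ * (σ * v i) ≋ - (σ * (μ * v i)) mod p
    two-ways i = begin
      μ * (σ * v i)                        ≈⟨ ≋-*ˡ μ (v∘π i) ⟨
      μ * v (to i)                         ≈⟨ Sv≋ (to i) ⟨
      (S ⊗ᵥ v) (to i)                      ≡⟨ reverse-⊗ᵥ π rev v i ⟩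
      - (S ⊗ᵥ (v ∘ to)) i                  ≈⟨ ≋-neg (≋-⟪⟫ (S i) v∘π) ⟩
      - (S ⊗ᵥ (λ j → σ * v j)) i           ≡⟨ cong (λ z → - z) (⟪⟫-*ʳ σ (S i) v) ⟩
      - (σ * (S ⊗ᵥ v) i)                   ≈⟨ ≋-neg (≋-*ˡ σ (Sv≋ i)) ⟩
      - (σ * (μ * v i))                    ∎
    p∣μ : p ∣ μ
    p∣μ = cancel σ p∤σ (cancel (+ 2) p∤2 (v-primitive (+ 2 * (σ * μ))
      (λ i → subst (p ∣_) (double μ σ (v i)) (difference (two-ways i)))))
      where
      double : ∀ μ σ v → μ * (σ * v) - (- (σ * (μ * v))) ≡ + 2 * (σ * μ) * v
      double = solve-∀

  -- If p ∣ ⟨v, v⟩ then 2v lies in the column space of W, and comparing degrees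
  -- of the corresponding polynomial in S forces v ∘ π ≡ − σ v.
  p∤⟪v,v⟫ : ¬ p ∣ ⟪ v , v ⟫
  p∤⟪v,v⟫ p∣⟪v,v⟫ = *-∤ p∤σ (*-∤ p∤2 p∤2r) (v-primitive (σ * (+ 2 * (+ 2 * r L)))
    (λ i → subst (p ∣_) (double (r L) σ (v i)) (difference (two-ways i))))
    where
    open ≋-Reasoning p
    -- Solves D y ≡ 2 A⁻¹ v. Away from L this uses e D = 2, whence the factor 2; at L both sides
    -- vanish, because (A⁻¹ v) L is ⟨v, v⟩.
    y : Vector ℤ (suc n)
    y i with i Fin.≟ L
    ... | yes _   = 0ℤ
    ... | no  i≢L = proj₁ (D-other i i≢L) * (A⁻¹ ⊗ᵥ v) i
    Dy : ∀ i → D i * y i ≋ + 2 * (A⁻¹ ⊗ᵥ v) i mod p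
    Dy i with i Fin.≟ L
    ... | yes refl = ≋-trans (≡⇒≋ (ℤ.*-zeroʳ (D L))) (≋-sym (∣⇒≋0 (∣n⇒∣m*n (+ 2) p∣⟪v,v⟫)))
    ... | no  i≢L  = ≡⇒≋ (trans (regroup (D i) (proj₁ (D-other i i≢L)) ((A⁻¹ ⊗ᵥ v) i))
                            (cong (_* (A⁻¹ ⊗ᵥ v) i) (proj₂ (D-other i i≢L))))
      where
      regroup : ∀ d e x → d * (e * x) ≡ (e * d) * x
      regroup = solve-∀
    z = B⁻¹ ⊗ᵥ y
    Wz : ∀ i → (W ⊗ᵥ z) i ≋ + 2 * v i mod p
    Wz i = begin
      (W ⊗ᵥ z) i                                ≡⟨ WB⁻¹ y i ⟩
      (A ⊗ᵥ (λ k → D k * y k)) i                ≈⟨ ≋-⟪⟫ (A i) Dy ⟩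
      (A ⊗ᵥ (λ k → + 2 * (A⁻¹ ⊗ᵥ v) k)) i       ≡⟨ ⟪⟫-*ʳ (+ 2) (A i) (A⁻¹ ⊗ᵥ v) ⟩
      + 2 * (A ⊗ᵥ (A⁻¹ ⊗ᵥ v)) i                 ≡⟨ cong (_*_ (+ 2)) (AA⁻¹ v i) ⟩
      + 2 * v i                                 ∎
    -- A multiple of the kernel vector r is subtracted to remove the top coefficient, so that
    -- multiplication by X loses nothing.
    z′ : Vector ℤ (suc n)
    z′ k = r L * z k + (- z L) * r k
    z′-last : z′ L ≡ 0ℤ
    z′-last = cancels (r L) (z L)
      where
      cancels : ∀ r z → r * z + (- z) * r ≡ 0ℤ
      cancels = solve-∀
    Wz′ : ∀ i → (W ⊗ᵥ z′) i ≋ + 2 * r L * v i mod p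
    Wz′ i = begin
      (W ⊗ᵥ z′) i                                       ≡⟨ ⟪⟫-linʳ (r L) (- z L) (W i) z r ⟩
      r L * (W ⊗ᵥ z) i + (- z L) * (W ⊗ᵥ r) i           ≈⟨ ≋-+ (≋-*ˡ (r L) (Wz i)) (∣⇒≋0 (∣n⇒∣m*n (- z L) (p∣Wr i))) ⟩
      r L * (+ 2 * v i) + 0ℤ                            ≡⟨ regroup (r L) (v i) ⟩
      + 2 * r L * v i                                   ∎
      where
      regroup : ∀ r v → r * (+ 2 * v) + 0ℤ ≡ + 2 * r * v
      regroup = solve-∀
    -- Since S v ≡ 0, the polynomial X z′ annihilates 𝟏 modulo p and is therefore a multiple of r.
    shift-z′ : ∀ k → shift z′ k ≋ ⟪ ρ , shift z′ ⟫ * r k mod p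
    shift-z′ = kernelW (shift z′) (λ i → W-shift z′ i
      (≋-∣ (≋-trans (≋-⟪⟫ (S i) Wz′) (≡⇒≋ (⟪⟫-*ʳ (+ 2 * r L) (S i) v))) (∣n⇒∣m*n (+ 2 * r L) (p∣Sv i)))
      (subst (p ∣_) (sym z′-last) (divides 0ℤ refl)))
    -- X z′ has the parity of r, so z′ has the opposite one. The induction principle serves only to
    -- separate the last index from the others.
    signed-z′ : ∀ k → signed z′ k ≋ (- σ) * z′ k mod p
    signed-z′ = >-weakInduction (λ k → signed z′ k ≋ (- σ) * z′ k mod p)
      (≡⇒≋ (trans (cong (_*_ σ) z′-last) (trans (ℤ.*-zeroʳ σ) (sym (trans (cong (_*_ (- σ)) z′-last) (ℤ.*-zeroʳ (- σ)))))))
      (λ i _ → step i)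
      where
      q = ⟪ ρ , shift z′ ⟫
      step : ∀ i → signed z′ (inject₁ i) ≋ (- σ) * z′ (inject₁ i) mod p
      step i = begin
        sgn (toℕ (inject₁ i)) * z′ (inject₁ i)    ≡⟨ cong (λ k → sgn k * z′ (inject₁ i)) (Fin.toℕ-inject₁ i) ⟩
        sgn (toℕ i) * z′ (inject₁ i)              ≈⟨ ≋-*ˡ (sgn (toℕ i)) (shift-z′ (suc i)) ⟩
        sgn (toℕ i) * (q * r (suc i))             ≡⟨ regroup (sgn (toℕ i)) q (r (suc i)) ⟩
        (- q) * signed r (suc i)                  ≈⟨ ≋-*ˡ (- q) (signed-r (suc i)) ⟩
        (- q) * (σ * r (suc i))                   ≡⟨ regroup′ q σ (r (suc i)) ⟩
        (- σ) * (q * r (suc i))                   ≈⟨ ≋-*ˡ (- σ) (shift-z′ (suc i)) ⟨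
        (- σ) * z′ (inject₁ i)                    ∎
        where
        regroup : ∀ s q r → s * (q * r) ≡ (- q) * ((- s) * r)
        regroup = solve-∀
        regroup′ : ∀ q s r → (- q) * (s * r) ≡ (- s) * (q * r)
        regroup′ = solve-∀
    two-ways : ∀ i → + 2 * r L * (σ * v i) ≋ (- σ) * (+ 2 * r L * v i) mod p
    two-ways i = begin
      + 2 * r L * (σ * v i)                 ≈⟨ ≋-*ˡ (+ 2 * r L) (v∘π i) ⟨
      + 2 * r L * v (to i)                  ≈⟨ Wz′ (to i) ⟨
      (W ⊗ᵥ z′) (to i)                      ≡⟨ krylov-signed π rev z′ i ⟩
      (W ⊗ᵥ signed z′) i                    ≈⟨ ≋-⟪⟫ (W i) signed-z′ ⟩
      (W ⊗ᵥ (λ k → (- σ) * z′ k)) i         ≡⟨ ⟪⟫-*ʳ (- σ) (W i) z′ ⟩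
      (- σ) * (W ⊗ᵥ z′) i                   ≈⟨ ≋-*ˡ (- σ) (Wz′ i) ⟩
      (- σ) * (+ 2 * r L * v i)             ∎
    double : ∀ r σ v → + 2 * r * (σ * v) - (- σ) * (+ 2 * r * v) ≡ σ * (+ 2 * (+ 2 * r)) * v
    double = solve-∀
    p∤2r : ¬ p ∣ + 2 * r L
    p∤2r = *-∤ p∤2 p∤r-last

-- Integer multiples of the orthogonal matrix relating two skew matrices

i*j≢0 : ∀ {i j} → i ≢ 0ℤ → j ≢ 0ℤ → i * j ≢ 0ℤ
i*j≢0 {i} i≢0 j≢0 eq = Sum.[ i≢0 , j≢0 ] (ℤ.i*j≡0⇒i≡0∨j≡0 i eq)

record Intertwiner (c : ℤ) (S T : Matrix ℤ n) : Set where
  field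
    N        : Matrix ℤ n
    isometry : ∀ x y → ⟪ N ⊗ᵥ x , N ⊗ᵥ y ⟫ ≡ c * c * ⟪ x , y ⟫
    commutes : ∀ x → N ⊗ᵥ (S ⊗ᵥ x) ≗ T ⊗ᵥ (N ⊗ᵥ x)
    fixes-𝟏  : ∀ i → (N ⊗ᵥ 𝟏) i ≡ c

  NᵀN : ∀ x → N ᵀ ⊗ᵥ (N ⊗ᵥ x) ≗ (λ i → c * c * x i)
  NᵀN x = ⟪⟫-nondegenerate λ z → begin
    ⟪ N ᵀ ⊗ᵥ (N ⊗ᵥ x) , z ⟫        ≡⟨ ⟪⟫-adjoint N (N ⊗ᵥ x) z ⟨
    ⟪ N ⊗ᵥ x , N ⊗ᵥ z ⟫            ≡⟨ isometry x z ⟩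
    c * c * ⟪ x , z ⟫              ≡⟨ ⟪⟫-*ˡ (c * c) x z ⟨
    ⟪ (λ i → c * c * x i) , z ⟫    ∎
    where open ≡-Reasoning

  NNᵀ : c ≢ 0ℤ → ∀ x → N ⊗ᵥ (N ᵀ ⊗ᵥ x) ≗ (λ i → c * c * x i)
  NNᵀ c≢0 = flip-inverse (i*j≢0 c≢0 c≢0) (N ᵀ) N NᵀN

  row-norm : c ≢ 0ℤ → ∀ k → ⟪ N k , N k ⟫ ≡ c * c
  row-norm c≢0 k = begin
    ⟪ N k , N k ⟫              ≡⟨ ⟪⟫-congʳ (N k) (λ j → sym (⊗ᵥ-basis (N ᵀ) k j)) ⟩
    (N ⊗ᵥ (N ᵀ ⊗ᵥ 𝟙 k)) k      ≡⟨ NNᵀ c≢0 (𝟙 k) k ⟩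
    c * c * 𝟙 k k              ≡⟨ cong (_*_ (c * c)) (𝟙-diag k) ⟩
    c * c * 1ℤ                 ≡⟨ ℤ.*-identityʳ (c * c) ⟩
    c * c                      ∎
    where open ≡-Reasoning

  N-iter : ∀ k x → N ⊗ᵥ iter S k x ≗ iter T k (N ⊗ᵥ x)
  N-iter zero    x i = refl
  N-iter (suc k) x i = trans (commutes (iter S k x) i) (⊗ᵥ-cong T (N-iter k x) i)

divide : ∀ {c} {S T : Matrix ℤ n} {d : ℤ} → d ≢ 0ℤ → (I : Intertwiner (c * d) S T) →
  (∀ i j → d ∣ Intertwiner.N I i j) → Intertwiner c S T
divide {n} {c} {S} {T} {d} d≢0 I d∣N = record
  { N        = N′
  ; isometry = λ x y → *-cancel-≢0 (i*j≢0 d≢0 d≢0) (begin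
      d * d * ⟪ N′ ⊗ᵥ x , N′ ⊗ᵥ y ⟫                            ≡⟨ ℤ.*-assoc d d _ ⟩
      d * (d * ⟪ N′ ⊗ᵥ x , N′ ⊗ᵥ y ⟫)                          ≡⟨ cong (_*_ d) (⟪⟫-*ʳ d (N′ ⊗ᵥ x) (N′ ⊗ᵥ y)) ⟨
      d * ⟪ N′ ⊗ᵥ x , (λ i → d * (N′ ⊗ᵥ y) i) ⟫                ≡⟨ ⟪⟫-*ˡ d (N′ ⊗ᵥ x) (λ i → d * (N′ ⊗ᵥ y) i) ⟨
      ⟪ (λ i → d * (N′ ⊗ᵥ x) i) , (λ i → d * (N′ ⊗ᵥ y) i) ⟫    ≡⟨ ⟪⟫-congˡ (λ i → d * (N′ ⊗ᵥ y) i) (sym ∘ N≡dN′ x) ⟩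
      ⟪ N ⊗ᵥ x , (λ i → d * (N′ ⊗ᵥ y) i) ⟫                     ≡⟨ ⟪⟫-congʳ (N ⊗ᵥ x) (sym ∘ N≡dN′ y) ⟩
      ⟪ N ⊗ᵥ x , N ⊗ᵥ y ⟫                                      ≡⟨ isometry x y ⟩
      c * d * (c * d) * ⟪ x , y ⟫                              ≡⟨ regroup c d ⟪ x , y ⟫ ⟩
      d * d * (c * c * ⟪ x , y ⟫)                              ∎)
  ; commutes = λ x i → *-cancel-≢0 d≢0 (begin
      d * (N′ ⊗ᵥ (S ⊗ᵥ x)) i                  ≡⟨ N≡dN′ (S ⊗ᵥ x) i ⟨
      (N ⊗ᵥ (S ⊗ᵥ x)) i                       ≡⟨ commutes x i ⟩
      (T ⊗ᵥ (N ⊗ᵥ x)) i                       ≡⟨ ⊗ᵥ-cong T (N≡dN′ x) i ⟩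
      (T ⊗ᵥ (λ j → d * (N′ ⊗ᵥ x) j)) i        ≡⟨ ⟪⟫-*ʳ d (T i) (N′ ⊗ᵥ x) ⟩
      d * (T ⊗ᵥ (N′ ⊗ᵥ x)) i                  ∎)
  ; fixes-𝟏  = λ i → *-cancel-≢0 d≢0 (trans (sym (N≡dN′ 𝟏 i)) (trans (fixes-𝟏 i) (ℤ.*-comm c d)))
  }
  where
  open Intertwiner I
  open ≡-Reasoning
  N′ : Matrix ℤ n
  N′ i j = quotient (d∣N i j)
  N≡dN′ : ∀ x → N ⊗ᵥ x ≗ (λ i → d * (N′ ⊗ᵥ x) i)
  N≡dN′ x i = trans (⟪⟫-congˡ x (λ j → trans (_∣_.equality (d∣N i j)) (ℤ.*-comm (N′ i j) d))) (⟪⟫-*ˡ d (N′ i) x)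
  regroup : ∀ c d e → c * d * (c * d) * e ≡ d * d * (c * c * e)
  regroup = solve-∀

-- Divisibility

-- After division by the gcd, m′ is coprime to n′ and divides n′ n′, so it is 1. This is what treats
-- a d with repeated prime factors.
square-∣ : ∀ m n → m ℕ.* m ℕ.∣ n ℕ.* n → m ℕ.∣ n
square-∣ zero    n h = subst (0 ℕ.∣_) (sym n≡0) ℕ.∣-refl
  where
  n≡0 : n ≡ 0
  n≡0 = Sum.reduce (ℕ.m*n≡0⇒m≡0∨n≡0 n (ℕ.0∣⇒≡0 h))
square-∣ m@(suc _) n h = subst (ℕ._∣ n) g≡m (gcd[m,n]∣n m n)
  where
  g = gcd m n
  instance
    g≢0 : ℕ.NonZero g
    g≢0 = ℕ.≢-nonZero (gcd[m,n]≢0 m n (inj₁ λ ()))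
    gg≢0 : ℕ.NonZero (g ℕ.* g)
    gg≢0 = ℕ.m*n≢0 g g
  m′ = m ℕ./ g
  n′ = n ℕ./ g
  m≡ : m ≡ m′ ℕ.* g
  m≡ = sym (ℕ.m/n*n≡m (gcd[m,n]∣m m n))
  n≡ : n ≡ n′ ℕ.* g
  n≡ = sym (ℕ.m/n*n≡m (gcd[m,n]∣n m n))
  coprime : Coprime m′ n′
  coprime = coprime-/gcd m n
  m′m′∣n′n′ : m′ ℕ.* m′ ℕ.∣ n′ ℕ.* n′
  m′m′∣n′n′ = ℕ.*-cancelʳ-∣ (g ℕ.* g) (subst₂ ℕ._∣_
    (trans (cong₂ ℕ._*_ m≡ m≡) (ℕ.[m*n]*[o*p]≡[m*o]*[n*p] m′ g m′ g))
    (trans (cong₂ ℕ._*_ n≡ n≡) (ℕ.[m*n]*[o*p]≡[m*o]*[n*p] n′ g n′ g)) h)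
  m′≡1 : m′ ≡ 1
  m′≡1 = coprime (ℕ.∣-refl , coprime-divisor coprime (ℕ.∣-trans (ℕ.m∣m*n m′) m′m′∣n′n′))
  g≡m : g ≡ m
  g≡m = sym (trans m≡ (trans (cong (ℕ._* g) m′≡1) (ℕ.*-identityˡ g)))

square-∣ℤ : ∀ i j → i * i ∣ j * j → i ∣ j
square-∣ℤ i j h = ∣ᵤ⇒∣ (square-∣ ℤ.∣ i ∣ ℤ.∣ j ∣ (subst₂ ℕ._∣_ (ℤ.abs-* i i) (ℤ.abs-* j j) (∣⇒∣ᵤ h)))

prime-divisor : ∀ n → n ≢ 0 → n ≢ 1 → ∃ λ p → Prime p × p ℕ.∣ n
prime-divisor n n≢0 n≢1 with factorise n {{ℕ.≢-nonZero n≢0}}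
... | record { factors = [] ; isFactorisation = eq } = contradiction eq n≢1
... | record { factors = p ∷ ps ; isFactorisation = eq ; factorsPrime = isPrime ∷ _ } =
  p , isPrime , subst (p ℕ.∣_) (sym eq) (ℕ.m∣m*n (product ps))

coprime-cancel : ∀ {d g} → d ≢ 0ℤ → (∀ p → Prime p → + p ∣ d → ¬ + p ∣ g) → ∀ x → d ∣ g * x → d ∣ x
coprime-cancel {d} {g} d≢0 no-prime x h = ∣ᵤ⇒∣ (coprime-divisor coprime (subst (ℤ.∣ d ∣ ℕ.∣_) (ℤ.abs-* g x) (∣⇒∣ᵤ h)))
  where
  coprime : Coprime ℤ.∣ d ∣ ℤ.∣ g ∣
  coprime {i} (i∣d , i∣g) with i ℕ.≟ 1
  ... | yes i≡1 = i≡1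
  ... | no  i≢1 with prime-divisor i (λ { refl → d≢0 (ℤ.∣i∣≡0⇒i≡0 (ℕ.0∣⇒≡0 i∣d)) }) i≢1
  ...   | p , isPrime , p∣i = contradiction (∣ᵤ⇒∣ (ℕ.∣-trans p∣i i∣g)) (no-prime p isPrime (∣ᵤ⇒∣ (ℕ.∣-trans p∣i i∣d)))

-- Clearing the denominators of krylov T (krylov S)⁻¹

-- The exponent k may exceed those of the columns; `Θ-commutes` relies on the walk of length n + 1.
krylov-pairing : {S T : Matrix ℤ n} → Skew S → Skew T → (∀ k → moment S k ≡ moment T k) →
  ∀ k y → ⟪ walk S k , krylov S ⊗ᵥ y ⟫ ≡ ⟪ walk T k , krylov T ⊗ᵥ y ⟫
krylov-pairing {S = S} {T} skewS skewT moments k y = trans (expand S skewS)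
  (trans (sum-cong (λ l → cong (λ μ → y l * (sgn k * μ)) (moments (k ℕ.+ toℕ l)))) (sym (expand T skewT)))
  where
  expand : ∀ S → Skew S → ⟪ walk S k , krylov S ⊗ᵥ y ⟫ ≡ sum (λ l → y l * (sgn k * moment S (k ℕ.+ toℕ l)))
  expand S skew = trans (⟪⟫-congʳ (walk S k) (⊗ᵥ-comb (krylov S) y))
    (trans (⟪⟫-comb (walk S k) y (krylov S ᵀ)) (sum-cong (λ l → cong (_*_ (y l)) (walk-gram skew k (toℕ l)))))

krylov-gram : {S T : Matrix ℤ n} → Skew S → Skew T → (∀ k → moment S k ≡ moment T k) →
  ∀ x y → ⟪ krylov S ⊗ᵥ x , krylov S ⊗ᵥ y ⟫ ≡ ⟪ krylov T ⊗ᵥ x , krylov T ⊗ᵥ y ⟫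
krylov-gram {S = S} {T} skewS skewT moments x y = trans (expand S)
  (trans (sum-cong (λ l → cong (_*_ (x l))
    (trans (⟪⟫-comm (krylov S ⊗ᵥ y) (walk S (toℕ l)))
      (trans (krylov-pairing skewS skewT moments (toℕ l) y) (⟪⟫-comm (walk T (toℕ l)) (krylov T ⊗ᵥ y))))))
  (sym (expand T)))
  where
  expand : ∀ S → ⟪ krylov S ⊗ᵥ x , krylov S ⊗ᵥ y ⟫ ≡ sum (λ l → x l * ⟪ krylov S ⊗ᵥ y , walk S (toℕ l) ⟫)
  expand S = trans (⟪⟫-comm (krylov S ⊗ᵥ x) (krylov S ⊗ᵥ y))
    (trans (⟪⟫-congʳ (krylov S ⊗ᵥ y) (⊗ᵥ-comb (krylov S) x)) (⟪⟫-comb (krylov S ⊗ᵥ y) x (krylov S ᵀ)))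

module Clearing
  {S T : Matrix ℤ (suc n)} (skewS : Skew S) (skewT : Skew T) (moments : ∀ k → moment S k ≡ moment T k)
  {D : Vector ℤ (suc n)} (F : Factorisation (krylov S) D) {d : ℤ} (d≢0 : d ≢ 0ℤ)
  (D-last : D (fromℕ n) ≡ + 2 * d) (D-other : ∀ i → i ≢ fromℕ n → ∃ λ e → e * D i ≡ + 2)
  where

  open Factorisation F
  private
    W = krylov S
    V = krylov T
    L = fromℕ n

  -- The diagonal of 2d D⁻¹. Every entry except the last keeps a factor d, which makes Θ of rank at
  -- most one modulo d.
  cofactor : Vector ℤ (suc n)
  cofactor i with i Fin.≟ L
  ... | yes _   = 1ℤ
  ... | no  i≢L = d * proj₁ (D-other i i≢L)

  D*cofactor : ∀ i → D i * cofactor i ≡ + 2 * d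
  D*cofactor i with i Fin.≟ L
  ... | yes refl = trans (ℤ.*-identityʳ (D L)) D-last
  ... | no  i≢L  = trans (regroup (D i) d (proj₁ (D-other i i≢L))) (cong (_* d) (proj₂ (D-other i i≢L)))
    where
    regroup : ∀ D d e → D * (d * e) ≡ (e * D) * d
    regroup = solve-∀

  d∣cofactor : ∀ i → i ≢ L → d ∣ cofactor i
  d∣cofactor i i≢L with i Fin.≟ L
  ... | yes i≡L  = contradiction i≡L i≢L
  ... | no  i≢L′ = ∣m⇒∣m*n (proj₁ (D-other i i≢L′)) ∣-refl

  -- This is 2d W⁻¹, written without denominators.
  lift : Vector ℤ (suc n) → Vector ℤ (suc n)
  lift x = B⁻¹ ⊗ᵥ (λ i → cofactor i * (A⁻¹ ⊗ᵥ x) i)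

  W-lift : ∀ x → W ⊗ᵥ lift x ≗ (λ i → + 2 * d * x i)
  W-lift x i = begin
    (W ⊗ᵥ lift x) i                                          ≡⟨ WB⁻¹ (λ i → cofactor i * (A⁻¹ ⊗ᵥ x) i) i ⟩
    (A ⊗ᵥ (λ j → D j * (cofactor j * (A⁻¹ ⊗ᵥ x) j))) i       ≡⟨ ⊗ᵥ-cong A (λ j → trans (sym (ℤ.*-assoc (D j) (cofactor j) ((A⁻¹ ⊗ᵥ x) j)))
                                                                  (cong (_* (A⁻¹ ⊗ᵥ x) j) (D*cofactor j))) i ⟩
    (A ⊗ᵥ (λ j → + 2 * d * (A⁻¹ ⊗ᵥ x) j)) i                  ≡⟨ ⟪⟫-*ʳ (+ 2 * d) (A i) (A⁻¹ ⊗ᵥ x) ⟩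
    + 2 * d * (A ⊗ᵥ (A⁻¹ ⊗ᵥ x)) i                            ≡⟨ cong (_*_ (+ 2 * d)) (AA⁻¹ x i) ⟩
    + 2 * d * x i                                            ∎
    where open ≡-Reasoning

  lift-W : ∀ x → lift (W ⊗ᵥ x) ≗ (λ i → + 2 * d * x i)
  lift-W x i = begin
    (B⁻¹ ⊗ᵥ (λ j → cofactor j * (A⁻¹ ⊗ᵥ (W ⊗ᵥ x)) j)) i      ≡⟨ ⊗ᵥ-cong B⁻¹ scaled i ⟩
    (B⁻¹ ⊗ᵥ (λ j → + 2 * d * (B ⊗ᵥ x) j)) i                  ≡⟨ ⟪⟫-*ʳ (+ 2 * d) (B⁻¹ i) (B ⊗ᵥ x) ⟩
    + 2 * d * (B⁻¹ ⊗ᵥ (B ⊗ᵥ x)) i                            ≡⟨ cong (_*_ (+ 2 * d)) (B⁻¹B x i) ⟩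
    + 2 * d * x i                                            ∎
    where
    open ≡-Reasoning
    regroup : ∀ c D y → c * (D * y) ≡ (D * c) * y
    regroup = solve-∀
    scaled : ∀ j → cofactor j * (A⁻¹ ⊗ᵥ (W ⊗ᵥ x)) j ≡ + 2 * d * (B ⊗ᵥ x) j
    scaled j = trans (cong (_*_ (cofactor j)) (A⁻¹W x j))
      (trans (regroup (cofactor j) (D j) ((B ⊗ᵥ x) j)) (cong (_* (B ⊗ᵥ x) j) (D*cofactor j)))

  Θ : Matrix ℤ (suc n)
  Θ = V ⊗ (B⁻¹ ⊗ (diag cofactor ⊗ A⁻¹))

  Θ-lift : ∀ x → Θ ⊗ᵥ x ≗ V ⊗ᵥ lift x
  Θ-lift x i = trans (⊗-⊗ᵥ V (B⁻¹ ⊗ (diag cofactor ⊗ A⁻¹)) x i)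
    (⊗ᵥ-cong V (λ j → trans (⊗-⊗ᵥ B⁻¹ (diag cofactor ⊗ A⁻¹) x j)
      (⊗ᵥ-cong B⁻¹ (λ k → trans (⊗-⊗ᵥ (diag cofactor) A⁻¹ x k) (diag-⊗ᵥ cofactor (A⁻¹ ⊗ᵥ x) k)) j)) i)

  ΘW : ∀ x → Θ ⊗ᵥ (W ⊗ᵥ x) ≗ (λ i → + 2 * d * (V ⊗ᵥ x) i)
  ΘW x i = trans (Θ-lift (W ⊗ᵥ x) i) (trans (⊗ᵥ-cong V (lift-W x) i) (⟪⟫-*ʳ (+ 2 * d) (V i) x))

  private
    e = + 2 * d
    e≢0 : e ≢ 0ℤ
    e≢0 = i*j≢0 {+ 2} (λ ()) d≢0

  Θ-isometry : ∀ x y → ⟪ Θ ⊗ᵥ x , Θ ⊗ᵥ y ⟫ ≡ e * e * ⟪ x , y ⟫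
  Θ-isometry x y = begin
    ⟪ Θ ⊗ᵥ x , Θ ⊗ᵥ y ⟫                          ≡⟨ trans (⟪⟫-congˡ (Θ ⊗ᵥ y) (Θ-lift x)) (⟪⟫-congʳ (V ⊗ᵥ lift x) (Θ-lift y)) ⟩
    ⟪ V ⊗ᵥ lift x , V ⊗ᵥ lift y ⟫                ≡⟨ krylov-gram skewS skewT moments (lift x) (lift y) ⟨
    ⟪ W ⊗ᵥ lift x , W ⊗ᵥ lift y ⟫                ≡⟨ trans (⟪⟫-congˡ (W ⊗ᵥ lift y) (W-lift x)) (⟪⟫-congʳ (λ i → e * x i) (W-lift y)) ⟩
    ⟪ (λ i → e * x i) , (λ i → e * y i) ⟫        ≡⟨ trans (⟪⟫-*ˡ e x (λ i → e * y i)) (cong (_*_ e) (⟪⟫-*ʳ e x y)) ⟩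
    e * (e * ⟪ x , y ⟫)                          ≡⟨ ℤ.*-assoc e e ⟪ x , y ⟫ ⟨
    e * e * ⟪ x , y ⟫                            ∎
    where open ≡-Reasoning

  private
    Θᵀ-flip : ∀ x → Θ ⊗ᵥ (Θ ᵀ ⊗ᵥ x) ≗ (λ i → e * e * x i)
    Θᵀ-flip = flip-inverse (i*j≢0 e≢0 e≢0) (Θ ᵀ) Θ (λ x → ⟪⟫-nondegenerate λ z →
      trans (sym (⟪⟫-adjoint Θ (Θ ⊗ᵥ x) z)) (trans (Θ-isometry x z) (sym (⟪⟫-*ˡ (e * e) x z))))

  -- For walks that are not columns of W the equation is tested against the vectors Θ W y. There
  -- both pairings reduce to moments, and these vectors include e³ z for every z.
  Θ-walk : ∀ k → Θ ⊗ᵥ walk S k ≗ (λ i → e * walk T k i)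
  Θ-walk k = ⟪⟫-nondegenerate λ z → *-cancel-≢0 (i*j≢0 e≢0 (i*j≢0 e≢0 e≢0)) (begin
    e * (e * e) * ⟪ Θ ⊗ᵥ walk S k , z ⟫                  ≡⟨ ⟪⟫-*ʳ (e * (e * e)) (Θ ⊗ᵥ walk S k) z ⟨
    ⟪ Θ ⊗ᵥ walk S k , (λ i → e * (e * e) * z i) ⟫        ≡⟨ ⟪⟫-congʳ (Θ ⊗ᵥ walk S k) (sym ∘ spanned z) ⟩
    ⟪ Θ ⊗ᵥ walk S k , Θ ⊗ᵥ (W ⊗ᵥ y z) ⟫                  ≡⟨ Θ-isometry (walk S k) (W ⊗ᵥ y z) ⟩
    e * e * ⟪ walk S k , W ⊗ᵥ y z ⟫                      ≡⟨ cong (_*_ (e * e)) (krylov-pairing skewS skewT moments k (y z)) ⟩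
    e * e * ⟪ walk T k , V ⊗ᵥ y z ⟫                      ≡⟨ trans (ℤ.*-assoc e e _) (cong (_*_ e) (sym (⟪⟫-*ʳ e (walk T k) (V ⊗ᵥ y z)))) ⟩
    e * ⟪ walk T k , (λ i → e * (V ⊗ᵥ y z) i) ⟫          ≡⟨ cong (_*_ e) (⟪⟫-congʳ (walk T k) (sym ∘ ΘW (y z))) ⟩
    e * ⟪ walk T k , Θ ⊗ᵥ (W ⊗ᵥ y z) ⟫                   ≡⟨ ⟪⟫-*ˡ e (walk T k) (Θ ⊗ᵥ (W ⊗ᵥ y z)) ⟨
    ⟪ (λ i → e * walk T k i) , Θ ⊗ᵥ (W ⊗ᵥ y z) ⟫         ≡⟨ ⟪⟫-congʳ (λ i → e * walk T k i) (spanned z) ⟩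
    ⟪ (λ i → e * walk T k i) , (λ i → e * (e * e) * z i) ⟫ ≡⟨ ⟪⟫-*ʳ (e * (e * e)) (λ i → e * walk T k i) z ⟩
    e * (e * e) * ⟪ (λ i → e * walk T k i) , z ⟫         ∎)
    where
    open ≡-Reasoning
    y : Vector ℤ (suc n) → Vector ℤ (suc n)
    y z = lift (Θ ᵀ ⊗ᵥ z)
    spanned : ∀ z i → (Θ ⊗ᵥ (W ⊗ᵥ y z)) i ≡ e * (e * e) * z i
    spanned z i = trans (⊗ᵥ-cong Θ (W-lift (Θ ᵀ ⊗ᵥ z)) i)
      (trans (⟪⟫-*ʳ e (Θ i) (Θ ᵀ ⊗ᵥ z)) (trans (cong (_*_ e) (Θᵀ-flip z i)) (sym (ℤ.*-assoc e (e * e) (z i)))))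

  -- With e x = W y, both S and T act as the shift on y, up to one walk of length n + 1 that
  -- `Θ-walk` carries across.
  Θ-commutes : ∀ x → Θ ⊗ᵥ (S ⊗ᵥ x) ≗ T ⊗ᵥ (Θ ⊗ᵥ x)
  Θ-commutes x i = *-cancel-≢0 e≢0 (begin
    e * (Θ ⊗ᵥ (S ⊗ᵥ x)) i                           ≡⟨ ⟪⟫-*ʳ e (Θ i) (S ⊗ᵥ x) ⟨
    (Θ ⊗ᵥ (λ j → e * (S ⊗ᵥ x) j)) i                 ≡⟨ ⊗ᵥ-cong Θ (λ j → sym (⟪⟫-*ʳ e (S j) x)) i ⟩
    (Θ ⊗ᵥ (S ⊗ᵥ (λ j → e * x j))) i                 ≡⟨ ⊗ᵥ-cong Θ (⊗ᵥ-cong S (sym ∘ W-lift x)) i ⟩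
    (Θ ⊗ᵥ (S ⊗ᵥ (W ⊗ᵥ y))) i                        ≡⟨ ⊗ᵥ-cong Θ (krylov-shift S y) i ⟩
    (Θ ⊗ᵥ (λ j → (W ⊗ᵥ shift y) j + y L * walk S (suc n) j)) i
      ≡⟨ ⟪⟫-+ʳ (Θ i) (W ⊗ᵥ shift y) (λ j → y L * walk S (suc n) j) ⟩
    (Θ ⊗ᵥ (W ⊗ᵥ shift y)) i + ⟪ Θ i , (λ j → y L * walk S (suc n) j) ⟫
      ≡⟨ cong₂ _+_ (ΘW (shift y) i) (trans (⟪⟫-*ʳ (y L) (Θ i) (walk S (suc n))) (cong (_*_ (y L)) (Θ-walk (suc n) i))) ⟩
    e * (V ⊗ᵥ shift y) i + y L * (e * walk T (suc n) i)
      ≡⟨ regroup e ((V ⊗ᵥ shift y) i) (y L) (walk T (suc n) i) ⟩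
    e * ((V ⊗ᵥ shift y) i + y L * walk T (suc n) i) ≡⟨ cong (_*_ e) (krylov-shift T y i) ⟨
    e * (T ⊗ᵥ (V ⊗ᵥ y)) i                           ≡⟨ cong (_*_ e) (⊗ᵥ-cong T (sym ∘ Θ-lift x) i) ⟩
    e * (T ⊗ᵥ (Θ ⊗ᵥ x)) i                           ∎)
    where
    open ≡-Reasoning
    y = lift x
    regroup : ∀ e a b c → e * a + b * (e * c) ≡ e * (a + b * c)
    regroup = solve-∀

  Θ-intertwiner : Intertwiner (+ 2 * d) S T
  Θ-intertwiner = record
    { N = Θ ; isometry = Θ-isometry ; commutes = Θ-commutes
    ; fixes-𝟏 = λ i → trans (Θ-walk 0 i) (ℤ.*-identityʳ e) }

  -- Modulo d each row θ of Θ is a multiple ξ v of v = A⁻¹ L, and completing the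
  -- square in ⟨θ, θ⟩ = (2d)² shows d² ∣ (⟨v, v⟩ ξ + …)².
  d∣Θ : (∀ x → d ∣ ⟪ A⁻¹ L , A⁻¹ L ⟫ * x → d ∣ x) → ∀ k j → d ∣ Θ k j
  d∣Θ coprime k j = ≋-∣ (θ≋ j) (∣m⇒∣m*n (v j) d∣ξ)
    where
    v θ : Vector ℤ (suc n)
    v = A⁻¹ L
    θ = Θ k
    ξ = ⟪ (A ᵀ) L , θ ⟫
    -- Column i of A meets only `cofactor i` inside Θ, and that is divisible by d for i ≠ L.
    d∣Aᵀθ : ∀ i → i ≢ L → d ∣ ⟪ (A ᵀ) i , θ ⟫
    d∣Aᵀθ i i≢L = subst (d ∣_) (sym eq) (∣-⟪⟫ (V k) (λ j → ∣-⟪⟫ (B⁻¹ j) divisible))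
      where
      eq : ⟪ (A ᵀ) i , θ ⟫ ≡ (V ⊗ᵥ lift (A ⊗ᵥ 𝟙 i)) k
      eq = trans (⟪⟫-comm ((A ᵀ) i) θ) (trans (⟪⟫-congʳ θ (λ j → sym (⊗ᵥ-basis A i j))) (Θ-lift (A ⊗ᵥ 𝟙 i) k))
      divisible : ∀ j → d ∣ cofactor j * (A⁻¹ ⊗ᵥ (A ⊗ᵥ 𝟙 i)) j
      divisible j with i Fin.≟ j
      ... | yes refl = ∣m⇒∣m*n ((A⁻¹ ⊗ᵥ (A ⊗ᵥ 𝟙 i)) i) (d∣cofactor i i≢L)
      ... | no  i≢j  = ∣n⇒∣m*n (cofactor j) (subst (d ∣_) (sym (trans (A⁻¹A (𝟙 i) j) (𝟙-off i≢j))) (divides 0ℤ refl))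
    θ≋ : ∀ j → θ j ≋ ξ * v j mod d
    θ≋ j = ≋-trans (≡⇒≋ (sym (Invertible.invˡ (transpose-invertible A-inv) θ j)))
      (≋-trans (≋-sum-single L (λ i → A⁻¹ i j * ⟪ (A ᵀ) i , θ ⟫) (λ i i≢L → ∣n⇒∣m*n (A⁻¹ i j) (d∣Aᵀθ i i≢L)))
        (≡⇒≋ (ℤ.*-comm (v j) ξ)))
    η : Vector ℤ (suc n)
    η j = quotient (difference (θ≋ j))
    θ≡ : ∀ j → θ j ≡ ξ * v j + d * η j
    θ≡ j = trans (isolate (θ j) (ξ * v j))
      (cong (_+_ (ξ * v j)) (trans (_∣_.equality (difference (θ≋ j))) (ℤ.*-comm (η j) d)))
      where
      isolate : ∀ t x → t ≡ x + (t - x)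
      isolate = solve-∀
    g = ⟪ v , v ⟫
    h = ⟪ v , η ⟫
    norm : e * e ≡ ξ * (ξ * g + d * h) + d * (ξ * h + d * ⟪ η , η ⟫)
    norm = begin
      e * e                              ≡⟨ Intertwiner.row-norm Θ-intertwiner e≢0 k ⟨
      ⟪ θ , θ ⟫                          ≡⟨ trans (⟪⟫-congˡ θ θ≡) (⟪⟫-congʳ (λ j → ξ * v j + d * η j) θ≡) ⟩
      ⟪ (λ j → ξ * v j + d * η j) , (λ j → ξ * v j + d * η j) ⟫
        ≡⟨ ⟪⟫-linˡ ξ d (λ j → ξ * v j + d * η j) v η ⟩
      ξ * ⟪ v , (λ j → ξ * v j + d * η j) ⟫ + d * ⟪ η , (λ j → ξ * v j + d * η j) ⟫
        ≡⟨ cong₂ (λ s t → ξ * s + d * t) (⟪⟫-linʳ ξ d v v η)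
             (trans (⟪⟫-linʳ ξ d η v η) (cong (λ s → ξ * s + d * ⟪ η , η ⟫) (⟪⟫-comm η v))) ⟩
      ξ * (ξ * g + d * h) + d * (ξ * h + d * ⟪ η , η ⟫) ∎
      where open ≡-Reasoning
    completed : (g * ξ + d * h) * (g * ξ + d * h) ≡ (g * + 4 - (g * ⟪ η , η ⟫ - h * h)) * (d * d)
    completed = trans (complete g ξ d h ⟪ η , η ⟫)
      (trans (cong (λ s → g * s - d * d * (g * ⟪ η , η ⟫ - h * h)) (sym norm)) (collect g d (g * ⟪ η , η ⟫ - h * h)))
      where
      complete : ∀ g ξ d h k → (g * ξ + d * h) * (g * ξ + d * h) ≡
        g * (ξ * (ξ * g + d * h) + d * (ξ * h + d * k)) - d * d * (g * k - h * h)
      complete = solve-∀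
      collect : ∀ g d s → g * ((+ 2 * d) * (+ 2 * d)) - d * d * s ≡ (g * + 4 - s) * (d * d)
      collect = solve-∀
    d∣ξ : d ∣ ξ
    d∣ξ = coprime ξ (∣m+n∣n⇒∣m (square-∣ℤ d (g * ξ + d * h) (divides (g * + 4 - (g * ⟪ η , η ⟫ - h * h)) completed)) (∣m⇒∣m*n h ∣-refl))

-- The prime 2

2-prime : PrimeIdeal (+ 2)
2-prime = primeIdeal prime[2]

∣-iter : (S : Matrix ℤ n) (k : ℕ) {x : Vector ℤ n} → (∀ i → p ∣ x i) → ∀ i → p ∣ iter S k x i
∣-iter S zero    h   = h
∣-iter S (suc k) h i = ∣-⟪⟫ (S i) (∣-iter S k h)

iter-lin : (S : Matrix ℤ n) (k : ℕ) (a b : ℤ) (x y : Vector ℤ n) →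
  iter S k (λ i → a * x i + b * y i) ≗ (λ i → a * iter S k x i + b * iter S k y i)
iter-lin S zero    a b x y i = refl
iter-lin S (suc k) a b x y i = trans (⊗ᵥ-cong S (iter-lin S k a b x y) i) (⟪⟫-linʳ a b (S i) (iter S k x) (iter S k y))

iter-comb : (S : Matrix ℤ n) (k : ℕ) (x : Vector ℤ m) (b : Fin m → Vector ℤ n) →
  iter S k (comb x b) ≗ comb x (λ i → iter S k (b i))
iter-comb S zero    x b i = refl
iter-comb S (suc k) x b i = trans (⊗ᵥ-cong S (iter-comb S k x b) i) (⟪⟫-comb (S i) x (λ j → iter S k (b j)))

⟪⟫-combˡ : (y : Vector ℤ n) (x : Vector ℤ m) (b : Fin m → Vector ℤ n) →
  ⟪ comb x b , y ⟫ ≡ sum (λ i → x i * ⟪ b i , y ⟫)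
⟪⟫-combˡ y x b = trans (⟪⟫-comm (comb x b) y) (trans (⟪⟫-comb y x b) (sum-cong (λ i → cong (_*_ (x i)) (⟪⟫-comm y (b i)))))

⊗ᵥ-distrib-comb : (S : Matrix ℤ n) (x : Vector ℤ m) (b : Fin m → Vector ℤ n) → S ⊗ᵥ comb x b ≗ comb x (λ i → S ⊗ᵥ b i)
⊗ᵥ-distrib-comb S x b i = ⟪⟫-comb (S i) x b

-- Off-diagonal terms occur in equal pairs, and x² ≡ x modulo 2.
symmetric-form≋diagonal : (b : Fin m → Fin m → ℤ) → (∀ i j → b i j ≡ b j i) → (x : Vector ℤ m) →
  sum (λ i → x i * sum (λ j → x j * b i j)) ≋ sum (λ i → x i * b i i) mod + 2
symmetric-form≋diagonal {zero}  b sym-b x = ≋-refl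
symmetric-form≋diagonal {suc m} b sym-b x = begin
  x₀ * (x₀ * b zero zero + cross) + sum (λ i → x (suc i) * (x₀ * b (suc i) zero + inner i))
    ≡⟨ cong (_+_ (x₀ * (x₀ * b zero zero + cross))) expand ⟩
  x₀ * (x₀ * b zero zero + cross) + (x₀ * cross + rest)
    ≡⟨ regroup x₀ (b zero zero) cross rest ⟩
  (x₀ * x₀) * b zero zero + (rest + + 2 * (x₀ * cross))
    ≈⟨ ≋-+ (≋-* (square≋self x₀) (≋-refl {b zero zero}))
         (≋-+ (symmetric-form≋diagonal (λ i j → b (suc i) (suc j)) (λ i j → sym-b (suc i) (suc j)) (x ∘ suc))
              (∣⇒≋0 (∣m⇒∣m*n (x₀ * cross) (∣-refl {+ 2})))) ⟩
  x₀ * b zero zero + (diagonal + 0ℤ)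
    ≡⟨ cong (_+_ (x₀ * b zero zero)) (ℤ.+-identityʳ diagonal) ⟩
  x₀ * b zero zero + diagonal ∎
  where
  open ≋-Reasoning (+ 2)
  x₀ = x zero
  cross = sum (λ j → x (suc j) * b zero (suc j))
  inner : Fin m → ℤ
  inner i = sum (λ j → x (suc j) * b (suc i) (suc j))
  rest = sum (λ i → x (suc i) * inner i)
  diagonal = sum (λ i → x (suc i) * b (suc i) (suc i))
  distribute : ∀ x y b s → x * (y * b + s) ≡ y * (x * b) + x * s
  distribute = solve-∀
  regroup : ∀ x b c r → x * (x * b + c) + (x * c + r) ≡ (x * x) * b + (r + + 2 * (x * c))
  regroup = solve-∀
  expand : sum (λ i → x (suc i) * (x₀ * b (suc i) zero + inner i)) ≡ x₀ * cross + rest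
  expand = trans
    (sum-cong (λ i → trans (distribute (x (suc i)) x₀ (b (suc i) zero) (inner i))
      (cong (λ z → x₀ * (x (suc i) * z) + x (suc i) * inner i) (sym-b (suc i) zero))))
    (trans (sum-+ (λ i → x₀ * (x (suc i) * b zero (suc i))) (λ i → x (suc i) * inner i))
      (cong (_+ rest) (sum-* x₀ (λ i → x (suc i) * b zero (suc i)))))

-- The dimension count modulo 2: m conditions on m + 1 coefficients. The coefficient of β is kept
-- apart because its parity decides how the relation is used.
dependent : (φ : Fin m → Vector ℤ n) (β : Vector ℤ n) (b : Fin m → Vector ℤ n) →
  ∃ λ c → ∃ λ x → (¬ + 2 ∣ c ⊎ ∃ λ i → ¬ + 2 ∣ x i) ×
    (∀ r → + 2 ∣ ⟪ φ r , (λ k → c * β k + 1ℤ * comb x b k) ⟫)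
dependent φ β b = c , x , nontrivial (proj₁ (proj₂ sol)) , relation
  where
  sol = nontrivialSolution 2-prime (λ r → ⟪ φ r , β ⟫ ∷ᵥ (λ i → ⟪ φ r , b i ⟫))
  c = proj₁ sol zero
  x = proj₁ sol ∘ suc
  nontrivial : (∃ λ i → ¬ + 2 ∣ proj₁ sol i) → ¬ + 2 ∣ c ⊎ ∃ λ i → ¬ + 2 ∣ x i
  nontrivial (zero  , h) = inj₁ h
  nontrivial (suc i , h) = inj₂ (i , h)
  relation : ∀ r → + 2 ∣ ⟪ φ r , (λ k → c * β k + 1ℤ * comb x b k) ⟫
  relation r = subst (+ 2 ∣_) (sym (begin
    ⟪ φ r , (λ k → c * β k + 1ℤ * comb x b k) ⟫             ≡⟨ ⟪⟫-linʳ c 1ℤ (φ r) β (comb x b) ⟩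
    c * ⟪ φ r , β ⟫ + 1ℤ * ⟪ φ r , comb x b ⟫               ≡⟨ cong₂ _+_ (ℤ.*-comm c ⟪ φ r , β ⟫)
                                                                 (trans (ℤ.*-identityˡ ⟪ φ r , comb x b ⟫) (⟪⟫-comb (φ r) x b)) ⟩
    ⟪ φ r , β ⟫ * c + sum (λ i → x i * ⟪ φ r , b i ⟫)       ≡⟨ cong (_+_ (⟪ φ r , β ⟫ * c)) (sum-cong (λ i → ℤ.*-comm (x i) ⟪ φ r , b i ⟫)) ⟩
    ⟪ φ r , β ⟫ * c + sum (λ i → ⟪ φ r , b i ⟫ * x i)       ∎)) (proj₂ (proj₂ sol) r)
    where open ≡-Reasoning

split-cases : ∀ h {m} {P : Fin (h ℕ.+ m) → Set} → (∀ i → P (i ↑ˡ m)) → (∀ r → P (h ↑ʳ r)) → ∀ k → P k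
split-cases h {m} {P} left right k with splitAt h k | Fin.join-splitAt h m k
... | inj₁ i | refl = left i
... | inj₂ r | refl = right r

halve : ∀ {a} → + 4 ∣ + 2 * a → + 2 ∣ a
halve {a} h = *-cancelˡ-∣ (+ 2) {+ 2} {a} h

module TwoPart
  {h m : ℕ} {S : Matrix ℤ (h ℕ.+ m)} (skew : Skew S) {D : Vector ℤ (h ℕ.+ m)} (F : Factorisation (krylov S) D)
  (D-one : ∀ i → D (i ↑ˡ m) ≡ 1ℤ) {o : Fin m → ℤ} (o-odd : ∀ r → ¬ + 2 ∣ o r)
  (D-two : ∀ r → D (h ↑ʳ r) ≡ + 2 * o r)
  where

  open Factorisation F
  private
    W = krylov S

  Perp : Vector ℤ (h ℕ.+ m) → Set
  Perp β = ∀ y → + 2 ∣ ⟪ β , W ⊗ᵥ y ⟫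

  WB⁻¹𝟙 : ∀ k i → (W ⊗ᵥ (B⁻¹ ⊗ᵥ 𝟙 k)) i ≡ D k * (A ᵀ) k i
  WB⁻¹𝟙 k i = begin
    (W ⊗ᵥ (B⁻¹ ⊗ᵥ 𝟙 k)) i                ≡⟨ WB⁻¹ (𝟙 k) i ⟩
    (A ⊗ᵥ (λ j → D j * 𝟙 k j)) i         ≡⟨ ⊗ᵥ-cong A D𝟙 i ⟩
    (A ⊗ᵥ (λ j → D k * 𝟙 k j)) i         ≡⟨ ⟪⟫-*ʳ (D k) (A i) (𝟙 k) ⟩
    D k * (A ⊗ᵥ 𝟙 k) i                   ≡⟨ cong (_*_ (D k)) (⊗ᵥ-basis A k i) ⟩
    D k * (A ᵀ) k i                      ∎
    where
    open ≡-Reasoning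
    D𝟙 : ∀ j → D j * 𝟙 k j ≡ D k * 𝟙 k j
    D𝟙 j with k Fin.≟ j
    ... | yes refl = refl
    ... | no  _    = trans (ℤ.*-zeroʳ (D j)) (sym (ℤ.*-zeroʳ (D k)))

  ∣D*Aᵀ : ∀ β → (∀ y → p ∣ ⟪ β , W ⊗ᵥ y ⟫) → ∀ k → p ∣ D k * (A ᵀ ⊗ᵥ β) k
  ∣D*Aᵀ {p} β h k = subst (p ∣_)
    (trans (⟪⟫-congʳ β (WB⁻¹𝟙 k)) (trans (⟪⟫-*ʳ (D k) β ((A ᵀ) k)) (cong (_*_ (D k)) (⟪⟫-comm β ((A ᵀ) k)))))
    (h (B⁻¹ ⊗ᵥ 𝟙 k))

  ∣Aᵀ-left : ∀ β → (∀ y → p ∣ ⟪ β , W ⊗ᵥ y ⟫) → ∀ i → p ∣ (A ᵀ ⊗ᵥ β) (i ↑ˡ m)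
  ∣Aᵀ-left {p} β h i = subst (p ∣_) (trans (cong (_* (A ᵀ ⊗ᵥ β) (i ↑ˡ m)) (D-one i)) (ℤ.*-identityˡ _)) (∣D*Aᵀ β h (i ↑ˡ m))

  -- The converse of `∣Aᵀ-left` at 2. Modulo 2, `Perp` is thus cut out by the h left coordinates of
  -- Aᵀβ and has dimension m.
  left⇒Perp : ∀ β → (∀ i → + 2 ∣ (A ᵀ ⊗ᵥ β) (i ↑ˡ m)) → Perp β
  left⇒Perp β even y = subst (+ 2 ∣_)
    (sym (trans (⟪⟫-congʳ β (factor y)) (⟪⟫-adjoint A β (λ i → D i * (B ⊗ᵥ y) i))))
    (∣-sum (split-cases h
      (λ i → ∣m⇒∣m*n (D (i ↑ˡ m) * (B ⊗ᵥ y) (i ↑ˡ m)) (even i))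
      (λ r → ∣n⇒∣m*n ((A ᵀ ⊗ᵥ β) (h ↑ʳ r)) (∣m⇒∣m*n ((B ⊗ᵥ y) (h ↑ʳ r))
        (subst (+ 2 ∣_) (sym (D-two r)) (∣m⇒∣m*n (o r) ∣-refl))))))

  Aᵀ-even⇒even : ∀ β → (∀ k → + 2 ∣ (A ᵀ ⊗ᵥ β) k) → ∀ k → + 2 ∣ β k
  Aᵀ-even⇒even β even k = subst (+ 2 ∣_) (Invertible.invˡ (transpose-invertible A-inv) β k) (∣-⟪⟫ ((A⁻¹ ᵀ) k) even)

  Perp-lin : ∀ a b {β γ} → Perp β → Perp γ → Perp (λ k → a * β k + b * γ k)
  Perp-lin a b {β} {γ} Pβ Pγ y = subst (+ 2 ∣_) (sym (⟪⟫-linˡ a b (W ⊗ᵥ y) β γ))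
    (∣m∣n⇒∣m+n (∣n⇒∣m*n a (Pβ y)) (∣n⇒∣m*n b (Pγ y)))

  Perp-comb : ∀ {l} (x : Vector ℤ l) {b : Fin l → Vector ℤ (h ℕ.+ m)} → (∀ i → Perp (b i)) → Perp (comb x b)
  Perp-comb x {b} Pb y = subst (+ 2 ∣_) (sym (⟪⟫-combˡ (W ⊗ᵥ y) x b)) (∣-sum (λ i → ∣n⇒∣m*n (x i) (Pb i y)))

  -- The orthogonal complement mod 2 of the column space of W lies in that
  -- column space; the hypotheses supply h equations cutting it out.
  perp⊆column-space : (φ : Fin h → Vector ℤ (h ℕ.+ m)) →
    (∀ c β q → Perp β → let w = λ k → c * β k + 1ℤ * (W ⊗ᵥ q) k in
      (∀ r → + 2 ∣ ⟪ φ r , w ⟫) → Perp (W ⊗ᵥ q) × (∀ r → + 2 ∣ (A ᵀ ⊗ᵥ w) (h ↑ʳ r))) →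
    ∀ β → Perp β → ∀ r → + 2 ∣ (A⁻¹ ⊗ᵥ β) (h ↑ʳ r)
  perp⊆column-space φ key β Pβ = conclude (+ 2 ∣? c)
    where
    -- D is 1 on the left block, so these are the first h columns of A, a basis of the column space
    -- of W modulo 2.
    u : Fin h → Vector ℤ (h ℕ.+ m)
    u i = W ⊗ᵥ (B⁻¹ ⊗ᵥ 𝟙 (i ↑ˡ m))
    dep = dependent φ β u
    c = proj₁ dep
    x = proj₁ (proj₂ dep)
    nontrivial = proj₁ (proj₂ (proj₂ dep))
    q = comb x (λ i → B⁻¹ ⊗ᵥ 𝟙 (i ↑ˡ m))
    w : Vector ℤ (h ℕ.+ m)
    w k = c * β k + 1ℤ * (W ⊗ᵥ q) k
    keyed = key c β q Pβ (λ r → subst (+ 2 ∣_)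
      (⟪⟫-congʳ (φ r) (λ k → cong (λ z → c * β k + 1ℤ * z) (sym (⊗ᵥ-distrib-comb W x (λ i → B⁻¹ ⊗ᵥ 𝟙 (i ↑ˡ m)) k))))
      (proj₂ (proj₂ (proj₂ dep)) r))
    w-even : ∀ k → + 2 ∣ w k
    w-even = Aᵀ-even⇒even w (split-cases h (∣Aᵀ-left w (Perp-lin c 1ℤ Pβ (proj₁ keyed))) (proj₂ keyed))
    Bq : ∀ k → (B ⊗ᵥ q) k ≡ sum (λ i → x i * 𝟙 (i ↑ˡ m) k)
    Bq k = trans (⊗ᵥ-distrib-comb B x (λ i → B⁻¹ ⊗ᵥ 𝟙 (i ↑ˡ m)) k) (sum-cong (λ i → cong (_*_ (x i)) (BB⁻¹ (𝟙 (i ↑ˡ m)) k)))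
    A⁻¹w : ∀ k → (A⁻¹ ⊗ᵥ w) k ≡ c * (A⁻¹ ⊗ᵥ β) k + 1ℤ * (D k * (B ⊗ᵥ q) k)
    A⁻¹w k = trans (⟪⟫-linʳ c 1ℤ (A⁻¹ k) β (W ⊗ᵥ q)) (cong (λ z → c * (A⁻¹ ⊗ᵥ β) k + 1ℤ * z) (A⁻¹W q k))
    even : ∀ k → + 2 ∣ c * (A⁻¹ ⊗ᵥ β) k + 1ℤ * (D k * (B ⊗ᵥ q) k)
    even k = subst (+ 2 ∣_) (A⁻¹w k) (∣-⟪⟫ (A⁻¹ k) w-even)
    even-right : ∀ r → + 2 ∣ c * (A⁻¹ ⊗ᵥ β) (h ↑ʳ r)
    even-right r = ∣m+n∣n⇒∣m (even (h ↑ʳ r)) (∣n⇒∣m*n 1ℤ (∣m⇒∣m*n ((B ⊗ᵥ q) (h ↑ʳ r))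
      (subst (+ 2 ∣_) (sym (D-two r)) (∣m⇒∣m*n (o r) ∣-refl))))
    coefficient : ∀ i → 1ℤ * (D (i ↑ˡ m) * (B ⊗ᵥ q) (i ↑ˡ m)) ≡ x i
    coefficient i = begin
      1ℤ * (D (i ↑ˡ m) * (B ⊗ᵥ q) (i ↑ˡ m))       ≡⟨ ℤ.*-identityˡ _ ⟩
      D (i ↑ˡ m) * (B ⊗ᵥ q) (i ↑ˡ m)              ≡⟨ cong₂ _*_ (D-one i) (Bq (i ↑ˡ m)) ⟩
      1ℤ * sum (λ j → x j * 𝟙 (j ↑ˡ m) (i ↑ˡ m))  ≡⟨ ℤ.*-identityˡ _ ⟩
      sum (λ j → x j * 𝟙 (j ↑ˡ m) (i ↑ˡ m))       ≡⟨ sum-single i (λ j → x j * 𝟙 (j ↑ˡ m) (i ↑ˡ m)) (λ j j≢i →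
        trans (cong (_*_ (x j)) (𝟙-off (λ eq → j≢i (Fin.↑ˡ-injective m j i eq)))) (ℤ.*-zeroʳ (x j))) ⟩
      x i * 𝟙 (i ↑ˡ m) (i ↑ˡ m)                   ≡⟨ trans (cong (_*_ (x i)) (𝟙-diag (i ↑ˡ m))) (ℤ.*-identityʳ (x i)) ⟩
      x i                                         ∎
      where open ≡-Reasoning
    -- An even c would make every x i even, against nontriviality. An odd c can be cancelled on the
    -- right block.
    conclude : Dec (+ 2 ∣ c) → ∀ r → + 2 ∣ (A⁻¹ ⊗ᵥ β) (h ↑ʳ r)
    conclude (no 2∤c)  r = PrimeIdeal.cancel 2-prime c 2∤c (even-right r)
    conclude (yes 2∣c) r = contradiction nontrivial λ
      { (inj₁ 2∤c) → 2∤c 2∣c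
      ; (inj₂ (i , 2∤xi)) → 2∤xi (subst (+ 2 ∣_) (coefficient i)
          (∣m+n∣m⇒∣n (even (i ↑ˡ m)) (∣m⇒∣m*n ((A⁻¹ ⊗ᵥ β) (i ↑ˡ m)) 2∣c))) }

  ∣⟪_,W⟫ : ∀ β → (∀ l → p ∣ ⟪ β , walk S l ⟫) → ∀ y → p ∣ ⟪ β , W ⊗ᵥ y ⟫
  ∣⟪_,W⟫ {p} β h y = subst (p ∣_)
    (sym (trans (⟪⟫-congʳ β (⊗ᵥ-comb W y)) (⟪⟫-comb β y (W ᵀ))))
    (∣-sum (λ l → ∣n⇒∣m*n (y l) (h (toℕ l))))

  -- ε is the parity of the order h + m = 2m + ε. A walk of length at least ε has even pairing with
  -- every walk; for odd order this leaves out 𝟏, whose norm is the order.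
  module _
    (ε : ℕ) (ε≤1 : ε ℕ.≤ 1) (h≡ : h ≡ ε ℕ.+ m) (even-moment : ∀ k → + 2 ∣ moment S (k ℕ.+ ε))
    (perp : ∀ β → Perp β → ∀ r → + 2 ∣ (A⁻¹ ⊗ᵥ β) (h ↑ʳ r))
    {T : Matrix ℤ (h ℕ.+ m)} (I : Intertwiner (+ 2) S T)
    where

    open Intertwiner I

    module Row (k₀ : Fin (h ℕ.+ m)) where
      u : Vector ℤ (h ℕ.+ m)
      u = N k₀

      u-perp : Perp u
      u-perp = ∣⟪ u ,W⟫ λ l → subst (+ 2 ∣_) (sym (N-iter l 𝟏 k₀))
        (∣-iter T l (λ i → subst (+ 2 ∣_) (sym (fixes-𝟏 i)) ∣-refl) k₀)

      -- As u is row k₀ of N and N Nᵀ = 4, N u is 4 times a unit vector, and pairing with u is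
      -- coordinate k₀ of N, which turns S into T.
      4∣⟪u,iter⟫ : ∀ l → + 4 ∣ ⟪ u , iter S l u ⟫
      4∣⟪u,iter⟫ l = subst (+ 4 ∣_) (sym (N-iter l u k₀)) (∣-iter T l (λ i → subst (+ 4 ∣_) (sym (Nu i)) (∣m⇒∣m*n (𝟙 k₀ i) ∣-refl)) k₀)
        where
        Nu : ∀ i → (N ⊗ᵥ u) i ≡ + 4 * 𝟙 k₀ i
        Nu i = trans (⊗ᵥ-cong N (λ j → sym (⊗ᵥ-basis (N ᵀ) k₀ j)) i) (NNᵀ (λ ()) (𝟙 k₀) i)

      e : Fin m → ℕ
      e i = toℕ i ℕ.+ ε

      a : Fin m → Vector ℤ (h ℕ.+ m)
      a i = walk S (e i)

      a-perp : ∀ i → Perp (a i)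
      a-perp i = ∣⟪ a i ,W⟫ λ l → subst (+ 2 ∣_) (sym (trans (⟪⟫-comm (a i) (walk S l)) (walk-gram skew l (e i))))
        (∣n⇒∣m*n (sgn l) (subst (λ q → + 2 ∣ moment S q) (ℕ.+-assoc l (toℕ i) ε) (even-moment (l ℕ.+ toℕ i))))

      -- u and the m walks a i all lie in `Perp`, whose dimension modulo 2 is m. The right
      -- coordinates of Aᵀ supply the m conditions, the left ones being even already. The aim is to
      -- show all x i even, so that c is odd.
      dep = dependent (λ r → (A ᵀ) (h ↑ʳ r)) u a
      c = proj₁ dep
      x = proj₁ (proj₂ dep)
      nontrivial = proj₁ (proj₂ (proj₂ dep))

      y w : Vector ℤ (h ℕ.+ m)
      y = comb x a
      w k = c * u k + 1ℤ * y k

      w-even : ∀ k → + 2 ∣ w k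
      w-even = Aᵀ-even⇒even w (split-cases h (∣Aᵀ-left w (Perp-lin c 1ℤ u-perp (Perp-comb x a-perp))) (proj₂ (proj₂ (proj₂ dep))))

      w/2 : Vector ℤ (h ℕ.+ m)
      w/2 k = quotient (w-even k)

      y≡ : ∀ k → y k ≡ + 2 * w/2 k + (- c) * u k
      y≡ k = trans (isolate c (u k) (y k)) (cong (_+ (- c) * u k) (trans (_∣_.equality (w-even k)) (ℤ.*-comm (w/2 k) (+ 2))))
        where
        isolate : ∀ c u y → y ≡ (c * u + 1ℤ * y) + (- c) * u
        isolate = solve-∀

      -- y = 2 w/2 - c u, and even powers of S are symmetric, so the two cross terms coincide and
      -- together acquire a factor 4.
      4∣⟪y,iter⟫ : ∀ l → + 4 ∣ ⟪ y , iter S (l ℕ.+ l) y ⟫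
      4∣⟪y,iter⟫ l = subst (+ 4 ∣_) (sym expand) (∣m∣n⇒∣m+n
          (∣m⇒∣m*n (⟪ β , G β ⟫ - c * ⟪ β , G u ⟫) (∣-refl {+ 4})) (∣n⇒∣m*n (c * c) (4∣⟪u,iter⟫ (l ℕ.+ l))))
        where
        open ≡-Reasoning
        β = w/2
        G = iter S (l ℕ.+ l)
        Gy : G y ≗ (λ k → + 2 * G β k + (- c) * G u k)
        Gy k = trans (iter-cong S (l ℕ.+ l) y≡ k) (iter-lin S (l ℕ.+ l) (+ 2) (- c) β u k)
        G-symmetric : ⟪ u , G β ⟫ ≡ ⟪ β , G u ⟫
        G-symmetric = trans (⟪⟫-comm u (G β)) (trans (⟪⟫-iter skew (l ℕ.+ l) β u)
          (trans (cong (_* ⟪ β , G u ⟫) (sgn-double l)) (ℤ.*-identityˡ ⟪ β , G u ⟫)))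
        collect : ∀ bb bu uu c → + 2 * (+ 2 * bb + (- c) * bu) + (- c) * (+ 2 * bu + (- c) * uu) ≡ + 4 * (bb - c * bu) + c * c * uu
        collect = solve-∀
        expand : ⟪ y , G y ⟫ ≡ + 4 * (⟪ β , G β ⟫ - c * ⟪ β , G u ⟫) + c * c * ⟪ u , G u ⟫
        expand = begin
          ⟪ y , G y ⟫
            ≡⟨ trans (⟪⟫-congˡ (G y) y≡) (⟪⟫-linˡ (+ 2) (- c) (G y) β u) ⟩
          + 2 * ⟪ β , G y ⟫ + (- c) * ⟪ u , G y ⟫
            ≡⟨ cong₂ (λ s t → + 2 * s + (- c) * t)
                 (trans (⟪⟫-congʳ β Gy) (⟪⟫-linʳ (+ 2) (- c) β (G β) (G u)))
                 (trans (⟪⟫-congʳ u Gy) (⟪⟫-linʳ (+ 2) (- c) u (G β) (G u))) ⟩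
          + 2 * (+ 2 * ⟪ β , G β ⟫ + (- c) * ⟪ β , G u ⟫) + (- c) * (+ 2 * ⟪ u , G β ⟫ + (- c) * ⟪ u , G u ⟫)
            ≡⟨ cong (λ z → + 2 * (+ 2 * ⟪ β , G β ⟫ + (- c) * ⟪ β , G u ⟫) + (- c) * (+ 2 * z + (- c) * ⟪ u , G u ⟫)) G-symmetric ⟩
          + 2 * (+ 2 * ⟪ β , G β ⟫ + (- c) * ⟪ β , G u ⟫) + (- c) * (+ 2 * ⟪ β , G u ⟫ + (- c) * ⟪ u , G u ⟫)
            ≡⟨ collect ⟪ β , G β ⟫ ⟪ β , G u ⟫ ⟪ u , G u ⟫ c ⟩
          + 4 * (⟪ β , G β ⟫ - c * ⟪ β , G u ⟫) + c * c * ⟪ u , G u ⟫ ∎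

      -- The walks a i pair evenly under even powers of S, so the form is twice an integral
      -- symmetric form b. Its value at x is even, and modulo 2 only the diagonal of b counts.
      4∣moments : ∀ l → + 4 ∣ sum (λ i → x i * moment S ((l ℕ.+ l) ℕ.+ (e i ℕ.+ e i)))
      4∣moments l = subst (+ 4 ∣_) (sym halves) (*-monoʳ-∣ (+ 2) {+ 2} diagonal-even)
        where
        open ≡-Reasoning
        G = iter S (l ℕ.+ l)
        form : Fin m → Fin m → ℤ
        form i j = ⟪ a i , G (a j) ⟫
        form≡ : ∀ i j → form i j ≡ sgn (e i) * moment S (e i ℕ.+ ((l ℕ.+ l) ℕ.+ e j))
        form≡ i j = trans (⟪⟫-congʳ (a i) (λ k → sym (iter-+ S (l ℕ.+ l) (e j) 𝟏 k))) (walk-gram skew (e i) ((l ℕ.+ l) ℕ.+ e j))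
        form-even : ∀ i j → + 2 ∣ form i j
        form-even i j = subst (+ 2 ∣_) (sym (form≡ i j)) (∣n⇒∣m*n (sgn (e i))
          (subst (λ q → + 2 ∣ moment S q) (index (toℕ i) (toℕ j) l ε) (even-moment (toℕ i ℕ.+ ε ℕ.+ ((l ℕ.+ l) ℕ.+ toℕ j)))))
          where
          index : ∀ i j l ε → i ℕ.+ ε ℕ.+ ((l ℕ.+ l) ℕ.+ j) ℕ.+ ε ≡ i ℕ.+ ε ℕ.+ ((l ℕ.+ l) ℕ.+ (j ℕ.+ ε))
          index = ℕSolver.solve-∀
        b : Fin m → Fin m → ℤ
        b i j = quotient (form-even i j)
        form≡2b : ∀ i j → form i j ≡ + 2 * b i j
        form≡2b i j = trans (_∣_.equality (form-even i j)) (ℤ.*-comm (b i j) (+ 2))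
        form-symmetric : ∀ i j → form i j ≡ form j i
        form-symmetric i j = trans (⟪⟫-comm (a i) (G (a j))) (trans (⟪⟫-iter skew (l ℕ.+ l) (a j) (a i))
          (trans (cong (_* form j i) (sgn-double l)) (ℤ.*-identityˡ (form j i))))
        b-symmetric : ∀ i j → b i j ≡ b j i
        b-symmetric i j = *-cancel-≢0 {c = + 2} (λ ()) (trans (sym (form≡2b i j)) (trans (form-symmetric i j) (form≡2b j i)))
        swap : ∀ x y → x * (+ 2 * y) ≡ + 2 * (x * y)
        swap = solve-∀
        norm : ⟪ y , G y ⟫ ≡ + 2 * sum (λ i → x i * sum (λ j → x j * b i j))
        norm = begin
          ⟪ comb x a , G y ⟫                                  ≡⟨ ⟪⟫-combˡ (G y) x a ⟩
          sum (λ i → x i * ⟪ a i , G y ⟫)                     ≡⟨ sum-cong (λ i → cong (_*_ (x i)) (inner i)) ⟩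
          sum (λ i → x i * (+ 2 * sum (λ j → x j * b i j)))   ≡⟨ sum-cong (λ i → swap (x i) (sum (λ j → x j * b i j))) ⟩
          sum (λ i → + 2 * (x i * sum (λ j → x j * b i j)))   ≡⟨ sum-* (+ 2) (λ i → x i * sum (λ j → x j * b i j)) ⟩
          + 2 * sum (λ i → x i * sum (λ j → x j * b i j))     ∎
          where
          inner : ∀ i → ⟪ a i , G y ⟫ ≡ + 2 * sum (λ j → x j * b i j)
          inner i = trans (⟪⟫-congʳ (a i) (iter-comb S (l ℕ.+ l) x a))
            (trans (⟪⟫-comb (a i) x (λ j → G (a j)))
              (trans (sum-cong (λ j → trans (cong (_*_ (x j)) (form≡2b i j)) (swap (x j) (b i j))))
                (sum-* (+ 2) (λ j → x j * b i j))))
        moment≡ : ∀ i → moment S ((l ℕ.+ l) ℕ.+ (e i ℕ.+ e i)) ≡ + 2 * (sgn (e i) * b i i)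
        moment≡ i = begin
          moment S ((l ℕ.+ l) ℕ.+ (e i ℕ.+ e i))             ≡⟨ cong (moment S) (index l (e i)) ⟩
          μ                                                  ≡⟨ ℤ.*-identityˡ μ ⟨
          1ℤ * μ                                             ≡⟨ cong (_* μ) (sgn-sq (e i)) ⟨
          sgn (e i) * sgn (e i) * μ                          ≡⟨ ℤ.*-assoc (sgn (e i)) (sgn (e i)) μ ⟩
          sgn (e i) * (sgn (e i) * μ)                        ≡⟨ cong (_*_ (sgn (e i))) (trans (sym (form≡ i i)) (form≡2b i i)) ⟩
          sgn (e i) * (+ 2 * b i i)                          ≡⟨ swap (sgn (e i)) (b i i) ⟩
          + 2 * (sgn (e i) * b i i)                          ∎
          where
          μ = moment S (e i ℕ.+ ((l ℕ.+ l) ℕ.+ e i))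
          index : ∀ l e → (l ℕ.+ l) ℕ.+ (e ℕ.+ e) ≡ e ℕ.+ ((l ℕ.+ l) ℕ.+ e)
          index = ℕSolver.solve-∀
        halves : sum (λ i → x i * moment S ((l ℕ.+ l) ℕ.+ (e i ℕ.+ e i))) ≡ + 2 * sum (λ i → x i * (sgn (e i) * b i i))
        halves = trans (sum-cong (λ i → trans (cong (_*_ (x i)) (moment≡ i)) (swap (x i) (sgn (e i) * b i i))))
          (sum-* (+ 2) (λ i → x i * (sgn (e i) * b i i)))
        diagonal-even : + 2 ∣ sum (λ i → x i * (sgn (e i) * b i i))
        diagonal-even = ≋-∣ (≋-sum (λ i → ≋-*ˡ (x i) (≋-trans (≋-* (sgn≋1 (e i)) (≋-refl {b i i})) (≡⇒≋ (ℤ.*-identityˡ (b i i))))))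
          (≋-∣ (≋-sym (symmetric-form≋diagonal b b-symmetric x)) (halve (subst (+ 4 ∣_) norm (4∣⟪y,iter⟫ l))))

      -- If y is g(S) 𝟏 with coefficients x, this is g(S²) 𝟏.
      α : Vector ℤ (h ℕ.+ m)
      α = comb x (λ i → walk S (e i ℕ.+ e i))

      -- Even walks are covered by `4∣moments`; odd walks pair to odd moments, which vanish.
      4∣⟪α,W⟫ : ∀ y → + 4 ∣ ⟪ α , W ⊗ᵥ y ⟫
      4∣⟪α,W⟫ = ∣⟪ α ,W⟫ λ l → subst (+ 4 ∣_) (sym (expand l)) (by-parity l (parity l))
        where
        expand : ∀ l → ⟪ α , walk S l ⟫ ≡ sum (λ i → x i * (sgn l * moment S (l ℕ.+ (e i ℕ.+ e i))))
        expand l = trans (⟪⟫-comm α (walk S l)) (trans (⟪⟫-comb (walk S l) x (λ i → walk S (e i ℕ.+ e i)))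
          (sum-cong (λ i → cong (_*_ (x i)) (walk-gram skew l (e i ℕ.+ e i)))))
        by-parity : ∀ l → (∃ λ j → l ≡ j ℕ.+ j ⊎ l ≡ suc (j ℕ.+ j)) →
          + 4 ∣ sum (λ i → x i * (sgn l * moment S (l ℕ.+ (e i ℕ.+ e i))))
        by-parity l (j , inj₁ refl) = subst (+ 4 ∣_)
          (sum-cong (λ i → cong (_*_ (x i)) (sym (trans (cong (_* moment S ((j ℕ.+ j) ℕ.+ (e i ℕ.+ e i))) (sgn-double j)) (ℤ.*-identityˡ _)))))
          (4∣moments j)
        by-parity l (j , inj₂ refl) = ∣-sum (λ i → ∣n⇒∣m*n (x i) (∣n⇒∣m*n (sgn l)
          (subst (+ 4 ∣_) (sym (trans (cong (moment S) (index j (e i))) (moment-odd skew (j ℕ.+ e i)))) (divides 0ℤ refl))))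
          where
          index : ∀ j e → suc (j ℕ.+ j) ℕ.+ (e ℕ.+ e) ≡ suc ((j ℕ.+ e) ℕ.+ (j ℕ.+ e))
          index = ℕSolver.solve-∀

      Aᵀα-even : ∀ k → + 2 ∣ (A ᵀ ⊗ᵥ α) k
      Aᵀα-even = split-cases h
        (λ i → ∣-trans (divides (+ 2) refl) (∣Aᵀ-left α 4∣⟪α,W⟫ i))
        (λ r → PrimeIdeal.cancel 2-prime (o r) (o-odd r) (halve (subst (+ 4 ∣_)
          (trans (cong (_* (A ᵀ ⊗ᵥ α) (h ↑ʳ r)) (D-two r)) (ℤ.*-assoc (+ 2) (o r) _)) (∣D*Aᵀ α 4∣⟪α,W⟫ (h ↑ʳ r)))))

      α-even : ∀ k → + 2 ∣ α k
      α-even = Aᵀ-even⇒even α Aᵀα-even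

      α/2 : Vector ℤ (h ℕ.+ m)
      α/2 k = quotient (α-even k)

      α≡ : ∀ k → α k ≡ + 2 * α/2 k
      α≡ k = trans (_∣_.equality (α-even k)) (ℤ.*-comm (α/2 k) (+ 2))

      -- Divisibility by 4 is used twice. On the right block one factor 2 is absorbed by D and the
      -- other makes α even; on the left block D is 1, so a factor 2 survives halving.
      α/2-perp : Perp α/2
      α/2-perp = left⇒Perp α/2 (λ i → halve (subst (+ 4 ∣_)
        (trans (⊗ᵥ-cong (A ᵀ) α≡ (i ↑ˡ m)) (⟪⟫-*ʳ (+ 2) ((A ᵀ) (i ↑ˡ m)) α/2)) (∣Aᵀ-left α 4∣⟪α,W⟫ i)))

      -- The largest exponent is 2(m - 1 + ε), below 2m + ε because ε ≤ 1. So every walk occurring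
      -- in α is a column of W.
      e+e< : ∀ i → e i ℕ.+ e i ℕ.< h ℕ.+ m
      e+e< i = subst₂ ℕ._<_ (sym (index (toℕ i) ε)) (trans (index′ m ε) (cong (ℕ._+ m) (sym h≡)))
        (ℕ.+-monoˡ-< ε (ℕ.<-≤-trans (s≤s (ℕ.+-monoʳ-≤ (toℕ i ℕ.+ toℕ i) ε≤1)) room))
        where
        index : ∀ i ε → i ℕ.+ ε ℕ.+ (i ℕ.+ ε) ≡ (i ℕ.+ i ℕ.+ ε) ℕ.+ ε
        index = ℕSolver.solve-∀
        index′ : ∀ m ε → (m ℕ.+ m) ℕ.+ ε ≡ ε ℕ.+ m ℕ.+ m
        index′ = ℕSolver.solve-∀
        room : suc (toℕ i ℕ.+ toℕ i ℕ.+ 1) ℕ.≤ m ℕ.+ m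
        room = subst (ℕ._≤ m ℕ.+ m) (index″ (toℕ i)) (ℕ.+-mono-≤ (Fin.toℕ<n i) (Fin.toℕ<n i))
          where
          index″ : ∀ i → suc i ℕ.+ suc i ≡ suc (i ℕ.+ i ℕ.+ 1)
          index″ = ℕSolver.solve-∀

      position : Fin m → Fin (h ℕ.+ m)
      position i = fromℕ< (e+e< i)

      position-injective : ∀ i j → position i ≡ position j → i ≡ j
      position-injective i j eq = Fin.toℕ-injective (ℕ.+-cancelʳ-≡ ε (toℕ i) (toℕ j)
        (double-injective (e i) (e j) (trans (sym (Fin.toℕ-fromℕ< (e+e< i))) (trans (cong toℕ eq) (Fin.toℕ-fromℕ< (e+e< j))))))
        where
        double-injective : ∀ i j → i ℕ.+ i ≡ j ℕ.+ j → i ≡ j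
        double-injective zero    zero    _  = refl
        double-injective (suc i) (suc j) eq = cong suc (double-injective i j
          (ℕ.suc-injective (trans (sym (ℕ.+-suc i i)) (trans (ℕ.suc-injective eq) (ℕ.+-suc j j)))))

      x̃ : Vector ℤ (h ℕ.+ m)
      x̃ = comb x (λ i → 𝟙 (position i))

      Wx̃ : W ⊗ᵥ x̃ ≗ α
      Wx̃ k = trans (⊗ᵥ-distrib-comb W x (λ i → 𝟙 (position i)) k)
        (sum-cong (λ i → cong (_*_ (x i)) (trans (krylov-column S (position i) k) (cong (λ q → walk S q k) (Fin.toℕ-fromℕ< (e+e< i))))))

      DBx̃ : ∀ k → D k * (B ⊗ᵥ x̃) k ≡ + 2 * (A⁻¹ ⊗ᵥ α/2) k
      DBx̃ k = trans (sym (A⁻¹W x̃ k)) (trans (⊗ᵥ-cong A⁻¹ (λ j → trans (Wx̃ j) (α≡ j)) k) (⟪⟫-*ʳ (+ 2) (A⁻¹ k) α/2))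

      -- On the left block D is 1 and the factor 2 of α remains. On the right block it cancels
      -- against D, and the evenness comes from `perp`: α/2 lies in the column space modulo 2.
      Bx̃-even : ∀ k → + 2 ∣ (B ⊗ᵥ x̃) k
      Bx̃-even = split-cases h
        (λ i → subst (+ 2 ∣_) (trans (sym (DBx̃ (i ↑ˡ m))) (trans (cong (_* (B ⊗ᵥ x̃) (i ↑ˡ m)) (D-one i)) (ℤ.*-identityˡ _)))
          (∣m⇒∣m*n ((A⁻¹ ⊗ᵥ α/2) (i ↑ˡ m)) ∣-refl))
        (λ r → PrimeIdeal.cancel 2-prime (o r) (o-odd r) (subst (+ 2 ∣_)
          (sym (*-cancel-≢0 {c = + 2} (λ ()) (trans (sym (ℤ.*-assoc (+ 2) (o r) _))
            (trans (cong (_* (B ⊗ᵥ x̃) (h ↑ʳ r)) (sym (D-two r))) (DBx̃ (h ↑ʳ r))))))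
          (perp α/2 α/2-perp r)))

      x-even : ∀ i → + 2 ∣ x i
      x-even i = subst (+ 2 ∣_) (trans (B⁻¹B x̃ (position i)) at) (∣-⟪⟫ (B⁻¹ (position i)) Bx̃-even)
        where
        at : x̃ (position i) ≡ x i
        at = trans (sum-single i (λ j → x j * 𝟙 (position j) (position i))
            (λ j j≢i → trans (cong (_*_ (x j)) (𝟙-off (λ eq → j≢i (position-injective j i eq)))) (ℤ.*-zeroʳ (x j))))
          (trans (cong (_*_ (x i)) (𝟙-diag (position i))) (ℤ.*-identityʳ (x i)))

      -- With all x i even, nontriviality makes c odd, and c u = w - y is even.
      u-even : ∀ k → + 2 ∣ u k
      u-even k = PrimeIdeal.cancel 2-prime c 2∤c (∣m+n∣n⇒∣m (w-even k)
        (∣n⇒∣m*n 1ℤ (∣-sum (λ i → ∣m⇒∣m*n (a i k) (x-even i)))))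
        where
        2∤c : ¬ + 2 ∣ c
        2∤c = Sum.[ (λ 2∤c → 2∤c) , (λ { (i , 2∤xi) → contradiction (x-even i) 2∤xi }) ]′ nontrivial

module _ {h m : ℕ} {S : Matrix ℤ (h ℕ.+ m)} (skew : Skew S) {D : Vector ℤ (h ℕ.+ m)} (F : Factorisation (krylov S) D)
  (D-one : ∀ i → D (i ↑ˡ m) ≡ 1ℤ) {o : Fin m → ℤ} (o-odd : ∀ r → ¬ + 2 ∣ o r)
  (D-two : ∀ r → D (h ↑ʳ r) ≡ + 2 * o r) where

  open Factorisation F
  open TwoPart skew F D-one o-odd D-two

  ⟪Wq,walk⟫ : ∀ q l → ⟪ krylov S ⊗ᵥ q , walk S l ⟫ ≡ sum (λ k → q k * (sgn (toℕ k) * moment S (toℕ k ℕ.+ l)))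
  ⟪Wq,walk⟫ q l = trans (⟪⟫-congˡ (walk S l) (⊗ᵥ-comb (krylov S) q))
    (trans (⟪⟫-combˡ (walk S l) q (krylov S ᵀ)) (sum-cong (λ k → cong (_*_ (q k)) (walk-gram skew (toℕ k) l))))

  -- For even order all moments are even, so the column space of W is orthogonal to itself modulo 2,
  -- and both it and `Perp` have dimension h = m.
  perp-even : h ≡ m → + 2 ∣ moment S 0 → ∀ β → Perp β → ∀ r → + 2 ∣ (A⁻¹ ⊗ᵥ β) (h ↑ʳ r)
  perp-even refl 2∣n = perp⊆column-space (λ r → (A ᵀ) (h ↑ʳ r)) λ c β q _ even →
      (∣⟪ krylov S ⊗ᵥ q ,W⟫ λ l → subst (+ 2 ∣_) (sym (⟪Wq,walk⟫ q l))
        (∣-sum (λ k → ∣n⇒∣m*n (q k) (∣n⇒∣m*n (sgn (toℕ k)) (all-even (toℕ k ℕ.+ l))))))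
    , even
    where
    all-even : ∀ k → + 2 ∣ moment S k
    all-even zero    = 2∣n
    all-even (suc k) = moment-even skew k

-- For odd order the column space has dimension m + 1, and 𝟏 is not orthogonal to itself. The
-- additional equation ⟨𝟏, w⟩ ≡ 0 makes the coefficient of 𝟏 in W q even, and the remaining columns
-- pair evenly with every walk.
perp-odd : {S : Matrix ℤ (suc m ℕ.+ m)} (skew : Skew S) {D : Vector ℤ (suc m ℕ.+ m)} (F : Factorisation (krylov S) D)
  (D-one : ∀ i → D (i ↑ˡ m) ≡ 1ℤ) {o : Fin m → ℤ} (o-odd : ∀ r → ¬ + 2 ∣ o r)
  (D-two : ∀ r → D (suc m ↑ʳ r) ≡ + 2 * o r) → ¬ + 2 ∣ moment S 0 →
  ∀ β → TwoPart.Perp skew F D-one o-odd D-two β → ∀ r → + 2 ∣ (Factorisation.A⁻¹ F ⊗ᵥ β) (suc m ↑ʳ r)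
perp-odd {m} {S} skew {D} F D-one o-odd D-two 2∤n = perp⊆column-space φ key
  where
  open Factorisation F
  open TwoPart skew F D-one o-odd D-two
  W = krylov S
  φ : Fin (suc m) → Vector ℤ (suc m ℕ.+ m)
  φ zero    = 𝟏
  φ (suc r) = (A ᵀ) (suc m ↑ʳ r)
  key : ∀ c β q → Perp β → let w = λ k → c * β k + 1ℤ * (W ⊗ᵥ q) k in
    (∀ r → + 2 ∣ ⟪ φ r , w ⟫) → Perp (W ⊗ᵥ q) × (∀ r → + 2 ∣ (A ᵀ ⊗ᵥ w) (suc m ↑ʳ r))
  key c β q Pβ even = (∣⟪ W ⊗ᵥ q ,W⟫ λ l → subst (+ 2 ∣_) (sym (⟪Wq,walk⟫ skew F D-one o-odd D-two q l)) (∣-sum (term l)))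
    , (λ r → even (suc r))
    where
    ⟪𝟏,β⟫-even : + 2 ∣ ⟪ 𝟏 , β ⟫
    ⟪𝟏,β⟫-even = subst (+ 2 ∣_) (trans (⟪⟫-congʳ β (krylov-column S zero)) (⟪⟫-comm β 𝟏)) (Pβ (𝟙 zero))
    ⟪𝟏,Wq⟫-even : + 2 ∣ ⟪ 𝟏 , W ⊗ᵥ q ⟫
    ⟪𝟏,Wq⟫-even = subst (+ 2 ∣_) (ℤ.*-identityˡ ⟪ 𝟏 , W ⊗ᵥ q ⟫)
      (∣m+n∣m⇒∣n (subst (+ 2 ∣_) (⟪⟫-linʳ c 1ℤ 𝟏 β (W ⊗ᵥ q)) (even zero)) (∣n⇒∣m*n c ⟪𝟏,β⟫-even))
    q₀-even : + 2 ∣ q zero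
    q₀-even = PrimeIdeal.cancel 2-prime (moment S 0) 2∤n (subst (+ 2 ∣_) (trans (cong (_*_ (q zero)) (ℤ.*-identityˡ (moment S 0))) (ℤ.*-comm (q zero) (moment S 0)))
      (∣m+n∣n⇒∣m (subst (+ 2 ∣_) (trans (⟪⟫-comm 𝟏 (W ⊗ᵥ q)) (⟪Wq,walk⟫ skew F D-one o-odd D-two q 0)) ⟪𝟏,Wq⟫-even)
        (∣-sum (λ k → ∣n⇒∣m*n (q (suc k)) (∣n⇒∣m*n (sgn (suc (toℕ k))) (moment-even skew (toℕ k ℕ.+ 0)))))))
    term : ∀ l k → + 2 ∣ q k * (sgn (toℕ k) * moment S (toℕ k ℕ.+ l))
    term l zero    = ∣m⇒∣m*n (1ℤ * moment S l) q₀-even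
    term l (suc k) = ∣n⇒∣m*n (q (suc k)) (∣n⇒∣m*n (sgn (suc (toℕ k))) (moment-even skew (toℕ k ℕ.+ l)))

moment-0 : (S : Matrix ℤ n) → moment S 0 ≡ + n
moment-0 {zero}  S = refl
moment-0 {suc n} S = cong (_+_ 1ℤ) (moment-0 {n} 𝟙)

-- Integral isometries fixing 𝟏 are permutations

0≤i*i-i : ∀ i → 0ℤ ℤ.≤ i * i - i
0≤i*i-i (+ zero)  = ℤ.≤-refl
0≤i*i-i (+ suc k) = subst (0ℤ ℤ.≤_) (factor (+ k)) (subst (0ℤ ℤ.≤_) (ℤ.pos-* (suc k) k) (ℤ.+≤+ z≤n))
  where
  factor : ∀ i → (1ℤ + i) * i ≡ (1ℤ + i) * (1ℤ + i) - (1ℤ + i)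
  factor = solve-∀
0≤i*i-i -[1+ k ]  = subst (0ℤ ℤ.≤_) (factor (+ suc k)) (subst (0ℤ ℤ.≤_) (ℤ.pos-* (suc k) (suc (suc k))) (ℤ.+≤+ z≤n))
  where
  factor : ∀ i → i * (1ℤ + i) ≡ (- i) * (- i) - (- i)
  factor = solve-∀

sum-nonneg : {f : Vector ℤ n} → (∀ i → 0ℤ ℤ.≤ f i) → 0ℤ ℤ.≤ sum f
sum-nonneg {zero}  h = ℤ.≤-refl
sum-nonneg {suc n} h = ℤ.+-mono-≤ (h zero) (sum-nonneg (h ∘ suc))

nonneg-+-zero : ∀ {i j} → 0ℤ ℤ.≤ i → 0ℤ ℤ.≤ j → i + j ≡ 0ℤ → i ≡ 0ℤ × j ≡ 0ℤ
nonneg-+-zero {+ zero}  {+ zero}  _ _ _  = refl , refl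
nonneg-+-zero {+ zero}  {+ suc _} _ _ ()
nonneg-+-zero {+ suc _} {+ _}     _ _ ()

sum-nonneg-zero : {f : Vector ℤ n} → (∀ i → 0ℤ ℤ.≤ f i) → sum f ≡ 0ℤ → ∀ i → f i ≡ 0ℤ
sum-nonneg-zero {suc n} {f} h eq zero    = proj₁ (nonneg-+-zero (h zero) (sum-nonneg (h ∘ suc)) eq)
sum-nonneg-zero {suc n} {f} h eq (suc i) =
  sum-nonneg-zero (h ∘ suc) (proj₂ (nonneg-+-zero (h zero) (sum-nonneg (h ∘ suc)) eq)) i

indicator : (z : Vector ℤ n) → (∀ i → z i ≡ 0ℤ ⊎ z i ≡ 1ℤ) → sum z ≡ 1ℤ → ∃ λ j → z ≗ 𝟙 j
indicator {suc n} z bit total with bit zero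
... | inj₁ z₀≡0 with indicator (z ∘ suc) (bit ∘ suc) (trans (sym (ℤ.+-identityˡ _)) (trans (cong (_+ sum (z ∘ suc)) (sym z₀≡0)) total))
...   | j , z≗ = suc j , λ { zero → z₀≡0 ; (suc i) → z≗ i }
indicator {suc n} z bit total | inj₂ z₀≡1 = zero , λ { zero → z₀≡1 ; (suc i) → sum-nonneg-zero nonneg rest i }
  where
  nonneg : ∀ i → 0ℤ ℤ.≤ z (suc i)
  nonneg i = Sum.[ (λ eq → ℤ.≤-reflexive (sym eq)) , (λ eq → subst (0ℤ ℤ.≤_) (sym eq) (ℤ.+≤+ z≤n)) ]′ (bit (suc i))
  isolate : ∀ a b → b ≡ (a + b) - a
  isolate = solve-∀
  rest : sum (z ∘ suc) ≡ 0ℤ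
  rest = trans (isolate (z zero) (sum (z ∘ suc))) (cong₂ _-_ total z₀≡1)

-- Norm minus total is Σ (zᵢ² - zᵢ) = 0, a sum of nonnegative integers, so every zᵢ is 0 or 1.
unit-vector : (z : Vector ℤ n) → ⟪ z , z ⟫ ≡ 1ℤ → ⟪ z , 𝟏 ⟫ ≡ 1ℤ → ∃ λ j → z ≗ 𝟙 j
unit-vector z norm total = indicator z bit total′
  where
  total′ : sum z ≡ 1ℤ
  total′ = trans (sum-cong (λ i → sym (ℤ.*-identityʳ (z i)))) total
  excess : sum (λ i → z i * z i - z i) ≡ 0ℤ
  excess = begin
    sum (λ i → z i * z i - z i)                        ≡⟨ sum-+ (λ i → z i * z i) (λ i → - z i) ⟩
    ⟪ z , z ⟫ + sum (λ i → - z i)                      ≡⟨ cong₂ _+_ norm (sum-cong (λ i → sym (ℤ.-1*i≡-i (z i)))) ⟩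
    1ℤ + sum (λ i → - 1ℤ * z i)                        ≡⟨ cong (_+_ 1ℤ) (trans (sum-* (- 1ℤ) z) (cong (_*_ (- 1ℤ)) total′)) ⟩
    0ℤ                                                 ∎
    where open ≡-Reasoning
  factor : ∀ i → i * i - i ≡ i * (i - 1ℤ)
  factor = solve-∀
  bit : ∀ i → z i ≡ 0ℤ ⊎ z i ≡ 1ℤ
  bit i = Sum.map₂ (ℤ.i-j≡0⇒i≡j (z i) 1ℤ) (ℤ.i*j≡0⇒i≡0∨j≡0 (z i)
    (trans (sym (factor (z i))) (sum-nonneg-zero (λ i → 0≤i*i-i (z i)) excess i)))

𝟙-≡ : {i j : Fin n} → 𝟙 i j ≡ 1ℤ → i ≡ j
𝟙-≡ {i = i} {j} eq with i Fin.≟ j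
... | yes i≡j = i≡j
... | no  _   with () ← eq

-- N is orthogonal and fixes 𝟏, hence so does Nᵀ. Rows and columns of N are then unit vectors, and
-- their positions are mutually inverse maps.
permutation : {S T : Matrix ℤ n} → Intertwiner 1ℤ S T →
  ∃ λ (π : Fin n ↔ Fin n) → ∀ k l → T k l ≡ S (Inverse.to π k) (Inverse.to π l)
permutation {n} {S} {T} I = mk↔ₛ′ π σ πσ σπ , similar
  where
  open Intertwiner I
  N𝟙 : ∀ j → N ⊗ᵥ 𝟙 j ≗ (N ᵀ) j
  N𝟙 = ⊗ᵥ-basis N
  rows : ∀ k → ∃ λ j → N k ≗ 𝟙 j
  rows k = unit-vector (N k) (row-norm (λ ()) k) (fixes-𝟏 k)
  columns : ∀ j → ∃ λ k → (N ᵀ) j ≗ 𝟙 k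
  columns j = unit-vector ((N ᵀ) j)
    (begin
      ⟪ (N ᵀ) j , (N ᵀ) j ⟫            ≡⟨ trans (⟪⟫-congˡ ((N ᵀ) j) (sym ∘ N𝟙 j)) (⟪⟫-congʳ (N ⊗ᵥ 𝟙 j) (sym ∘ N𝟙 j)) ⟩
      ⟪ N ⊗ᵥ 𝟙 j , N ⊗ᵥ 𝟙 j ⟫          ≡⟨ isometry (𝟙 j) (𝟙 j) ⟩
      1ℤ * ⟪ 𝟙 j , 𝟙 j ⟫               ≡⟨ trans (ℤ.*-identityˡ ⟪ 𝟙 j , 𝟙 j ⟫) (trans (𝟙-⊗ᵥ (𝟙 j) j) (𝟙-diag j)) ⟩
      1ℤ                               ∎)
    (begin
      (N ᵀ ⊗ᵥ 𝟏) j                     ≡⟨ ⊗ᵥ-cong (N ᵀ) (sym ∘ fixes-𝟏) j ⟩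
      (N ᵀ ⊗ᵥ (N ⊗ᵥ 𝟏)) j              ≡⟨ NᵀN 𝟏 j ⟩
      1ℤ                               ∎)
    where open ≡-Reasoning
  π σ : Fin n → Fin n
  π k = proj₁ (rows k)
  σ j = proj₁ (columns j)
  πσ : ∀ j → π (σ j) ≡ j
  πσ j = 𝟙-≡ (trans (sym (proj₂ (rows (σ j)) j)) (trans (proj₂ (columns j) (σ j)) (𝟙-diag (σ j))))
  σπ : ∀ k → σ (π k) ≡ k
  σπ k = 𝟙-≡ (trans (sym (proj₂ (columns (π k)) k)) (trans (proj₂ (rows k) (π k)) (𝟙-diag (π k))))
  similar : ∀ k l → T k l ≡ S (π k) (π l)
  similar k l = sym (begin
    S (π k) (π l)                     ≡⟨ ⊗ᵥ-basis S (π l) (π k) ⟨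
    (S ⊗ᵥ 𝟙 (π l)) (π k)              ≡⟨ 𝟙-⊗ᵥ (S ⊗ᵥ 𝟙 (π l)) (π k) ⟨
    ⟪ 𝟙 (π k) , S ⊗ᵥ 𝟙 (π l) ⟫        ≡⟨ ⟪⟫-congˡ (S ⊗ᵥ 𝟙 (π l)) (sym ∘ proj₂ (rows k)) ⟩
    (N ⊗ᵥ (S ⊗ᵥ 𝟙 (π l))) k           ≡⟨ commutes (𝟙 (π l)) k ⟩
    (T ⊗ᵥ (N ⊗ᵥ 𝟙 (π l))) k           ≡⟨ ⊗ᵥ-cong T (λ j → trans (N𝟙 (π l) j) (trans (proj₂ (columns (π l)) j) (cong (λ q → 𝟙 q j) (σπ l)))) k ⟩
    (T ⊗ᵥ 𝟙 l) k                      ≡⟨ ⊗ᵥ-basis T l k ⟩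
    T k l                             ∎)
    where open ≡-Reasoning

-- Oriented graphs

module _ (Γ : OrientedGraph n) where
  open OrientedGraph Γ

  edge⇒1 : ∀ {i j} → i ⟶ j → skewAdjacency Γ i j ≡ 1ℤ
  edge⇒1 {i} {j} i⟶j = cong (λ b → if b then 1ℤ else if does (j ⟶? i) then -1ℤ else 0ℤ) (dec-true (i ⟶? j) i⟶j)

  1⇒edge : ∀ {i j} → skewAdjacency Γ i j ≡ 1ℤ → i ⟶ j
  1⇒edge {i} {j} eq with i ⟶? j | j ⟶? i
  ... | yes i⟶j | _     = i⟶j
  ... | no  _   | yes _ with () ← eq
  1⇒edge {i} {j} () | no _ | no _

  skewAdjacency-skew : Skew (skewAdjacency Γ)
  skewAdjacency-skew i j with i ⟶? j | j ⟶? i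
  ... | yes i⟶j | yes j⟶i = contradiction j⟶i (asym i⟶j)
  ... | yes _   | no  _   = refl
  ... | no  _   | yes _   = refl
  ... | no  _   | no  _   = refl

  no-loop : ∀ {i} → ¬ (i ⟶ i)
  no-loop i⟶i = asym i⟶i i⟶i

self-converse⇒reverses : (Γ : OrientedGraph n) (sc : SelfConverse Γ) → Reverses (skewAdjacency Γ) (proj₁ sc)
self-converse⇒reverses Γ (π , edges) i j = trans
  (cong₂ (λ b c → if b then 1ℤ else if c then -1ℤ else 0ℤ)
    (sym (does-⇔ (edges j i) (j ⟶? i) (to i ⟶? to j)))
    (sym (does-⇔ (edges i j) (i ⟶? j) (to j ⟶? to i))))
  (skewAdjacency-skew Γ j i)
  where
  open OrientedGraph Γ
  open Inverse π using (to)

similar⇒≅ : (Γ Δ : OrientedGraph n) (π : Fin n ↔ Fin n) →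
  (∀ k l → skewAdjacency Δ k l ≡ skewAdjacency Γ (Inverse.to π k) (Inverse.to π l)) → Δ ≅ Γ
similar⇒≅ Γ Δ π similar = π , λ i j → mk⇔
  (λ e → 1⇒edge Γ (trans (sym (similar i j)) (edge⇒1 Δ e)))
  (λ e → 1⇒edge Δ (trans (similar i j) (edge⇒1 Γ e)))

smith⇒factorisation : (Γ : OrientedGraph n) {D : Vector ℤ n} → IsSmithNormalForm (walkMatrix Γ) D →
  Factorisation (krylov (skewAdjacency Γ)) D
smith⇒factorisation Γ {D} snf = record
  { A = U₁ ; B = U₂
  ; A-inv = unimodular⇒invertible unimodular₁ ; B-inv = unimodular⇒invertible unimodular₂
  ; factor = λ x i → begin
      ⟪ krylov S i , x ⟫                           ≡⟨ ⟪⟫-congˡ x (λ k → trans (sym (power-iter S (toℕ k) 𝟏 i)) (factorization i k)) ⟩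
      (((U₁ ⊗ diag D) ⊗ U₂) ⊗ᵥ x) i                ≡⟨ ⊗-⊗ᵥ (U₁ ⊗ diag D) U₂ x i ⟩
      ((U₁ ⊗ diag D) ⊗ᵥ (U₂ ⊗ᵥ x)) i               ≡⟨ ⊗-⊗ᵥ U₁ (diag D) (U₂ ⊗ᵥ x) i ⟩
      (U₁ ⊗ᵥ (diag D ⊗ᵥ (U₂ ⊗ᵥ x))) i              ≡⟨ ⊗ᵥ-cong U₁ (diag-⊗ᵥ D (U₂ ⊗ᵥ x)) i ⟩
      (U₁ ⊗ᵥ (λ i → D i * (U₂ ⊗ᵥ x) i)) i          ∎ }
  where
  open IsSmithNormalForm snf
  open ≡-Reasoning
  S = skewAdjacency Γ

-- The given invariant factors and the assembly of the proof

module _ (n : ℕ) (d : ℤ) where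
  private
    D = ones-twos-2d n d
    entry : Bool → Bool → ℤ
    entry b b′ = if b then 1ℤ else if b′ then + 2 * d else + 2

  entry-1 : ∀ i → toℕ i ℕ.< ⌈ n /2⌉ → D i ≡ 1ℤ
  entry-1 i i<h = cong (λ b → entry b (does (suc (toℕ i) ℕ.≟ n))) (dec-true (toℕ i ℕ.<? ⌈ n /2⌉) i<h)

  entry-2d : ∀ i → ¬ toℕ i ℕ.< ⌈ n /2⌉ → suc (toℕ i) ≡ n → D i ≡ + 2 * d
  entry-2d i i≮h i≡n = cong₂ entry (dec-false (toℕ i ℕ.<? ⌈ n /2⌉) i≮h) (dec-true (suc (toℕ i) ℕ.≟ n) i≡n)

  entry-2 : ∀ i → ¬ toℕ i ℕ.< ⌈ n /2⌉ → suc (toℕ i) ≢ n → D i ≡ + 2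
  entry-2 i i≮h i≢n = cong₂ entry (dec-false (toℕ i ℕ.<? ⌈ n /2⌉) i≮h) (dec-false (suc (toℕ i) ℕ.≟ n) i≢n)

-- Orders of at least two, written as ⌈n/2⌉ + ⌊n/2⌋. Both blocks are nonempty, so the last invariant
-- factor lies in the second one and is 2d.
module Main (h′ m′ : ℕ)
  (half : ⌈ suc h′ ℕ.+ suc m′ /2⌉ ≡ suc h′) (ε : ℕ) (ε≤1 : ε ℕ.≤ 1) (h≡ : suc h′ ≡ ε ℕ.+ suc m′)
  (Γ Δ : OrientedGraph (suc h′ ℕ.+ suc m′)) (sc : SelfConverse Γ) (d : ℤ) (odd : Odd d)
  (snf : IsSmithNormalForm (walkMatrix Γ) (ones-twos-2d (suc h′ ℕ.+ suc m′) d))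
  (moments : ∀ k → moment (skewAdjacency Γ) k ≡ moment (skewAdjacency Δ) k)
  where

  private
    h = suc h′
    k = suc m′
    N = h ℕ.+ k
    S = skewAdjacency Γ
    T = skewAdjacency Δ
    D = ones-twos-2d N d
    L = fromℕ (h′ ℕ.+ k)
    skewS = skewAdjacency-skew Γ
    skewT = skewAdjacency-skew Δ

  F : Factorisation (krylov S) D
  F = smith⇒factorisation Γ snf

  2∤d : ¬ + 2 ∣ d
  2∤d = odd ∘ ∣⇒∣ᵤ

  d≢0 : d ≢ 0ℤ
  d≢0 refl = 2∤d (divides 0ℤ refl)

  <half : ∀ {i} → i ℕ.< h → i ℕ.< ⌈ N /2⌉
  <half {i} = subst (i ℕ.<_) (sym half)

  ≮half : ∀ {i} → h ℕ.≤ i → ¬ i ℕ.< ⌈ N /2⌉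
  ≮half {i} h≤i i<h = ℕ.<⇒≱ (subst (i ℕ.<_) half i<h) h≤i

  D-last : D L ≡ + 2 * d
  D-last = entry-2d N d L
    (≮half (subst (h ℕ.≤_) (sym (Fin.toℕ-fromℕ (h′ ℕ.+ k))) (subst (h ℕ.≤_) (sym (ℕ.+-suc h′ m′)) (s≤s (ℕ.m≤m+n h′ m′)))))
    (cong suc (Fin.toℕ-fromℕ (h′ ℕ.+ k)))

  D-other : ∀ i → i ≢ L → ∃ λ e → e * D i ≡ + 2
  D-other i i≢L = by-cases (toℕ i ℕ.<? ⌈ N /2⌉)
    where
    by-cases : Dec (toℕ i ℕ.< ⌈ N /2⌉) → ∃ λ e → e * D i ≡ + 2
    by-cases (yes i<h) = + 2 , cong (_*_ (+ 2)) (entry-1 N d i i<h)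
    by-cases (no  i≮h) = 1ℤ , cong (_*_ 1ℤ) (entry-2 N d i i≮h
      (λ eq → i≢L (Fin.toℕ-injective (trans (ℕ.suc-injective eq) (sym (Fin.toℕ-fromℕ (h′ ℕ.+ k)))))))

  D-one : ∀ i → D (i ↑ˡ k) ≡ 1ℤ
  D-one i = entry-1 N d (i ↑ˡ k) (<half (subst (ℕ._< h) (sym (Fin.toℕ-↑ˡ i k)) (Fin.toℕ<n i)))

  D-right : ∀ r → ∃ λ o → (¬ + 2 ∣ o) × D (h ↑ʳ r) ≡ + 2 * o
  D-right r = by-cases (suc (toℕ (h ↑ʳ r)) ℕ.≟ N)
    where
    right : ¬ toℕ (h ↑ʳ r) ℕ.< ⌈ N /2⌉
    right = ≮half (subst (h ℕ.≤_) (sym (Fin.toℕ-↑ʳ h r)) (ℕ.m≤m+n h (toℕ r)))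
    by-cases : Dec (suc (toℕ (h ↑ʳ r)) ≡ N) → ∃ λ o → (¬ + 2 ∣ o) × D (h ↑ʳ r) ≡ + 2 * o
    by-cases (yes eq) = d , 2∤d , entry-2d N d (h ↑ʳ r) right eq
    by-cases (no neq) = 1ℤ , PrimeIdeal.proper 2-prime , entry-2 N d (h ↑ʳ r) right neq

  open Clearing skewS skewT moments F d≢0 D-last D-other using (Θ-intertwiner; d∣Θ)

  odd-prime : ∀ p → Prime p → + p ∣ d → ¬ + p ∣ + 2
  odd-prime p isPrime p∣d p∣2 with irreducible[2] (∣⇒∣ᵤ p∣2)
  ... | inj₁ refl = PrimeIdeal.proper (primeIdeal isPrime) ∣-refl
  ... | inj₂ refl = 2∤d p∣d

  coprime : ∀ x → d ∣ ⟪ Factorisation.A⁻¹ F L , Factorisation.A⁻¹ F L ⟫ * x → d ∣ x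
  coprime = coprime-cancel d≢0 λ p isPrime p∣d →
    OddPrime.p∤⟪v,v⟫ skewS (proj₁ sc) (self-converse⇒reverses Γ sc) F d≢0 D-last D-other
      (primeIdeal isPrime) (odd-prime p isPrime p∣d) p∣d

  twice : Intertwiner (+ 2) S T
  twice = divide d≢0 Θ-intertwiner (d∣Θ coprime)

  open TwoPart {h = h} {m = k} skewS F D-one (λ r → proj₁ (proj₂ (D-right r))) (λ r → proj₂ (proj₂ (D-right r)))

  isomorphic : (∀ i → + 2 ∣ moment S (i ℕ.+ ε)) →
    (∀ β → Perp β → ∀ r → + 2 ∣ (Factorisation.A⁻¹ F ⊗ᵥ β) (h ↑ʳ r)) → Δ ≅ Γ
  isomorphic even-moment perp = similar⇒≅ Γ Δ (proj₁ perm) (proj₂ perm)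
    where
    perm = permutation (divide {c = 1ℤ} {d = + 2} (λ ()) twice
      (Row.u-even ε ε≤1 h≡ even-moment perp twice))

2∣double : ∀ k → + 2 ∣ + (k ℕ.+ k)
2∣double k = divides (+ k) (trans (cong (λ q → + (k ℕ.+ q)) (sym (ℕ.+-identityʳ k))) (trans (ℤ.pos-* 2 k) (ℤ.*-comm (+ 2) (+ k))))

small-≅ : n ℕ.≤ 1 → (Γ Δ : OrientedGraph n) → Δ ≅ Γ
small-≅ n≤1 Γ Δ = ↔-id _ , λ i j → mk⇔
  (λ e → contradiction (subst (λ q → OrientedGraph._⟶_ Δ q j) (all-equal n≤1 i j) e) (no-loop Δ))
  (λ e → contradiction (subst (λ q → OrientedGraph._⟶_ Γ q j) (all-equal n≤1 i j) e) (no-loop Γ))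
  where
  all-equal : n ℕ.≤ 1 → (i j : Fin n) → i ≡ j
  all-equal (s≤s z≤n) zero zero = refl

determined : ∀ n (Γ Δ : OrientedGraph n) → SelfConverse Γ → (d : ℤ) → Odd d →
  IsSmithNormalForm (walkMatrix Γ) (ones-twos-2d n d) →
  (∀ {q} → n ≡ suc q → ∀ k → moment (skewAdjacency Γ) k ≡ moment (skewAdjacency Δ) k) → Δ ≅ Γ
determined n Γ Δ sc d odd snf moments with parity n
... | zero , inj₁ refl = small-≅ z≤n Γ Δ
-- One vertex, like none, leaves no room for an edge, and d does not occur among the invariant
-- factors.
... | zero , inj₂ refl = small-≅ (s≤s z≤n) Γ Δ
... | suc j , inj₁ refl = M.isomorphic (λ k → all-even (k ℕ.+ 0))
        (perp-even skewS M.F M.D-one (λ r → proj₁ (proj₂ (M.D-right r))) (λ r → proj₂ (proj₂ (M.D-right r))) refl (all-even 0))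
  where
  S = skewAdjacency Γ
  skewS = skewAdjacency-skew Γ
  module M = Main j j (sym (ℕ.n≡⌈n+n/2⌉ (suc j))) 0 z≤n refl Γ Δ sc d odd snf (moments refl)
  all-even : ∀ k → + 2 ∣ moment S k
  all-even zero    = subst (+ 2 ∣_) (sym (moment-0 S)) (2∣double (suc j))
  all-even (suc k) = moment-even skewS k
... | suc j , inj₂ refl = M.isomorphic
        (λ k → subst (λ q → + 2 ∣ moment S q) (ℕ.+-comm 1 k) (moment-even skewS k))
        (perp-odd skewS M.F M.D-one (λ r → proj₁ (proj₂ (M.D-right r))) (λ r → proj₂ (proj₂ (M.D-right r))) n-odd)
  where
  S = skewAdjacency Γ
  skewS = skewAdjacency-skew Γ
  module M = Main (suc j) j (cong suc (sym (ℕ.n≡⌊n+n/2⌋ (suc j)))) 1 (s≤s z≤n) refl Γ Δ sc d odd snf (moments refl)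
  n-odd : ¬ + 2 ∣ moment S 0
  n-odd 2∣n = PrimeIdeal.proper 2-prime
    (∣m+n∣n⇒∣m {n = + (suc j ℕ.+ suc j)} (subst (+ 2 ∣_) (moment-0 S) 2∣n) (2∣double (suc j)))

theorem1p6 : ∀ {c ℓ₁ ℓ₂} (K : AlgClosedField₀ c ℓ₁ ℓ₂) (n : ℕ) (Γ : OrientedGraph n) →
    SelfConverse Γ →
    (d : ℤ) → Odd d →
    IsSmithNormalForm (walkMatrix Γ) (ones-twos-2d n d) →
    Spectrum.DGSS K Γ
theorem1p6 K n Γ sc d odd snf Δ spectrum J-spectrum
  -- The order of Δ is read off from the length of its spectrum.
  with OverField.cospectral-size K {A = skewAdjacency Γ} {B = skewAdjacency Δ} spectrum
... | refl = determined n Γ Δ sc d odd snf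
  λ { refl → cospectral-moments K (skewAdjacency Γ) (skewAdjacency Δ) spectrum J-spectrum }
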